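{- Let $n\in\mathbb{D}$ be a squarefree integer with $n\equiv 1\pmod 4$. Let $q_1$ and $q_2$ be two positive binary quadratic forms of discriminant $-4n$. Then there exists a primitive two-dimensional sublattice $L\subset\mathbb{Z}^4$ with $\operatorname{disc}(Q_L)=-4n$, $[Q_L]=[q_1]$ and $[Q_{L^\perp}]=[q_2]$ if and only if the Legendre compositions of $q_1$ and $q_2$ belong to the genus class $\mathcal{G}_n$.
   Context: $\mathbb{D}=\{D\in\mathbb{N}:D\not\equiv 0,7,12,15\pmod{16}\}$. A two-dimensional sublattice $L\subset\mathbb{Z}^4$ is primitive if $(\mathbb{Q}L)\cap\mathbb{Z}^4=L$; $L^\perp=\{w\in\mathbb{Z}^4:\langle w,x\rangle=0\ \forall x\in L\}$. For a rank-2 sublattice $N=\langle u,v\rangle$ of $\mathbb{Z}^k$, $Q_N$ is the restriction of the sum-of-squares form to $N$, and $[Q_N]$ denotes the $\mathrm{GL}_2(\mathbb{Z})$-equivalence class of the binary form $(x,y)\mapsto Q_N(xu+yv)$; $\operatorname{disc}(Q_N)$ is $-4$ times the determinant of its Gram matrix (i.e. $b^2-4ac$ for $ax^2+bxy+cy^2$). A binary quadratic lattice $(M,q_M)$ is a Legendre composition of $(L,q_L)$ and $(L',q_{L'})$ if there is a surjective linear homomorphism $\mu:L\otimes L'\to M$ with $q_L(u)q_{L'}(v)=q_M(\mu(u\otimes v))$; forms $q$ are viewed as lattices $(\mathbb{Z}^2,q)$. $\mathcal{G}_n=\{[Q_3|_{v^\perp}]: v\in\mathbb{Z}^3,\ Q_3(v)=n\}$,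 where $Q_3(x,y,z)=x^2+y^2+z^2$ and $v^\perp\subset\mathbb{Z}^3$ is the orthogonal complement of $v$; by a theorem of Gauss, for such $n$ it is a single genus class of binary quadratic forms of discriminant $-4n$. -}

module Defs where

open import Data.Nat as ℕ using (ℕ; _%_)
open import Data.Nat.Divisibility using (_∣_)
open import Data.Integer using (ℤ; +_; -_; _+_; _*_; _-_; _<_)
open import Data.Fin using (Fin; zero; suc)
open import Data.Product using (Σ; ∃; _×_; _,_)
open import Data.Sum using (_⊎_)
open import Relation.Binary.PropositionalEquality using (_≡_; _≢_)
open import Relation.Nullary using (¬_)

Vecℤ : ℕ → Set
Vecℤ k = Fin k → ℤ

dot : ∀ {k} → Vecℤ k → Vecℤ k → ℤ
dot {ℕ.zero}  u v = + 0
dot {ℕ.suc k} u v = u zero * v zero + dot (λ i → u (suc i)) (λ i → v (suc i))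

InD : ℕ → Set
InD D = (D % 16 ≢ 0) × (D % 16 ≢ 7) × (D % 16 ≢ 12) × (D % 16 ≢ 15)

SquareFree : ℕ → Set
SquareFree n = ∀ d → (d ℕ.* d) ∣ n → d ≡ 1

record BQF : Set where
  constructor bqf
  field
    a b c : ℤ

evalF : BQF → ℤ → ℤ → ℤ
evalF (bqf a b c) x y = a * (x * x) + b * (x * y) + c * (y * y)

disc : BQF → ℤ
disc (bqf a b c) = b * b - + 4 * (a * c)

Positive : BQF → Set
Positive q = ∀ x y → ¬ (x ≡ + 0 × y ≡ + 0) → + 0 < evalF q x y

Equiv : BQF → BQF → Set
Equiv f g = Σ ℤ λ p → Σ ℤ λ q → Σ ℤ λ r → Σ ℤ λ s →
  ((p * s - q * r ≡ + 1) ⊎ (p * s - q * r ≡ - (+ 1))) ×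
  (∀ x y → evalF f (p * x + q * y) (r * x + s * y) ≡ evalF g x y)

InSpan : ∀ {k} → Vecℤ k → Vecℤ k → Vecℤ k → Set
InSpan u v w = Σ ℤ λ x → Σ ℤ λ y → ∀ i → w i ≡ x * u i + y * v i

Independent : ∀ {k} → Vecℤ k → Vecℤ k → Set
Independent u v = ∀ x y → (∀ i → x * u i + y * v i ≡ + 0) → (x ≡ + 0 × y ≡ + 0)

IsBasis : ∀ {k} → (Vecℤ k → Set) → Vecℤ k → Vecℤ k → Set
IsBasis S u v = S u × S v × Independent u v × (∀ w → S w → InSpan u v w)

-- L = ⟨u,v⟩ primitive: (ℚL) ∩ ℤ^k = L, i.e. whenever m·w ∈ L with m ≠ 0, w ∈ L.
Primitive : ∀ {k} → Vecℤ k → Vecℤ k → Set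
Primitive u v = ∀ (m : ℤ) (w : Vecℤ _) → m ≢ + 0 → InSpan u v (λ i → m * w i) → InSpan u v w

Perp : ∀ {k} → Vecℤ k → Vecℤ k → Vecℤ k → Set
Perp u v w = (dot w u ≡ + 0) × (dot w v ≡ + 0)

-- Q_N in the basis (u,v): (x,y) ↦ Q(xu+yv) = ⟨u,u⟩x² + 2⟨u,v⟩xy + ⟨v,v⟩y².
FormOf : ∀ {k} → Vecℤ k → Vecℤ k → BQF
FormOf u v = bqf (dot u u) (+ 2 * dot u v) (dot v v)

InGenusG : ℕ → BQF → Set
InGenusG n q = Σ (Vecℤ 3) λ v → (dot v v ≡ + n) ×
  Σ (Vecℤ 3) λ e → Σ (Vecℤ 3) λ f →
    IsBasis (λ w → dot w v ≡ + 0) e f × Equiv (FormOf e f) q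

-- Legendre composition: (ℤ², q) is a Legendre composition of (ℤ², q₁) and (ℤ², q₂).
-- A linear map μ : ℤ² ⊗ ℤ² → ℤ² is given by μ i j = μ(e_i ⊗ f_j) ∈ ℤ².
tensorApply : (Fin 2 → Fin 2 → Vecℤ 2) → (Fin 2 → Fin 2 → ℤ) → Vecℤ 2
tensorApply μ t k =
  t zero zero * μ zero zero k + t zero (suc zero) * μ zero (suc zero) k +
  t (suc zero) zero * μ (suc zero) zero k + t (suc zero) (suc zero) * μ (suc zero) (suc zero) k

IsLegendreComposition : BQF → BQF → BQF → Set
IsLegendreComposition q₁ q₂ q = Σ (Fin 2 → Fin 2 → Vecℤ 2) λ μ →
  (∀ (w : Vecℤ 2) → Σ (Fin 2 → Fin 2 → ℤ) λ t → ∀ k → tensorApply μ t k ≡ w k) ×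
  (∀ (u v : Vecℤ 2) →
     evalF q₁ (u zero) (u (suc zero)) * evalF q₂ (v zero) (v (suc zero)) ≡
     (let m = tensorApply μ (λ i j → u i * v j) in evalF q (m zero) (m (suc zero))))

{-# OPTIONS --safe #-}
-- Identify ℤ⁴ with the Lipschitz quaternions and ℤ³ with the purely imaginary ones.
--
-- If L ⊥ L′ are planes of Gram determinant n, then x ⊗ y ↦ x ȳ and x ⊗ y ↦ x̄ y map L ⊗ L′ to planes of ℤ³ and
-- multiply norms.  The Gram matrix of a composite of two forms is determined by the factors up to one entry z,
-- and coplanarity leaves two possible values of z, of which x ȳ and x̄ y realise one each.  Hence every Legendre
-- composition q of Q_L and Q_L′ is isometric to one of these two images ⟨e, f⟩, and q is the form of (e × f)^⊥
-- since a squarefree n ≡ 1 mod 4 leaves no room for a composite of discriminant other than −4n.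
--
-- Conversely, replace q₁, q₂ by concordant forms (a₁, 2B, a₂C), (a₂, 2B, a₁C) with a₁ odd and prime to a₂; they
-- compose to (a₁a₂, 2B, C), which by assumption is the Gram form of imaginary quaternions e, f.  As a₁ is odd, a
-- Euclidean algorithm yields a quaternion x of norm a₁ with e x = a₁ y.  Then ⟨x, −f y⟩ and ⟨y, f x⟩ are orthogonal
-- planes with forms q₁, q₂, and squarefreeness of n makes both of them primitive.
module Submission where

open import Defs
import Data.Nat as ℕ
import Data.Nat.Properties as ℕ
import Data.Nat.Divisibility as ℕ
import Data.Nat.DivMod as ℕ
open import Data.Nat using (ℕ; zero; suc; _%_)
open import Data.Nat.Induction using (<-wellFounded)
open import Data.Nat.ListAction using (product)
open import Data.Nat.Primality using (Prime; prime⇒irreducible; ¬prime[1])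
open import Data.Nat.Primality.Factorisation using (PrimeFactorisation; factorise)
open import Data.Integer as ℤ using (ℤ; +_; -_; -[1+_]; _+_; _*_; _-_; ∣_∣)
import Data.Integer.Properties as ℤ
open import Data.Integer.DivMod using (_/_; n%d<d; a≡a%n+[a/n]*n; _/ℕ_; _%ℕ_; n%ℕd<d; a≡a%ℕn+[a/ℕn]*n)
open import Data.Integer.Tactic.RingSolver using (solve-∀)
open import Data.Fin using (Fin; zero; suc)
open import Data.List using (List; []; _∷_)
open import Data.List.Relation.Unary.All using (All; []; _∷_)
open import Data.Product using (Σ; ∃-syntax; _×_; _,_; proj₁; proj₂)
open import Data.Sum using (_⊎_; inj₁; inj₂)
open import Data.Empty using (⊥-elim)
open import Function.Bundles using (_⇔_; mk⇔)
open import Induction.WellFounded using (Acc; acc)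
open import Relation.Nullary using (¬_; Dec; yes; no)
open import Relation.Binary.PropositionalEquality
open ≡-Reasoning

-- The definition of a Legendre composite does not fix the discriminant of `q`, and the genus
-- condition concerns every composite, so one direction has to handle an arbitrary `q`. Restricting
-- a composite to one factor shows that its determinant is n k², where k divides the values of Q_L.
-- Squarefreeness of n excludes an odd k other than ±1, and n ≡ 1 mod 4 excludes an even k, because
-- it forces Q_L to take odd values. In the other direction a single composite decides, and it can
-- be chosen conveniently. The obstacle in that direction is that the Lipschitz order has no
-- Euclidean division: when all four coordinates of a quotient are half-integers, rounding leaves a
-- remainder as large as the divisor. A divisor of odd norm never meets this case. This is why a₁ is
-- chosen odd.

cong₃ : ∀ {A B C D : Set} (f : A → B → C → D) {x x′ y y′ z z′} → x ≡ x′ → y ≡ y′ → z ≡ z′ → f x y z ≡ f x′ y′ z′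
cong₃ f refl refl refl = refl

cong₅ : ∀ {A B C D E F : Set} (f : A → B → C → D → E → F) {x x′ y y′ z z′ u u′ v v′} →
  x ≡ x′ → y ≡ y′ → z ≡ z′ → u ≡ u′ → v ≡ v′ → f x y z u v ≡ f x′ y′ z′ u′ v′
cong₅ f refl refl refl refl refl = refl

-- Integers

*-cancelˡ : ∀ {i j k} → i ≢ + 0 → i * j ≡ i * k → j ≡ k
*-cancelˡ {i} {j} {k} i≢0 = ℤ.*-cancelˡ-≡ i j k {{ℤ.≢-nonZero i≢0}}

*≡0⇒≡0 : ∀ {i j} → i ≢ + 0 → i * j ≡ + 0 → j ≡ + 0
*≡0⇒≡0 {i} i≢0 p = *-cancelˡ i≢0 (trans p (sym (ℤ.*-zeroʳ i)))

*-≢0 : ∀ {i j} → i ≢ + 0 → j ≢ + 0 → i * j ≢ + 0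
*-≢0 i≢0 j≢0 p = j≢0 (*≡0⇒≡0 i≢0 p)

squares-equal : ∀ x y → x * x ≡ y * y → x ≡ y ⊎ x ≡ - y
squares-equal x y p with ℤ.i*j≡0⇒i≡0∨j≡0 (x - y) {x + y} (trans (factor x y) (ℤ.i≡j⇒i-j≡0 p))
  where
  factor : ∀ x y → (x - y) * (x + y) ≡ x * x - y * y
  factor = solve-∀
... | inj₁ q = inj₁ (ℤ.i-j≡0⇒i≡j x y q)
... | inj₂ q = inj₂ (ℤ.i-j≡0⇒i≡j x (- y) (trans (cong (λ t → x + t) (ℤ.neg-involutive y)) q))

square-nonNeg : ∀ x → + 0 ℤ.≤ x * x
square-nonNeg (+ n)    = subst (+ 0 ℤ.≤_) (ℤ.pos-* n n) (ℤ.+≤+ ℕ.z≤n)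
square-nonNeg -[1+ n ] = ℤ.+≤+ ℕ.z≤n

square-∣∣ : ∀ d → d * d ≡ + (∣ d ∣ ℕ.* ∣ d ∣)
square-∣∣ (+ m)    = sym (ℤ.pos-* m m)
square-∣∣ -[1+ m ] = refl

Bezout : ℤ → ℤ → Set
Bezout a b = ∃[ s ] ∃[ t ] s * a + t * b ≡ + 1

bezout-sym : ∀ {a b} → Bezout a b → Bezout b a
bezout-sym {a} {b} (s , t , p) = t , s , trans (ℤ.+-comm (t * b) (s * a)) p

bezout-* : ∀ {a b c} → Bezout a c → Bezout b c → Bezout (a * b) c
bezout-* {a} {b} {c} (s , t , p) (s′ , t′ , p′) =
  s * s′ , s * a * t′ + t * s′ * b + t * t′ * c , trans (expand s t s′ t′ a b c) (cong₂ _*_ p p′)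
  where
  expand : ∀ s t s′ t′ a b c →
    s * s′ * (a * b) + (s * a * t′ + t * s′ * b + t * t′ * c) * c ≡ (s * a + t * c) * (s′ * b + t′ * c)
  expand = solve-∀

-- A greatest common divisor, presented through its coprime cofactors. The sign of `g` is arbitrary,
-- and for a = b = 0 the cofactors 1 and 0 are still coprime.
record CommonFactor (a b : ℤ) : Set where
  field
    g a′ b′ : ℤ
    a-eq : a ≡ g * a′
    b-eq : b ≡ g * b′
    coprime : Bezout a′ b′

commonFactor-acc : ∀ a b → Acc ℕ._<_ ∣ b ∣ → CommonFactor a b
commonFactor-acc a b (acc rec) with b ℤ.≟ + 0
... | yes refl = record
  { g = a ; a′ = + 1 ; b′ = + 0 ; a-eq = sym (ℤ.*-identityʳ a) ; b-eq = sym (ℤ.*-zeroʳ a)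
  ; coprime = + 1 , + 0 , refl }
... | no b≢0 = record
  { g = g ; a′ = b′ + (a / b) * a′ ; b′ = a′
  ; a-eq = trans (trans (a≡a%n+[a/n]*n a b) (cong₂ (λ r d → r + (a / b) * d) b-eq a-eq))
                 (collect g a′ b′ (a / b))
  ; b-eq = a-eq
  ; coprime = t , s - t * (a / b) , trans (regroup s t a′ b′ (a / b)) st }
  where
  instance
    b-nonZero = ℤ.≢-nonZero b≢0
  open CommonFactor (commonFactor-acc b (+ (a ℤ.% b)) (rec (n%d<d a b)))
  s = proj₁ coprime
  t = proj₁ (proj₂ coprime)
  st = proj₂ (proj₂ coprime)
  collect : ∀ g a′ b′ q → g * b′ + q * (g * a′) ≡ g * (b′ + q * a′)
  collect = solve-∀
  regroup : ∀ s t a′ b′ q → t * (b′ + q * a′) + (s - t * q) * a′ ≡ s * a′ + t * b′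
  regroup = solve-∀

commonFactor : ∀ a b → CommonFactor a b
commonFactor a b = commonFactor-acc a b (<-wellFounded ∣ b ∣)

-- 2² divides 0.
squareFree⇒≢0 : ∀ {n} → SquareFree n → + n ≢ + 0
squareFree⇒≢0 {zero} sf refl with sf 2 (ℕ.divides 0 refl)
... | ()
squareFree⇒≢0 {suc n} sf ()

squareFree-ℤ : ∀ {n} → SquareFree n → ∀ d k → d * d * k ≡ + n → d * d ≡ + 1
squareFree-ℤ {n} sf d k p = trans (square-∣∣ d) (cong (λ x → + (x ℕ.* x)) (sf ∣ d ∣ (ℕ.divides ∣ k ∣ (begin
  n                                ≡⟨ cong ∣_∣ (sym p) ⟩
  ∣ d * d * k ∣                    ≡⟨ ℤ.abs-* (d * d) k ⟩
  ∣ d * d ∣ ℕ.* ∣ k ∣              ≡⟨ ℕ.*-comm ∣ d * d ∣ ∣ k ∣ ⟩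
  ∣ k ∣ ℕ.* ∣ d * d ∣              ≡⟨ cong (∣ k ∣ ℕ.*_) (ℤ.abs-* d d) ⟩
  ∣ k ∣ ℕ.* (∣ d ∣ ℕ.* ∣ d ∣)      ∎))))

-- With g = gcd(n, z) the equation reduces to g z′² = n′k. As n′ is prime to z′, it divides g, so
-- n′² divides n; hence n′ = ±1 and g = ±n.
squareFree-∣² : ∀ {n} → SquareFree n → ∀ z k → z * z ≡ + n * k → ∃[ h ] z ≡ + n * h
squareFree-∣² {n} sf z k p = n′ * z′ , (begin
  z                        ≡⟨ b-eq ⟩
  g * z′                   ≡⟨ rearr₁ g z′ ⟩
  + 1 * (g * z′)           ≡⟨ cong (_* (g * z′)) (sym n′²≡1) ⟩
  n′ * n′ * (g * z′)       ≡⟨ rearr₂ n′ g z′ ⟩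
  g * n′ * (n′ * z′)       ≡⟨ cong (_* (n′ * z′)) (sym a-eq) ⟩
  + n * (n′ * z′)          ∎)
  where
  open CommonFactor (commonFactor (+ n) z) renaming (a′ to n′; b′ to z′)
  s = proj₁ coprime
  t = proj₁ (proj₂ coprime)
  st = proj₂ (proj₂ coprime)
  rearr₁ : ∀ g z → g * z ≡ + 1 * (g * z)
  rearr₁ = solve-∀
  rearr₂ : ∀ n g z → n * n * (g * z) ≡ g * n * (n * z)
  rearr₂ = solve-∀
  g≢0 : g ≢ + 0
  g≢0 q = squareFree⇒≢0 sf (trans a-eq (cong (_* n′) q))
  n′k : g * (z′ * z′) ≡ n′ * k
  n′k = *-cancelˡ g≢0 (begin
    g * (g * (z′ * z′))    ≡⟨ e₁ g z′ ⟩
    g * z′ * (g * z′)      ≡⟨ cong₂ _*_ (sym b-eq) (sym b-eq) ⟩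
    z * z                  ≡⟨ p ⟩
    + n * k                ≡⟨ cong (_* k) a-eq ⟩
    g * n′ * k             ≡⟨ ℤ.*-assoc g n′ k ⟩
    g * (n′ * k)           ∎)
    where
    e₁ : ∀ g z → g * (g * (z * z)) ≡ g * z * (g * z)
    e₁ = solve-∀
  -- This is g (s n′ + t z′)² divided by n′, where g z′² has been replaced by n′k.
  h : ℤ
  h = g * (s * s * n′ + + 2 * s * t * z′) + t * t * k
  g≡ : n′ * h ≡ g
  g≡ = begin
    n′ * (g * (s * s * n′ + + 2 * s * t * z′) + t * t * k)           ≡⟨ e₁ n′ g s t z′ k ⟩
    n′ * (g * (s * s * n′ + + 2 * s * t * z′)) + t * t * (n′ * k)    ≡⟨ cong (λ x → n′ * (g * (s * s * n′ + + 2 * s * t * z′)) + t * t * x) (sym n′k) ⟩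
    n′ * (g * (s * s * n′ + + 2 * s * t * z′)) + t * t * (g * (z′ * z′)) ≡⟨ e₂ n′ g s t z′ ⟩
    g * ((s * n′ + t * z′) * (s * n′ + t * z′))                      ≡⟨ cong (λ x → g * (x * x)) st ⟩
    g * + 1                                                          ≡⟨ ℤ.*-identityʳ g ⟩
    g                                                                ∎
    where
    e₁ : ∀ n g s t z k → n * (g * (s * s * n + + 2 * s * t * z) + t * t * k) ≡ n * (g * (s * s * n + + 2 * s * t * z)) + t * t * (n * k)
    e₁ = solve-∀
    e₂ : ∀ n g s t z → n * (g * (s * s * n + + 2 * s * t * z)) + t * t * (g * (z * z)) ≡ g * ((s * n + t * z) * (s * n + t * z))
    e₂ = solve-∀
  n′²≡1 : n′ * n′ ≡ + 1
  n′²≡1 = squareFree-ℤ sf n′ h (begin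
    n′ * n′ * h     ≡⟨ ℤ.*-assoc n′ n′ h ⟩
    n′ * (n′ * h)   ≡⟨ cong (n′ *_) g≡ ⟩
    n′ * g          ≡⟨ ℤ.*-comm n′ g ⟩
    g * n′          ≡⟨ sym a-eq ⟩
    + n             ∎)

-- After cancelling the gcd, d′² divides n a′² and is prime to a′², so it divides n and d′ = ±1.
squareFree-²∣² : ∀ {n} → SquareFree n → ∀ d a k → d ≢ + 0 → k * (d * d) ≡ + n * (a * a) → ∃[ h ] a ≡ h * d
squareFree-²∣² {n} sf d a k d≢0 p = d′ * a′ , (begin
  a                       ≡⟨ b-eq ⟩
  g * a′                  ≡⟨ rearr₁ g a′ ⟩
  + 1 * (g * a′)          ≡⟨ cong (_* (g * a′)) (sym d′²≡1) ⟩
  d′ * d′ * (g * a′)      ≡⟨ rearr₂ d′ g a′ ⟩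
  d′ * a′ * (g * d′)      ≡⟨ cong (d′ * a′ *_) (sym a-eq) ⟩
  d′ * a′ * d             ∎)
  where
  open CommonFactor (commonFactor d a) renaming (a′ to d′; b′ to a′)
  s = proj₁ coprime
  t = proj₁ (proj₂ coprime)
  st = proj₂ (proj₂ coprime)
  rearr₁ : ∀ g z → g * z ≡ + 1 * (g * z)
  rearr₁ = solve-∀
  rearr₂ : ∀ d g a → d * d * (g * a) ≡ d * a * (g * d)
  rearr₂ = solve-∀
  g≢0 : g ≢ + 0
  g≢0 q = d≢0 (trans a-eq (cong (_* d′) q))
  reduced : k * (d′ * d′) ≡ + n * (a′ * a′)
  reduced = *-cancelˡ (*-≢0 g≢0 g≢0) (begin
    g * g * (k * (d′ * d′))      ≡⟨ e₁ g k d′ ⟩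
    k * (g * d′ * (g * d′))      ≡⟨ cong₂ (λ x y → k * (x * y)) (sym a-eq) (sym a-eq) ⟩
    k * (d * d)                  ≡⟨ p ⟩
    + n * (a * a)                ≡⟨ cong₂ (λ x y → + n * (x * y)) b-eq b-eq ⟩
    + n * (g * a′ * (g * a′))    ≡⟨ sym (e₁ g (+ n) a′) ⟩
    g * g * (+ n * (a′ * a′))    ∎)
    where
    e₁ : ∀ g k d → g * g * (k * (d * d)) ≡ k * (g * d * (g * d))
    e₁ = solve-∀
  -- In the cube of s d′ + t a′ = 1 every term contains a′² or d′²; these are the cofactors of a′²
  -- and of d′².
  u v : ℤ
  u = t * t * t * a′ + + 3 * s * d′ * t * t
  v = + 3 * s * s * t * a′ + s * s * s * d′
  d′²≡1 : d′ * d′ ≡ + 1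
  d′²≡1 = squareFree-ℤ sf d′ (k * u + + n * v) (begin
    d′ * d′ * (k * u + + n * v)                    ≡⟨ e₁ d′ k u (+ n) v ⟩
    k * (d′ * d′) * u + + n * (d′ * d′ * v)        ≡⟨ cong (λ x → x * u + + n * (d′ * d′ * v)) reduced ⟩
    + n * (a′ * a′) * u + + n * (d′ * d′ * v)      ≡⟨ e₂ (+ n) a′ d′ s t ⟩
    + n * ((s * d′ + t * a′) * (s * d′ + t * a′) * (s * d′ + t * a′)) ≡⟨ cong (λ x → + n * (x * x * x)) st ⟩
    + n * + 1                                      ≡⟨ ℤ.*-identityʳ (+ n) ⟩
    + n                                            ∎)
    where
    e₁ : ∀ d k u n v → d * d * (k * u + n * v) ≡ k * (d * d) * u + n * (d * d * v)
    e₁ = solve-∀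
    e₂ : ∀ n a d s t → n * (a * a) * (t * t * t * a + + 3 * s * d * t * t) + n * (d * d * (+ 3 * s * s * t * a + s * s * s * d))
       ≡ n * ((s * d + t * a) * (s * d + t * a) * (s * d + t * a))
    e₂ = solve-∀

-- Vectors and binary quadratic forms

pattern 0F = zero
pattern 1F = suc zero
pattern 2F = suc (suc zero)
pattern 3F = suc (suc (suc zero))

vec2 : ℤ → ℤ → Vecℤ 2
vec2 x y 0F = x
vec2 x y 1F = y

comb : ∀ {k} → ℤ → Vecℤ k → ℤ → Vecℤ k → Vecℤ k
comb x u y v i = x * u i + y * v i

dot-comm : ∀ {k} (u v : Vecℤ k) → dot u v ≡ dot v u
dot-comm {zero}  u v = refl
dot-comm {suc k} u v = cong₂ _+_ (ℤ.*-comm (u 0F) (v 0F)) (dot-comm (λ i → u (suc i)) (λ i → v (suc i)))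

dot-congˡ : ∀ {k} {u u′ : Vecℤ k} (v : Vecℤ k) → (∀ i → u i ≡ u′ i) → dot u v ≡ dot u′ v
dot-congˡ {zero}  v p = refl
dot-congˡ {suc k} v p = cong₂ _+_ (cong (_* v 0F) (p 0F)) (dot-congˡ (λ i → v (suc i)) (λ i → p (suc i)))

dot-linearˡ : ∀ {k} x y (u v w : Vecℤ k) → dot (comb x u y v) w ≡ x * dot u w + y * dot v w
dot-linearˡ {zero}  x y u v w = base x y
  where
  base : ∀ x y → + 0 ≡ x * + 0 + y * + 0
  base = solve-∀
dot-linearˡ {suc k} x y u v w =
  trans (cong (λ d → (x * u 0F + y * v 0F) * w 0F + d)
              (dot-linearˡ x y (λ i → u (suc i)) (λ i → v (suc i)) (λ i → w (suc i))))
        (step x y (u 0F) (v 0F) (w 0F) (dot (λ i → u (suc i)) (λ i → w (suc i))) (dot (λ i → v (suc i)) (λ i → w (suc i))))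
  where
  step : ∀ x y u v w d e → (x * u + y * v) * w + (x * d + y * e) ≡ x * (u * w + d) + y * (v * w + e)
  step = solve-∀

dot-scaleˡ : ∀ {k} x (u w : Vecℤ k) → dot (λ i → x * u i) w ≡ x * dot u w
dot-scaleˡ x u w = begin
  dot (λ i → x * u i) w                ≡⟨ dot-congˡ w (λ i → pad x (u i)) ⟩
  dot (comb x u (+ 0) u) w             ≡⟨ dot-linearˡ x (+ 0) u u w ⟩
  x * dot u w + + 0 * dot u w          ≡⟨ sym (pad x (dot u w)) ⟩
  x * dot u w                          ∎
  where
  pad : ∀ x y → x * y ≡ x * y + + 0 * y
  pad = solve-∀

dot-zeroˡ : ∀ {k} (u w : Vecℤ k) → (∀ i → u i ≡ + 0) → dot u w ≡ + 0
dot-zeroˡ u w p = trans (dot-congˡ w (λ i → trans (p i) (sym (ℤ.*-zeroˡ (u i))))) (trans (dot-scaleˡ (+ 0) u w) (ℤ.*-zeroˡ (dot u w)))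

dot-self-nonNeg : ∀ {k} (u : Vecℤ k) → + 0 ℤ.≤ dot u u
dot-self-nonNeg {zero}  u = ℤ.≤-refl
dot-self-nonNeg {suc k} u = ℤ.+-mono-≤ (square-nonNeg (u 0F)) (dot-self-nonNeg (λ i → u (suc i)))

gramDet : ∀ {k} → Vecℤ k → Vecℤ k → ℤ
gramDet u v = dot u u * dot v v - dot u v * dot u v

-- The coordinates of n·w in the basis u, v, from Cramer's rule applied to the Gram matrix of determinant n.
cramer₁ cramer₂ : ∀ {k} → Vecℤ k → Vecℤ k → Vecℤ k → ℤ
cramer₁ u v w = dot w u * dot v v - dot w v * dot u v
cramer₂ u v w = dot w v * dot u u - dot w u * dot u v

gramDet-independent : ∀ {k} (u v : Vecℤ k) → gramDet u v ≢ + 0 → Independent u v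
gramDet-independent u v Δ≢0 x y p =
  *≡0⇒≡0 Δ≢0 (trans (elim₁ (dot u u) (dot u v) (dot v v) x y)
    (trans (cong₂ (λ s t → dot v v * s - dot u v * t) pu pv) (zeros (dot v v) (dot u v)))) ,
  *≡0⇒≡0 Δ≢0 (trans (elim₂ (dot u u) (dot u v) (dot v v) x y)
    (trans (cong₂ (λ s t → dot u u * s - dot u v * t) pv pu) (zeros (dot u u) (dot u v))))
  where
  pu : x * dot u u + y * dot u v ≡ + 0
  pu = trans (cong (λ d → x * dot u u + y * d) (dot-comm u v)) (trans (sym (dot-linearˡ x y u v u)) (dot-zeroˡ _ u p))
  pv : x * dot u v + y * dot v v ≡ + 0
  pv = trans (sym (dot-linearˡ x y u v v)) (dot-zeroˡ _ v p)
  elim₁ : ∀ a b c x y → (a * c - b * b) * x ≡ c * (x * a + y * b) - b * (x * b + y * c)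
  elim₁ = solve-∀
  elim₂ : ∀ a b c x y → (a * c - b * b) * y ≡ a * (x * b + y * c) - b * (x * a + y * b)
  elim₂ = solve-∀
  zeros : ∀ a b → a * + 0 - b * + 0 ≡ + 0
  zeros = solve-∀

-- With α, β the Cramer coordinates, ⟨v,v⟩ n ⟨w,w⟩ = α² + n ⟨w,v⟩², so n divides α², hence α.
squareFree-span : ∀ {n} → SquareFree n → ∀ {k} (u v w : Vecℤ k) → gramDet u v ≡ + n →
  (∀ i → + n * w i ≡ cramer₁ u v w * u i + cramer₂ u v w * v i) → InSpan u v w
squareFree-span {n} sf u v w Δ p =
  proj₁ div₁ , proj₁ div₂ , λ i → *-cancelˡ n≢0 (begin
    + n * w i                                                ≡⟨ p i ⟩
    α * u i + β * v i                                        ≡⟨ cong₂ (λ x y → x * u i + y * v i) (proj₂ div₁) (proj₂ div₂) ⟩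
    + n * proj₁ div₁ * u i + + n * proj₁ div₂ * v i          ≡⟨ factor (+ n) (proj₁ div₁) (u i) (proj₁ div₂) (v i) ⟩
    + n * (proj₁ div₁ * u i + proj₁ div₂ * v i)              ∎)
  where
  n≢0 = squareFree⇒≢0 sf
  a = dot u u ; b = dot u v ; c = dot v v ; s = dot w u ; t = dot w v
  α = cramer₁ u v w
  β = cramer₂ u v w
  factor : ∀ n x u y v → n * x * u + n * y * v ≡ n * (x * u + y * v)
  factor = solve-∀
  norm : + n * dot w w ≡ α * s + β * t
  norm = begin
    + n * dot w w                    ≡⟨ sym (dot-scaleˡ (+ n) w w) ⟩
    dot (λ i → + n * w i) w          ≡⟨ dot-congˡ w p ⟩
    dot (comb α u β v) w             ≡⟨ dot-linearˡ α β u v w ⟩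
    α * dot u w + β * dot v w        ≡⟨ cong₂ (λ x y → α * x + β * y) (dot-comm u w) (dot-comm v w) ⟩
    α * s + β * t                    ∎
  square₁ : ∀ a b c s t → (s * c - t * b) * (s * c - t * b) ≡ c * ((s * c - t * b) * s + (t * a - s * b) * t) - (a * c - b * b) * (t * t)
  square₁ = solve-∀
  square₂ : ∀ a b c s t → (t * a - s * b) * (t * a - s * b) ≡ a * ((s * c - t * b) * s + (t * a - s * b) * t) - (a * c - b * b) * (s * s)
  square₂ = solve-∀
  pull : ∀ c n w t → c * (n * w) - n * t ≡ n * (c * w - t)
  pull = solve-∀
  div₁ : ∃[ h ] α ≡ + n * h
  div₁ = squareFree-∣² sf α (c * dot w w - t * t)
    (trans (square₁ a b c s t) (trans (cong₂ (λ x y → c * x - y * (t * t)) (sym norm) Δ) (pull c (+ n) (dot w w) (t * t))))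
  div₂ : ∃[ h ] β ≡ + n * h
  div₂ = squareFree-∣² sf β (a * dot w w - s * s)
    (trans (square₂ a b c s t) (trans (cong₂ (λ x y → a * x - y * (s * s)) (sym norm) Δ) (pull a (+ n) (dot w w) (s * s))))

-- The square of the index of ⟨u, v⟩ in its saturation divides the Gram determinant. Concretely, the
-- Cramer coordinates of m w are m times those of w, so cancelling m leaves the situation of
-- `squareFree-span`.
squareFree-primitive : ∀ {n} → SquareFree n → ∀ {k} (u v : Vecℤ k) → gramDet u v ≡ + n → Primitive u v
squareFree-primitive {n} sf u v Δ m w m≢0 (x , y , mw) =
  squareFree-span sf u v w Δ λ i → *-cancelˡ m≢0 (begin
    m * (+ n * w i)                                               ≡⟨ rearr m (+ n) (w i) ⟩
    + n * (m * w i)                                               ≡⟨ cong₂ _*_ (sym Δ) (mw i) ⟩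
    gramDet u v * (x * u i + y * v i)                             ≡⟨ cramer (dot u u) (dot u v) (dot v v) x y (u i) (v i) ⟩
    ((x * a + y * b) * c - (x * b + y * c) * b) * u i + ((x * b + y * c) * a - (x * a + y * b) * b) * v i
                                                                  ≡⟨ cong₂ (λ s t → (s * c - t * b) * u i + (t * a - s * b) * v i) (sym ms) (sym mt) ⟩
    (m * dot w u * c - m * dot w v * b) * u i + (m * dot w v * a - m * dot w u * b) * v i
                                                                  ≡⟨ pull m (dot w u) (dot w v) a b c (u i) (v i) ⟩
    m * (cramer₁ u v w * u i + cramer₂ u v w * v i)               ∎)
  where
  a = dot u u ; b = dot u v ; c = dot v v
  rearr : ∀ m n w → m * (n * w) ≡ n * (m * w)
  rearr = solve-∀
  cramer : ∀ a b c x y u v → (a * c - b * b) * (x * u + y * v) ≡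
    ((x * a + y * b) * c - (x * b + y * c) * b) * u + ((x * b + y * c) * a - (x * a + y * b) * b) * v
  cramer = solve-∀
  pull : ∀ m s t a b c u v → (m * s * c - m * t * b) * u + (m * t * a - m * s * b) * v ≡ m * ((s * c - t * b) * u + (t * a - s * b) * v)
  pull = solve-∀
  ms : m * dot w u ≡ x * a + y * b
  ms = trans (sym (dot-scaleˡ m w u)) (trans (dot-congˡ u mw) (trans (dot-linearˡ x y u v u) (cong (λ d → x * a + y * d) (dot-comm v u))))
  mt : m * dot w v ≡ x * b + y * c
  mt = trans (sym (dot-scaleˡ m w v)) (trans (dot-congˡ v mw) (dot-linearˡ x y u v v))

-- Substitutions and equivalence of binary quadratic forms

-- The right action of integer 2×2 matrices by substitution. Determinants other than ±1 occur in
-- `composition-disc`.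
act : BQF → ℤ → ℤ → ℤ → ℤ → BQF
act f@(bqf a b c) p q r s = bqf (evalF f p r) (+ 2 * a * p * q + b * (p * s + q * r) + + 2 * c * r * s) (evalF f q s)

evalF-act : ∀ f p q r s x y → evalF (act f p q r s) x y ≡ evalF f (p * x + q * y) (r * x + s * y)
evalF-act (bqf a b c) = identity a b c
  where
  identity : ∀ a b c p q r s x y →
    (a * (p * p) + b * (p * r) + c * (r * r)) * (x * x) +
    (+ 2 * a * p * q + b * (p * s + q * r) + + 2 * c * r * s) * (x * y) +
    (a * (q * q) + b * (q * s) + c * (s * s)) * (y * y) ≡
    a * ((p * x + q * y) * (p * x + q * y)) + b * ((p * x + q * y) * (r * x + s * y)) + c * ((r * x + s * y) * (r * x + s * y))
  identity = solve-∀

disc-act : ∀ f p q r s → disc (act f p q r s) ≡ disc f * ((p * s - q * r) * (p * s - q * r))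
disc-act (bqf a b c) = identity a b c
  where
  identity : ∀ a b c p q r s →
    (+ 2 * a * p * q + b * (p * s + q * r) + + 2 * c * r * s) * (+ 2 * a * p * q + b * (p * s + q * r) + + 2 * c * r * s) -
    + 4 * ((a * (p * p) + b * (p * r) + c * (r * r)) * (a * (q * q) + b * (q * s) + c * (s * s))) ≡
    (b * b - + 4 * (a * c)) * ((p * s - q * r) * (p * s - q * r))
  identity = solve-∀

bqf-cong : ∀ {a a′ b b′ c c′} → a ≡ a′ → b ≡ b′ → c ≡ c′ → bqf a b c ≡ bqf a′ b′ c′
bqf-cong refl refl refl = refl

-- The values at (1,0), (0,1) and (1,1) recover the coefficients. Equivalences and compositions
-- supply identities between values, and this turns them into identities between coefficients.
bqf-ext : ∀ f g → (∀ x y → evalF f x y ≡ evalF g x y) → f ≡ g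
bqf-ext (bqf a b c) (bqf a′ b′ c′) p = bqf-cong a≡ b≡ c≡
  where
  at10 : ∀ a b c → a ≡ a * (+ 1 * + 1) + b * (+ 1 * + 0) + c * (+ 0 * + 0)
  at10 = solve-∀
  at01 : ∀ a b c → c ≡ a * (+ 0 * + 0) + b * (+ 0 * + 1) + c * (+ 1 * + 1)
  at01 = solve-∀
  at11 : ∀ a b c → b ≡ a * (+ 1 * + 1) + b * (+ 1 * + 1) + c * (+ 1 * + 1) - a - c
  at11 = solve-∀
  a≡ : a ≡ a′
  a≡ = trans (at10 a b c) (trans (p (+ 1) (+ 0)) (sym (at10 a′ b′ c′)))
  c≡ : c ≡ c′
  c≡ = trans (at01 a b c) (trans (p (+ 0) (+ 1)) (sym (at01 a′ b′ c′)))
  b≡ : b ≡ b′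
  b≡ = trans (at11 a b c) (trans (cong₂ _-_ (cong₂ _-_ (p (+ 1) (+ 1)) a≡) c≡) (sym (at11 a′ b′ c′)))

Unit : ℤ → Set
Unit d = (d ≡ + 1) ⊎ (d ≡ - (+ 1))

unit-square : ∀ {d} → Unit d → d * d ≡ + 1
unit-square (inj₁ refl) = refl
unit-square (inj₂ refl) = refl

act-equiv : ∀ f p q r s → Unit (p * s - q * r) → Equiv f (act f p q r s)
act-equiv f p q r s unit = p , q , r , s , unit , λ x y → sym (evalF-act f p q r s x y)

equiv-act : ∀ f g ((p , q , r , s , _) : Equiv f g) → act f p q r s ≡ g
equiv-act f g (p , q , r , s , _ , e) = bqf-ext _ g λ x y → trans (evalF-act f p q r s x y) (e x y)

equiv-disc : ∀ f g → Equiv f g → disc f ≡ disc g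
equiv-disc f g E@(p , q , r , s , unit , _) = begin
  disc f                                                    ≡⟨ sym (ℤ.*-identityʳ (disc f)) ⟩
  disc f * + 1                                              ≡⟨ cong (disc f *_) (sym (unit-square unit)) ⟩
  disc f * ((p * s - q * r) * (p * s - q * r))              ≡⟨ sym (disc-act f p q r s) ⟩
  disc (act f p q r s)                                      ≡⟨ cong disc (equiv-act f g E) ⟩
  disc g                                                    ∎

equiv-trans : ∀ f g h → Equiv f g → Equiv g h → Equiv f h
equiv-trans f g h (p , q , r , s , U , e) (p′ , q′ , r′ , s′ , U′ , e′) =
  p * p′ + q * r′ , p * q′ + q * s′ , r * p′ + s * r′ , r * q′ + s * s′ ,
  subst Unit (det p q r s p′ q′ r′ s′) (unit-* U U′) ,
  λ x y → trans (cong₂ (evalF f) (assoc p p′ q r′ q′ s′ x y) (assoc r p′ s r′ q′ s′ x y)) (trans (e (p′ * x + q′ * y) (r′ * x + s′ * y)) (e′ x y))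
  where
  unit-* : ∀ {d d′} → Unit d → Unit d′ → Unit (d * d′)
  unit-* (inj₁ refl) (inj₁ refl) = inj₁ refl
  unit-* (inj₁ refl) (inj₂ refl) = inj₂ refl
  unit-* (inj₂ refl) (inj₁ refl) = inj₂ refl
  unit-* (inj₂ refl) (inj₂ refl) = inj₁ refl
  det : ∀ p q r s p′ q′ r′ s′ → (p * s - q * r) * (p′ * s′ - q′ * r′) ≡
    (p * p′ + q * r′) * (r * q′ + s * s′) - (p * q′ + q * s′) * (r * p′ + s * r′)
  det = solve-∀
  assoc : ∀ p p′ q r′ q′ s′ x y → (p * p′ + q * r′) * x + (p * q′ + q * s′) * y ≡ p * (p′ * x + q′ * y) + q * (r′ * x + s′ * y)
  assoc = solve-∀

equiv-sym : ∀ f g → Equiv f g → Equiv g f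
equiv-sym f g (p , q , r , s , U , e) =
  -- Since d² = 1, the inverse matrix is d times the adjugate.
  d * s , - (d * q) , - (d * r) , d * p , subst Unit inv-det U ,
  λ x y → trans (sym (e _ _)) (cong₂ (evalF f) (back₁ x y) (back₂ x y))
  where
  d = p * s - q * r
  inv-det : d ≡ d * s * (d * p) - - (d * q) * - (d * r)
  inv-det = sym (trans (identity (p * s - q * r) p q r s) (trans (cong (_* d) (unit-square U)) (ℤ.*-identityˡ d)))
    where
    identity : ∀ d p q r s → d * s * (d * p) - - (d * q) * - (d * r) ≡ d * d * (p * s - q * r)
    identity = solve-∀
  back₁ : ∀ x y → p * (d * s * x + - (d * q) * y) + q * (- (d * r) * x + d * p * y) ≡ x
  back₁ x y = trans (identity (p * s - q * r) p q r s x y) (trans (cong (_* x) (unit-square U)) (ℤ.*-identityˡ x))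
    where
    identity : ∀ d p q r s x y → p * (d * s * x + - (d * q) * y) + q * (- (d * r) * x + d * p * y) ≡ d * (p * s - q * r) * x
    identity = solve-∀
  back₂ : ∀ x y → r * (d * s * x + - (d * q) * y) + s * (- (d * r) * x + d * p * y) ≡ y
  back₂ x y = trans (identity (p * s - q * r) p q r s x y) (trans (cong (_* y) (unit-square U)) (ℤ.*-identityˡ y))
    where
    identity : ∀ d p q r s x y → r * (d * s * x + - (d * q) * y) + s * (- (d * r) * x + d * p * y) ≡ d * (p * s - q * r) * y
    identity = solve-∀

disc-FormOf : ∀ {k} (u v : Vecℤ k) → disc (FormOf u v) ≡ - (+ 4 * gramDet u v)
disc-FormOf u v = identity (dot u u) (dot u v) (dot v v)
  where
  identity : ∀ a b c → (+ 2 * b) * (+ 2 * b) - + 4 * (a * c) ≡ - (+ 4 * (a * c - b * b))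
  identity = solve-∀

dot-bilinear : ∀ {k} p r q s (u v : Vecℤ k) → dot (comb p u r v) (comb q u s v) ≡
  p * q * dot u u + (p * s + r * q) * dot u v + r * s * dot v v
dot-bilinear p r q s u v = begin
  dot (comb p u r v) (comb q u s v)                                          ≡⟨ dot-linearˡ p r u v _ ⟩
  p * dot u (comb q u s v) + r * dot v (comb q u s v)                        ≡⟨ cong₂ (λ x y → p * x + r * y) (dot-comm u _) (dot-comm v _) ⟩
  p * dot (comb q u s v) u + r * dot (comb q u s v) v                        ≡⟨ cong₂ (λ x y → p * x + r * y) (dot-linearˡ q s u v u) (dot-linearˡ q s u v v) ⟩
  p * (q * dot u u + s * dot v u) + r * (q * dot u v + s * dot v v)          ≡⟨ cong (λ x → p * (q * dot u u + s * x) + r * (q * dot u v + s * dot v v)) (dot-comm v u) ⟩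
  p * (q * dot u u + s * dot u v) + r * (q * dot u v + s * dot v v)          ≡⟨ identity p q r s (dot u u) (dot u v) (dot v v) ⟩
  p * q * dot u u + (p * s + r * q) * dot u v + r * s * dot v v              ∎
  where
  identity : ∀ p q r s a b c → p * (q * a + s * b) + r * (q * b + s * c) ≡ p * q * a + (p * s + r * q) * b + r * s * c
  identity = solve-∀

FormOf-comb : ∀ {k} (u v : Vecℤ k) p q r s → FormOf (comb p u r v) (comb q u s v) ≡ act (FormOf u v) p q r s
FormOf-comb u v p q r s = bqf-ext _ _ λ x y → begin
  evalF (FormOf (comb p u r v) (comb q u s v)) x y
    ≡⟨ cong₃ (λ α β γ → α * (x * x) + + 2 * β * (x * y) + γ * (y * y)) (dot-bilinear p r p r u v) (dot-bilinear p r q s u v) (dot-bilinear q s q s u v) ⟩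
  (p * p * a + (p * r + r * p) * b + r * r * c) * (x * x) + + 2 * (p * q * a + (p * s + r * q) * b + r * s * c) * (x * y) + (q * q * a + (q * s + s * q) * b + s * s * c) * (y * y)
    ≡⟨ identity a b c p q r s x y ⟩
  evalF (act (FormOf u v) p q r s) x y ∎
  where
  a = dot u u ; b = dot u v ; c = dot v v
  identity : ∀ a b c p q r s x y →
    (p * p * a + (p * r + r * p) * b + r * r * c) * (x * x) + + 2 * (p * q * a + (p * s + r * q) * b + r * s * c) * (x * y) + (q * q * a + (q * s + s * q) * b + s * s * c) * (y * y) ≡
    (a * (p * p) + + 2 * b * (p * r) + c * (r * r)) * (x * x) +
    (+ 2 * a * p * q + + 2 * b * (p * s + q * r) + + 2 * c * r * s) * (x * y) +
    (a * (q * q) + + 2 * b * (q * s) + c * (s * s)) * (y * y)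
  identity = solve-∀

-- Legendre composition under change of the factors

composition-swap : ∀ q₁ q₂ q → IsLegendreComposition q₁ q₂ q → IsLegendreComposition q₂ q₁ q
composition-swap q₁ q₂ q (μ , surj , mult) =
  (λ i j → μ j i) ,
  (λ w → let t , p = surj w in (λ i j → t j i) , λ k →
    trans (swap (t 0F 0F * μ 0F 0F k) (t 1F 0F * μ 1F 0F k) (t 0F 1F * μ 0F 1F k) (t 1F 1F * μ 1F 1F k)) (p k)) ,
  λ u v → trans (ℤ.*-comm (evalF q₂ (u 0F) (u 1F)) (evalF q₁ (v 0F) (v 1F)))
    (trans (mult v u) (cong₂ (evalF q) (swap⊗ u v 0F) (swap⊗ u v 1F)))
  where
  swap : ∀ a b c d → a + b + c + d ≡ a + c + b + d
  swap = solve-∀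
  swap⊗ : ∀ (u v : Vecℤ 2) k → tensorApply μ (λ i j → v i * u j) k ≡ tensorApply (λ i j → μ j i) (λ i j → u i * v j) k
  swap⊗ u v k = identity (u 0F) (u 1F) (v 0F) (v 1F) (μ 0F 0F k) (μ 0F 1F k) (μ 1F 0F k) (μ 1F 1F k)
    where
    identity : ∀ a b c d e f g h → c * a * e + c * b * f + d * a * g + d * b * h ≡ a * c * e + a * d * g + b * c * f + b * d * h
    identity = solve-∀

composition-equivˡ : ∀ f q₁ q₂ q → Equiv f q₁ → IsLegendreComposition f q₂ q → IsLegendreComposition q₁ q₂ q
composition-equivˡ f q₁ q₂ q E@(p , r , p′ , r′ , _ , e) (μ , surj , mult) =
  ν , (λ w → let t , eq = surj w in inverse t , λ k → trans (inverse-ok t k) (eq k)) ,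
  λ u v → trans (cong (_* evalF q₂ (v 0F) (v 1F)) (sym (e (u 0F) (u 1F))))
    (trans (mult (A u) v) (cong₂ (evalF q) (A⊗ u v 0F) (A⊗ u v 1F)))
  where
  ν : Fin 2 → Fin 2 → Vecℤ 2
  ν 0F j k = p * μ 0F j k + p′ * μ 1F j k
  ν 1F j k = r * μ 0F j k + r′ * μ 1F j k
  A : Vecℤ 2 → Vecℤ 2
  A u 0F = p * u 0F + r * u 1F
  A u 1F = p′ * u 0F + r′ * u 1F
  -- Surjectivity of ν = μ ∘ (A ⊗ 1) needs A⁻¹ ⊗ 1; as before A⁻¹ is d times the adjugate.
  inverse : (Fin 2 → Fin 2 → ℤ) → Fin 2 → Fin 2 → ℤ
  inverse t 0F j = d * r′ * t 0F j + - (d * r) * t 1F j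
    where d = p * r′ - r * p′
  inverse t 1F j = - (d * p′) * t 0F j + d * p * t 1F j
    where d = p * r′ - r * p′
  inverse-ok : ∀ t k → tensorApply ν (inverse t) k ≡ tensorApply μ t k
  inverse-ok t k = trans
    (identity (p * r′ - r * p′) p r p′ r′ (t 0F 0F) (t 0F 1F) (t 1F 0F) (t 1F 1F) (μ 0F 0F k) (μ 0F 1F k) (μ 1F 0F k) (μ 1F 1F k))
    (trans (cong (_* tensorApply μ t k) (unit-square (proj₁ (proj₂ (proj₂ (proj₂ (proj₂ E))))))) (ℤ.*-identityˡ _))
    where
    identity : ∀ d p r p′ r′ a b c e x y z w →
      (d * r′ * a + - (d * r) * c) * (p * x + p′ * z) + (d * r′ * b + - (d * r) * e) * (p * y + p′ * w) +
      (- (d * p′) * a + d * p * c) * (r * x + r′ * z) + (- (d * p′) * b + d * p * e) * (r * y + r′ * w) ≡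
      d * (p * r′ - r * p′) * (a * x + b * y + c * z + e * w)
    identity = solve-∀
  A⊗ : ∀ (u v : Vecℤ 2) k → tensorApply μ (λ i j → A u i * v j) k ≡ tensorApply ν (λ i j → u i * v j) k
  A⊗ u v k = identity p r p′ r′ (u 0F) (u 1F) (v 0F) (v 1F) (μ 0F 0F k) (μ 0F 1F k) (μ 1F 0F k) (μ 1F 1F k)
    where
    identity : ∀ p r p′ r′ a b c d x y z w →
      (p * a + r * b) * c * x + (p * a + r * b) * d * y + (p′ * a + r′ * b) * c * z + (p′ * a + r′ * b) * d * w ≡
      a * c * (p * x + p′ * z) + a * d * (p * y + p′ * w) + b * c * (r * x + r′ * z) + b * d * (r * y + r′ * w)
    identity = solve-∀

composition-equiv : ∀ f₁ f₂ q₁ q₂ q → Equiv f₁ q₁ → Equiv f₂ q₂ →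
  IsLegendreComposition f₁ f₂ q → IsLegendreComposition q₁ q₂ q
composition-equiv f₁ f₂ q₁ q₂ q E₁ E₂ C =
  composition-swap q₂ q₁ q (composition-equivˡ f₂ q₂ q₁ q E₂ (composition-swap q₁ f₂ q (composition-equivˡ f₁ q₁ f₂ q E₁ C)))

-- Congruences modulo 4 and the content of a form

parity : ∀ x → ∃[ k ] (x ≡ + 2 * k ⊎ x ≡ + 1 + + 2 * k)
parity x with x ℤ.% + 2 | n%d<d x (+ 2) | a≡a%n+[a/n]*n x (+ 2)
... | 0 | _ | p = x / + 2 , inj₁ (trans p (even (x / + 2)))
  where
  even : ∀ q → + 0 + q * + 2 ≡ + 2 * q
  even = solve-∀
... | 1 | _ | p = x / + 2 , inj₂ (trans p (odd (x / + 2)))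
  where
  odd : ∀ q → + 1 + q * + 2 ≡ + 1 + + 2 * q
  odd = solve-∀
... | suc (suc _) | ℕ.s≤s (ℕ.s≤s ()) | _

4*⇒%4≡0 : ∀ x r → + 4 * x ≡ + r → r % 4 ≡ 0
4*⇒%4≡0 x r p = trans (cong (_% 4) r≡) (ℕ.m*n%n≡0 ∣ x ∣ 4)
  where
  r≡ : r ≡ ∣ x ∣ ℕ.* 4
  r≡ = trans (sym (cong ∣_∣ p)) (trans (ℤ.abs-* (+ 4) x) (ℕ.*-comm 4 ∣ x ∣))

-- Squares are 0 or 1 modulo 4, so x² + 1 is 1 or 2.
-1-nonSquare-mod4 : ∀ x y → x * x + + 1 ≢ + 4 * y
-1-nonSquare-mod4 x y p with parity x
... | k , inj₁ refl with 4*⇒%4≡0 (y - k * k) 1 (trans (identity k y) (trans (cong (_- + 4 * (k * k)) (sym p)) (identity′ k)))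
  where
  identity : ∀ k y → + 4 * (y - k * k) ≡ + 4 * y - + 4 * (k * k)
  identity = solve-∀
  identity′ : ∀ k → + 2 * k * (+ 2 * k) + + 1 - + 4 * (k * k) ≡ + 1
  identity′ = solve-∀
...   | ()
-1-nonSquare-mod4 x y p | k , inj₂ refl with 4*⇒%4≡0 (y - k - k * k) 2 (trans (identity k y) (trans (cong (_- + 4 * (k + k * k)) (sym p)) (identity′ k)))
  where
  identity : ∀ k y → + 4 * (y - k - k * k) ≡ + 4 * y - + 4 * (k + k * k)
  identity = solve-∀
  identity′ : ∀ k → (+ 1 + + 2 * k) * (+ 1 + + 2 * k) + + 1 - + 4 * (k + k * k) ≡ + 2
  identity′ = solve-∀
...   | ()

%4≡1 : ∀ n → n % 4 ≡ 1 → ∃[ j ] + n ≡ + 1 + + 4 * j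
%4≡1 n p = + (n ℕ./ 4) , trans (cong +_ (trans (ℕ.m≡m%n+[m/n]*n n 4) (cong₂ ℕ._+_ p (ℕ.*-comm (n ℕ./ 4) 4))))
  (cong (λ t → + 1 + t) (ℤ.pos-* 4 (n ℕ./ 4)))

-- Even a and c would give b² ≡ -n ≡ -1 modulo 4. Every use of the congruence on n passes through
-- this lemma: it says that a form of determinant n takes odd values.
det≡1mod4⇒notBothEven : ∀ n → n % 4 ≡ 1 → ∀ a b c → a * c - b * b ≡ + n → ∀ k l → ¬ (a ≡ + 2 * k × c ≡ + 2 * l)
det≡1mod4⇒notBothEven n n≡1 a b c Δ k l (refl , refl) with %4≡1 n n≡1
... | j , p = -1-nonSquare-mod4 b (k * l - j) (trans (cong (λ t → b * b + t) (identity j)) (trans (cong (λ t → b * b + (t - + 4 * j)) (sym (trans Δ p))) (identity′ b k l j)))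
  where
  identity : ∀ j → + 1 ≡ + 1 + + 4 * j - + 4 * j
  identity = solve-∀
  identity′ : ∀ b k l j → b * b + (+ 2 * k * (+ 2 * l) - b * b - + 4 * j) ≡ + 4 * (k * l - j)
  identity′ = solve-∀

-- 4n = 4ac − (2b)² is divisible by k², and an even k would make both a and c even.
content-unit : ∀ {n} → SquareFree n → n % 4 ≡ 1 → ∀ k α γ ε b →
  k * α * (k * γ) - b * b ≡ + n → k * α + + 2 * b + k * γ ≡ k * ε → k * k ≡ + 1
content-unit {n} sf n≡1 k α γ ε b Δ sum with parity k
... | κ , inj₁ refl = ⊥-elim (det≡1mod4⇒notBothEven n n≡1 _ b _ Δ (κ * α) (κ * γ) (ℤ.*-assoc (+ 2) κ α , ℤ.*-assoc (+ 2) κ γ))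
... | κ , inj₂ refl = squareFree-ℤ sf k (α * γ - b′ * b′) (trans (identity k α γ b′) (trans (cong (λ t → k * α * (k * γ) - t * t) (sym b≡)) Δ))
  where
  -- Division of 2b by the odd number k = 1 + 2κ is turned into division of b by b = k b - κ (2b).
  b′ = b - κ * (ε - α - γ)
  2b≡ : + 2 * b ≡ k * (ε - α - γ)
  2b≡ = trans (move (k * α) (+ 2 * b) (k * γ)) (trans (cong (λ t → t - k * α - k * γ) sum) (factor k ε α γ))
    where
    move : ∀ x y z → y ≡ x + y + z - x - z
    move = solve-∀
    factor : ∀ k ε α γ → k * ε - k * α - k * γ ≡ k * (ε - α - γ)
    factor = solve-∀
  b≡ : b ≡ k * b′
  b≡ = trans (split κ b) (trans (cong (λ t → k * b - κ * t) 2b≡) (factor k b κ (ε - α - γ)))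
    where
    split : ∀ κ b → b ≡ (+ 1 + + 2 * κ) * b - κ * (+ 2 * b)
    split = solve-∀
    factor : ∀ k b κ h → k * b - κ * (k * h) ≡ k * (b - κ * h)
    factor = solve-∀
  identity : ∀ k α γ b → k * k * (α * γ - b * b) ≡ k * α * (k * γ) - k * b * (k * b)
  identity = solve-∀

-- The Gram numbers of a composite

tensorMap : ∀ {k} → (Fin 2 → Fin 2 → Vecℤ k) → (Fin 2 → Fin 2 → ℤ) → Vecℤ k
tensorMap g t i = t 0F 0F * g 0F 0F i + t 0F 1F * g 0F 1F i + t 1F 0F * g 1F 0F i + t 1F 1F * g 1F 1F i

Σ₄ : (Fin 2 → Fin 2 → ℤ) → (Fin 2 → Fin 2 → ℤ) → ℤ
Σ₄ t f = t 0F 0F * f 0F 0F + t 0F 1F * f 0F 1F + t 1F 0F * f 1F 0F + t 1F 1F * f 1F 1F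

Σ₄-cong : ∀ t {f f′} → (∀ i j → f i j ≡ f′ i j) → Σ₄ t f ≡ Σ₄ t f′
Σ₄-cong t p rewrite p 0F 0F | p 0F 1F | p 1F 0F | p 1F 1F = refl

_⊗_ : Vecℤ 2 → Vecℤ 2 → Fin 2 → Fin 2 → ℤ
(u ⊗ v) i j = u i * v j

-- One interface for the polar form of `q` on ℤ² and for twice the dot product on ℤ³, so that an
-- abstract composite and a quaternion product pass through the same Gram computation. Linearity is
-- phrased for the four-term sums that come from ℤ² ⊗ ℤ².
record SymBilinear (k : ℕ) : Set where
  field
    form   : Vecℤ k → Vecℤ k → ℤ
    symm   : ∀ u v → form u v ≡ form v u
    linear : ∀ g t w → form (tensorMap g t) w ≡ Σ₄ t (λ i j → form (g i j) w)

  form-expand : ∀ g t t′ → form (tensorMap g t) (tensorMap g t′) ≡ Σ₄ t (λ i j → Σ₄ t′ (λ k l → form (g i j) (g k l)))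
  form-expand g t t′ = trans (linear g t (tensorMap g t′)) (Σ₄-cong t λ i j →
    trans (symm (g i j) (tensorMap g t′)) (trans (linear g t′ (g i j)) (Σ₄-cong t′ λ k l → symm (g k l) (g i j))))

open SymBilinear

twiceDot : ∀ {k} → SymBilinear k
twiceDot .form u v = + 2 * dot u v
twiceDot .symm u v = cong (+ 2 *_) (dot-comm u v)
twiceDot .linear g t w = trans (cong (+ 2 *_) (dot-linear g w)) (double (t 0F 0F) (t 0F 1F) (t 1F 0F) (t 1F 1F) (dot (g 0F 0F) w) (dot (g 0F 1F) w) (dot (g 1F 0F) w) (dot (g 1F 1F) w))
  where
  double : ∀ a b c d x y z w → + 2 * (a * x + b * y + c * z + d * w) ≡ a * (+ 2 * x) + b * (+ 2 * y) + c * (+ 2 * z) + d * (+ 2 * w)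
  double = solve-∀
  dot-linear : ∀ {k} (g : Fin 2 → Fin 2 → Vecℤ k) w → dot (tensorMap g t) w ≡ Σ₄ t (λ i j → dot (g i j) w)
  dot-linear {zero}  g w = base (t 0F 0F) (t 0F 1F) (t 1F 0F) (t 1F 1F)
    where
    base : ∀ a b c d → + 0 ≡ a * + 0 + b * + 0 + c * + 0 + d * + 0
    base = solve-∀
  dot-linear {suc k} g w =
    trans (cong (λ d → tensorMap g t 0F * w 0F + d) (dot-linear (λ i j l → g i j (suc l)) (λ l → w (suc l))))
          (step (t 0F 0F) (t 0F 1F) (t 1F 0F) (t 1F 1F) (g 0F 0F 0F) (g 0F 1F 0F) (g 1F 0F 0F) (g 1F 1F 0F) (w 0F)
            (rest 0F 0F) (rest 0F 1F) (rest 1F 0F) (rest 1F 1F))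
    where
    rest : Fin 2 → Fin 2 → ℤ
    rest i j = dot (λ l → g i j (suc l)) (λ l → w (suc l))
    step : ∀ a b c d x y z v w p q r s →
      (a * x + b * y + c * z + d * v) * w + (a * p + b * q + c * r + d * s) ≡
      a * (x * w + p) + b * (y * w + q) + c * (z * w + r) + d * (v * w + s)
    step = solve-∀

polar : BQF → SymBilinear 2
polar (bqf A B C) .form u v = + 2 * A * (u 0F * v 0F) + B * (u 0F * v 1F + u 1F * v 0F) + + 2 * C * (u 1F * v 1F)
polar (bqf A B C) .symm u v = identity A B C (u 0F) (u 1F) (v 0F) (v 1F)
  where
  identity : ∀ A B C a b c d → + 2 * A * (a * c) + B * (a * d + b * c) + + 2 * C * (b * d) ≡
    + 2 * A * (c * a) + B * (c * b + d * a) + + 2 * C * (d * b)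
  identity = solve-∀
polar (bqf A B C) .linear g t w = identity A B C (t 0F 0F) (t 0F 1F) (t 1F 0F) (t 1F 1F)
  (g 0F 0F 0F) (g 0F 1F 0F) (g 1F 0F 0F) (g 1F 1F 0F) (g 0F 0F 1F) (g 0F 1F 1F) (g 1F 0F 1F) (g 1F 1F 1F) (w 0F) (w 1F)
  where
  identity : ∀ A B C a b c d x y z v x′ y′ z′ v′ w w′ →
    + 2 * A * ((a * x + b * y + c * z + d * v) * w) + B * ((a * x + b * y + c * z + d * v) * w′ + (a * x′ + b * y′ + c * z′ + d * v′) * w) + + 2 * C * ((a * x′ + b * y′ + c * z′ + d * v′) * w′) ≡
    a * (+ 2 * A * (x * w) + B * (x * w′ + x′ * w) + + 2 * C * (x′ * w′)) +
    b * (+ 2 * A * (y * w) + B * (y * w′ + y′ * w) + + 2 * C * (y′ * w′)) +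
    c * (+ 2 * A * (z * w) + B * (z * w′ + z′ * w) + + 2 * C * (z′ * w′)) +
    d * (+ 2 * A * (v * w) + B * (v * w′ + v′ * w) + + 2 * C * (v′ * w′))
  identity = solve-∀

polar-diag : ∀ q u → form (polar q) u u ≡ + 2 * evalF q (u 0F) (u 1F)
polar-diag (bqf A B C) u = identity A B C (u 0F) (u 1F)
  where
  identity : ∀ A B C a b → + 2 * A * (a * a) + B * (a * b + b * a) + + 2 * C * (b * b) ≡ + 2 * (A * (a * a) + B * (a * b) + C * (b * b))
  identity = solve-∀

-- Legendre composition in terms of the polar form β(u,v) = q(u+v) − q(u) − q(v), whence the factor 2.
Multiplicative : ∀ {k} → BQF → BQF → SymBilinear k → (Fin 2 → Fin 2 → Vecℤ k) → Set
Multiplicative q₁ q₂ β g = ∀ s t →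
  form β (tensorMap g (s ⊗ t)) (tensorMap g (s ⊗ t)) ≡ + 2 * (evalF q₁ (s 0F) (s 1F) * evalF q₂ (t 0F) (t 1F))

-- All Gram numbers of a composite are determined by the factors, except z = β(g₀₁, g₁₀).
gramTable : (a b c a′ b′ c′ z : ℤ) → (i j k l : Fin 2) → ℤ
gramTable a b c a′ b′ c′ z 0F 0F 0F 0F = + 2 * (a * a′)
gramTable a b c a′ b′ c′ z 0F 0F 0F 1F = + 2 * (a * b′)
gramTable a b c a′ b′ c′ z 0F 0F 1F 0F = + 2 * (b * a′)
gramTable a b c a′ b′ c′ z 0F 0F 1F 1F = + 4 * (b * b′) - z
gramTable a b c a′ b′ c′ z 0F 1F 0F 0F = + 2 * (a * b′)
gramTable a b c a′ b′ c′ z 0F 1F 0F 1F = + 2 * (a * c′)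
gramTable a b c a′ b′ c′ z 0F 1F 1F 0F = z
gramTable a b c a′ b′ c′ z 0F 1F 1F 1F = + 2 * (b * c′)
gramTable a b c a′ b′ c′ z 1F 0F 0F 0F = + 2 * (b * a′)
gramTable a b c a′ b′ c′ z 1F 0F 0F 1F = z
gramTable a b c a′ b′ c′ z 1F 0F 1F 0F = + 2 * (c * a′)
gramTable a b c a′ b′ c′ z 1F 0F 1F 1F = + 2 * (c * b′)
gramTable a b c a′ b′ c′ z 1F 1F 0F 0F = + 4 * (b * b′) - z
gramTable a b c a′ b′ c′ z 1F 1F 0F 1F = + 2 * (b * c′)
gramTable a b c a′ b′ c′ z 1F 1F 1F 0F = + 2 * (c * b′)
gramTable a b c a′ b′ c′ z 1F 1F 1F 1F = + 2 * (c * c′)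

multiplicative-gram : ∀ {k} a b c a′ b′ c′ (β : SymBilinear k) g →
  Multiplicative (bqf a (+ 2 * b) c) (bqf a′ (+ 2 * b′) c′) β g →
  ∀ i j k l → form β (g i j) (g k l) ≡ gramTable a b c a′ b′ c′ (form β (g 0F 1F) (g 1F 0F)) i j k l
multiplicative-gram a b c a′ b′ c′ β g mult = table
  where
  G : Fin 2 → Fin 2 → Fin 2 → Fin 2 → ℤ
  G i j k l = form β (g i j) (g k l)
  G-sym : ∀ i j k l → G i j k l ≡ G k l i j
  G-sym i j k l = symm β (g i j) (g k l)
  α α′ γ γ′ ε ε′ : BQF
  α  = bqf (G 0F 0F 0F 0F) (G 0F 0F 1F 0F + G 1F 0F 0F 0F) (G 1F 0F 1F 0F)
  ε  = bqf (G 0F 0F 0F 1F + G 0F 1F 0F 0F) (G 0F 0F 1F 1F + G 1F 1F 0F 0F + G 0F 1F 1F 0F + G 1F 0F 0F 1F) (G 1F 0F 1F 1F + G 1F 1F 1F 0F)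
  γ  = bqf (G 0F 1F 0F 1F) (G 0F 1F 1F 1F + G 1F 1F 0F 1F) (G 1F 1F 1F 1F)
  α′ = bqf (+ 2 * (a * a′)) (+ 4 * (b * a′)) (+ 2 * (c * a′))
  ε′ = bqf (+ 4 * (a * b′)) (+ 8 * (b * b′)) (+ 4 * (c * b′))
  γ′ = bqf (+ 2 * (a * c′)) (+ 4 * (b * c′)) (+ 2 * (c * c′))
  lhs : ∀ s₀ s₁ t₀ t₁ p₀₀ p₀₁ p₀₂ p₀₃ p₁₀ p₁₁ p₁₂ p₁₃ p₂₀ p₂₁ p₂₂ p₂₃ p₃₀ p₃₁ p₃₂ p₃₃ →
    (p₀₀ * (s₀ * s₀) + (p₀₂ + p₂₀) * (s₀ * s₁) + p₂₂ * (s₁ * s₁)) * (t₀ * t₀) +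
    ((p₀₁ + p₁₀) * (s₀ * s₀) + (p₀₃ + p₃₀ + p₁₂ + p₂₁) * (s₀ * s₁) + (p₂₃ + p₃₂) * (s₁ * s₁)) * (t₀ * t₁) +
    (p₁₁ * (s₀ * s₀) + (p₁₃ + p₃₁) * (s₀ * s₁) + p₃₃ * (s₁ * s₁)) * (t₁ * t₁) ≡
    s₀ * t₀ * (s₀ * t₀ * p₀₀ + s₀ * t₁ * p₀₁ + s₁ * t₀ * p₀₂ + s₁ * t₁ * p₀₃) +
    s₀ * t₁ * (s₀ * t₀ * p₁₀ + s₀ * t₁ * p₁₁ + s₁ * t₀ * p₁₂ + s₁ * t₁ * p₁₃) +
    s₁ * t₀ * (s₀ * t₀ * p₂₀ + s₀ * t₁ * p₂₁ + s₁ * t₀ * p₂₂ + s₁ * t₁ * p₂₃) +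
    s₁ * t₁ * (s₀ * t₀ * p₃₀ + s₀ * t₁ * p₃₁ + s₁ * t₀ * p₃₂ + s₁ * t₁ * p₃₃)
  lhs = solve-∀
  rhs : ∀ a b c a′ b′ c′ s₀ s₁ t₀ t₁ →
    + 2 * ((a * (s₀ * s₀) + + 2 * b * (s₀ * s₁) + c * (s₁ * s₁)) * (a′ * (t₀ * t₀) + + 2 * b′ * (t₀ * t₁) + c′ * (t₁ * t₁))) ≡
    (+ 2 * (a * a′) * (s₀ * s₀) + + 4 * (b * a′) * (s₀ * s₁) + + 2 * (c * a′) * (s₁ * s₁)) * (t₀ * t₀) +
    (+ 4 * (a * b′) * (s₀ * s₀) + + 8 * (b * b′) * (s₀ * s₁) + + 4 * (c * b′) * (s₁ * s₁)) * (t₀ * t₁) +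
    (+ 2 * (a * c′) * (s₀ * s₀) + + 4 * (b * c′) * (s₀ * s₁) + + 2 * (c * c′) * (s₁ * s₁)) * (t₁ * t₁)
  rhs = solve-∀
  -- For fixed s both sides are binary forms in t. Their coefficients `α`, `ε`, `γ` are binary forms
  -- in s, to which extensionality is then applied again.
  inner : ∀ s₀ s₁ → bqf (evalF α s₀ s₁) (evalF ε s₀ s₁) (evalF γ s₀ s₁) ≡ bqf (evalF α′ s₀ s₁) (evalF ε′ s₀ s₁) (evalF γ′ s₀ s₁)
  inner s₀ s₁ = bqf-ext _ _ λ t₀ t₁ → trans
    (lhs s₀ s₁ t₀ t₁ (G 0F 0F 0F 0F) (G 0F 0F 0F 1F) (G 0F 0F 1F 0F) (G 0F 0F 1F 1F)
                     (G 0F 1F 0F 0F) (G 0F 1F 0F 1F) (G 0F 1F 1F 0F) (G 0F 1F 1F 1F)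
                     (G 1F 0F 0F 0F) (G 1F 0F 0F 1F) (G 1F 0F 1F 0F) (G 1F 0F 1F 1F)
                     (G 1F 1F 0F 0F) (G 1F 1F 0F 1F) (G 1F 1F 1F 0F) (G 1F 1F 1F 1F))
    (trans (sym (form-expand β g (vec2 s₀ s₁ ⊗ vec2 t₀ t₁) (vec2 s₀ s₁ ⊗ vec2 t₀ t₁)))
    (trans (mult (vec2 s₀ s₁) (vec2 t₀ t₁)) (rhs a b c a′ b′ c′ s₀ s₁ t₀ t₁)))
  α≡ : α ≡ α′
  α≡ = bqf-ext α α′ λ s₀ s₁ → cong BQF.a (inner s₀ s₁)
  ε≡ : ε ≡ ε′
  ε≡ = bqf-ext ε ε′ λ s₀ s₁ → cong BQF.b (inner s₀ s₁)
  γ≡ : γ ≡ γ′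
  γ≡ = bqf-ext γ γ′ λ s₀ s₁ → cong BQF.c (inner s₀ s₁)
  halve : ∀ {x y z} → x ≡ y → x + y ≡ + 4 * z → x ≡ + 2 * z
  halve {x} {_} {z} refl p = *-cancelˡ {+ 2} (λ ()) (trans (twice x) (trans p (quad z)))
    where
    twice : ∀ x → + 2 * x ≡ x + x
    twice = solve-∀
    quad : ∀ z → + 4 * z ≡ + 2 * (+ 2 * z)
    quad = solve-∀
  cross-term : ∀ {x x′ y y′ w} → x ≡ x′ → y ≡ y′ → x + x′ + y + y′ ≡ + 8 * w → x ≡ + 4 * w - y
  cross-term {x} {_} {y} {_} {w} refl refl p = *-cancelˡ {+ 2} (λ ()) (trans (isolate x y) (trans (cong (_- + 2 * y) p) (factor w y)))
    where
    isolate : ∀ x y → + 2 * x ≡ x + x + y + y - + 2 * y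
    isolate = solve-∀
    factor : ∀ w y → + 8 * w - + 2 * y ≡ + 2 * (+ 4 * w - y)
    factor = solve-∀
  z = G 0F 1F 1F 0F
  t0001 = halve (G-sym 0F 0F 0F 1F) (cong BQF.a ε≡)
  t0010 = halve (G-sym 0F 0F 1F 0F) (cong BQF.b α≡)
  t0111 = halve (G-sym 0F 1F 1F 1F) (cong BQF.b γ≡)
  t1011 = halve (G-sym 1F 0F 1F 1F) (cong BQF.c ε≡)
  t0011 = cross-term (G-sym 0F 0F 1F 1F) (G-sym 0F 1F 1F 0F) (cong BQF.b ε≡)
  table : ∀ i j k l → G i j k l ≡ gramTable a b c a′ b′ c′ z i j k l
  table 0F 0F 0F 0F = cong BQF.a α≡
  table 0F 0F 0F 1F = t0001
  table 0F 0F 1F 0F = t0010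
  table 0F 0F 1F 1F = t0011
  table 0F 1F 0F 0F = trans (G-sym 0F 1F 0F 0F) t0001
  table 0F 1F 0F 1F = cong BQF.a γ≡
  table 0F 1F 1F 0F = refl
  table 0F 1F 1F 1F = t0111
  table 1F 0F 0F 0F = trans (G-sym 1F 0F 0F 0F) t0010
  table 1F 0F 0F 1F = G-sym 1F 0F 0F 1F
  table 1F 0F 1F 0F = cong BQF.c α≡
  table 1F 0F 1F 1F = t1011
  table 1F 1F 0F 0F = trans (G-sym 1F 1F 0F 0F) t0011
  table 1F 1F 0F 1F = trans (G-sym 1F 1F 0F 1F) t0111
  table 1F 1F 1F 0F = trans (G-sym 1F 1F 1F 0F) t1011
  table 1F 1F 1F 1F = cong BQF.c γ≡

-- The Gram determinant of v₁, v₂, v₃, multiplied by β(v₁,v₁), vanishes.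
Coplanar : ∀ {k} → SymBilinear k → (v₁ v₂ v₃ : Vecℤ k) → Set
Coplanar β v₁ v₂ v₃ =
  (form β v₁ v₂ * form β v₁ v₃ - form β v₁ v₁ * form β v₂ v₃) * (form β v₁ v₂ * form β v₁ v₃ - form β v₁ v₁ * form β v₂ v₃) ≡
  (form β v₁ v₂ * form β v₁ v₂ - form β v₁ v₁ * form β v₂ v₂) * (form β v₁ v₃ * form β v₁ v₃ - form β v₁ v₁ * form β v₃ v₃)

-- The vectors lie in ℤ², so each 2×2 minor splits as disc q times a product of two determinants
-- against v₁; the relation is then commutativity.
polar-coplanar : ∀ q v₁ v₂ v₃ → Coplanar (polar q) v₁ v₂ v₃
polar-coplanar q@(bqf A B C) v₁ v₂ v₃ = begin
  m v₂ v₃ * m v₂ v₃                                                   ≡⟨ cong₂ _*_ (minor v₂ v₃) (minor v₂ v₃) ⟩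
  disc q * (d v₂ * d v₃) * (disc q * (d v₂ * d v₃))                   ≡⟨ swap (disc q) (d v₂) (d v₃) ⟩
  disc q * (d v₂ * d v₂) * (disc q * (d v₃ * d v₃))                   ≡⟨ sym (cong₂ _*_ (minor v₂ v₂) (minor v₃ v₃)) ⟩
  m v₂ v₂ * m v₃ v₃                                                   ∎
  where
  P = form (polar q)
  m : Vecℤ 2 → Vecℤ 2 → ℤ
  m v w = P v₁ v * P v₁ w - P v₁ v₁ * P v w
  d : Vecℤ 2 → ℤ
  d v = v₁ 0F * v 1F - v₁ 1F * v 0F
  swap : ∀ D x y → D * (x * y) * (D * (x * y)) ≡ D * (x * x) * (D * (y * y))
  swap = solve-∀
  minor : ∀ v w → m v w ≡ disc q * (d v * d w)
  minor v w = identity A B C (v₁ 0F) (v₁ 1F) (v 0F) (v 1F) (w 0F) (w 1F)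
    where
    identity : ∀ A B C x y z t u v →
      (+ 2 * A * (x * z) + B * (x * t + y * z) + + 2 * C * (y * t)) * (+ 2 * A * (x * u) + B * (x * v + y * u) + + 2 * C * (y * v)) -
      (+ 2 * A * (x * x) + B * (x * y + y * x) + + 2 * C * (y * y)) * (+ 2 * A * (z * u) + B * (z * v + t * u) + + 2 * C * (t * v)) ≡
      (B * B - + 4 * (A * C)) * ((x * t - y * z) * (x * v - y * u))
    identity = solve-∀

-- Cross products and coplanarity in ℤ³

cross : Vecℤ 3 → Vecℤ 3 → Vecℤ 3
cross u v 0F = u 1F * v 2F - u 2F * v 1F
cross u v 1F = u 2F * v 0F - u 0F * v 2F
cross u v 2F = u 0F * v 1F - u 1F * v 0F

cross-norm : ∀ u v → dot (cross u v) (cross u v) ≡ gramDet u v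
cross-norm u v = identity (u 0F) (u 1F) (u 2F) (v 0F) (v 1F) (v 2F)
  where
  identity : ∀ a b c x y z → let d = λ a b c x y z → a * x + (b * y + (c * z + + 0)) in
    d (b * z - c * y) (c * x - a * z) (a * y - b * x) (b * z - c * y) (c * x - a * z) (a * y - b * x) ≡
    d a b c a b c * d x y z x y z - d a b c x y z * d a b c x y z
  identity = solve-∀

cross-⊥ˡ : ∀ u v → dot u (cross u v) ≡ + 0
cross-⊥ˡ u v = identity (u 0F) (u 1F) (u 2F) (v 0F) (v 1F) (v 2F)
  where
  identity : ∀ a b c x y z → a * (b * z - c * y) + (b * (c * x - a * z) + (c * (a * y - b * x) + + 0)) ≡ + 0
  identity = solve-∀

cross-⊥ʳ : ∀ u v → dot v (cross u v) ≡ + 0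
cross-⊥ʳ u v = identity (u 0F) (u 1F) (u 2F) (v 0F) (v 1F) (v 2F)
  where
  identity : ∀ a b c x y z → x * (b * z - c * y) + (y * (c * x - a * z) + (z * (a * y - b * x) + + 0)) ≡ + 0
  identity = solve-∀

-- u·v×w annihilates W, hence vanishes.
triple-product-zero : ∀ u v w W → dot W W ≢ + 0 → dot u W ≡ + 0 → dot v W ≡ + 0 → dot w W ≡ + 0 →
  dot u (cross v w) ≡ + 0
triple-product-zero u v w W W≢0 uW vW wW = *≡0⇒≡0 W≢0 (begin
  dot W W * T                                                                         ≡⟨ identity (u 0F) (u 1F) (u 2F) (v 0F) (v 1F) (v 2F) (w 0F) (w 1F) (w 2F) (W 0F) (W 1F) (W 2F) ⟩
  dot u W * dot W (cross v w) + dot v W * dot W (cross w u) + dot w W * dot W (cross u v)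
                                                                                      ≡⟨ cong₃ (λ x y z → x * dot W (cross v w) + y * dot W (cross w u) + z * dot W (cross u v)) uW vW wW ⟩
  + 0 * dot W (cross v w) + + 0 * dot W (cross w u) + + 0 * dot W (cross u v)         ≡⟨ zeros (dot W (cross v w)) (dot W (cross w u)) (dot W (cross u v)) ⟩
  + 0                                                                                 ∎)
  where
  T = dot u (cross v w)
  zeros : ∀ x y z → + 0 * x + + 0 * y + + 0 * z ≡ + 0
  zeros = solve-∀
  identity : ∀ a b c d e f g h i x y z →
    let D = λ a b c x y z → a * x + (b * y + (c * z + + 0))
        X = λ p q r a b c x y z → p * (b * z - c * y) + (q * (c * x - a * z) + (r * (a * y - b * x) + + 0)) in
    D x y z x y z * X a b c d e f g h i ≡
    D a b c x y z * X x y z d e f g h i + D d e f x y z * X x y z g h i a b c + D g h i x y z * X x y z a b c d e f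
  identity = solve-∀

-- The two sides differ by a multiple of the Gram determinant of u, v, w. That determinant is the
-- square of their triple product, which vanishes because all three are orthogonal to W.
dot-coplanar : ∀ u v w W → dot W W ≢ + 0 → dot u W ≡ + 0 → dot v W ≡ + 0 → dot w W ≡ + 0 → Coplanar twiceDot u v w
dot-coplanar u v w W W≢0 uW vW wW =
  trans (scale (dot u u) (dot u v) (dot u w) (dot v v) (dot v w) (dot w w))
  (trans (cong (λ t → (+ 2 * b * (+ 2 * b) - + 2 * a * (+ 2 * d)) * (+ 2 * c * (+ 2 * c) - + 2 * a * (+ 2 * f)) - + 16 * (a * t)) det≡0)
    (drop ((+ 2 * b * (+ 2 * b) - + 2 * a * (+ 2 * d)) * (+ 2 * c * (+ 2 * c) - + 2 * a * (+ 2 * f))) a))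
  where
  a = dot u u ; b = dot u v ; c = dot u w ; d = dot v v ; e = dot v w ; f = dot w w
  scale : ∀ a b c d e f → (+ 2 * b * (+ 2 * c) - + 2 * a * (+ 2 * e)) * (+ 2 * b * (+ 2 * c) - + 2 * a * (+ 2 * e)) ≡
    (+ 2 * b * (+ 2 * b) - + 2 * a * (+ 2 * d)) * (+ 2 * c * (+ 2 * c) - + 2 * a * (+ 2 * f))
    - + 16 * (a * (a * (d * f - e * e) - b * (b * f - e * c) + c * (b * e - d * c)))
  scale = solve-∀
  drop : ∀ x a → x - + 16 * (a * (+ 0 * + 0)) ≡ x
  drop = solve-∀
  identity : ∀ a b c d e f g h i →
    let D = λ a b c x y z → a * x + (b * y + (c * z + + 0))
        X = λ p q r a b c x y z → p * (b * z - c * y) + (q * (c * x - a * z) + (r * (a * y - b * x) + + 0))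
        uu = D a b c a b c ; uv = D a b c d e f ; uw = D a b c g h i ; vv = D d e f d e f ; vw = D d e f g h i ; ww = D g h i g h i in
    uu * (vv * ww - vw * vw) - uv * (uv * ww - vw * uw) + uw * (uv * vw - vv * uw) ≡ X a b c d e f g h i * X a b c d e f g h i
  identity = solve-∀
  det≡0 : a * (d * f - e * e) - b * (b * f - e * c) + c * (b * e - d * c) ≡ + 0 * + 0
  det≡0 = trans (identity (u 0F) (u 1F) (u 2F) (v 0F) (v 1F) (v 2F) (w 0F) (w 1F) (w 2F))
    (cong₂ _*_ (triple-product-zero u v w W W≢0 uW vW wW) (triple-product-zero u v w W W≢0 uW vW wW))

-- This leaves two possible values for z.
coplanar-gram : ∀ {k} n a b c a′ b′ c′ (β : SymBilinear k) g → a ≢ + 0 → a′ ≢ + 0 →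
  a * c - b * b ≡ n → a′ * c′ - b′ * b′ ≡ n →
  Multiplicative (bqf a (+ 2 * b) c) (bqf a′ (+ 2 * b′) c′) β g →
  Coplanar β (g 0F 0F) (g 0F 1F) (g 1F 0F) →
  let z = form β (g 0F 1F) (g 1F 0F) in (z - + 2 * (b * b′)) * (z - + 2 * (b * b′)) ≡ + 2 * n * (+ 2 * n)
coplanar-gram n a b c a′ b′ c′ β g a≢0 a′≢0 Δ Δ′ mult coplanar =
  *-cancelˡ (*-≢0 (*-≢0 {+ 4} (λ ()) (*-≢0 a≢0 a′≢0)) (*-≢0 a≢0 a′≢0)) (begin
    + 4 * (a * a′) * (a * a′) * ((z - + 2 * (b * b′)) * (z - + 2 * (b * b′)))   ≡⟨ left a b a′ b′ z ⟩
    _                                                        ≡⟨ cong₃ (λ x y w → (x * y - w * z) * (x * y - w * z)) (sym (t 0F 0F 0F 1F)) (sym (t 0F 0F 1F 0F)) (sym (t 0F 0F 0F 0F)) ⟩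
    _                                                        ≡⟨ coplanar ⟩
    _                                                        ≡⟨ cong₅ (λ x w p y r → (x * x - w * p) * (y * y - w * r)) (t 0F 0F 0F 1F) (t 0F 0F 0F 0F) (t 0F 1F 0F 1F) (t 0F 0F 1F 0F) (t 1F 0F 1F 0F) ⟩
    _                                                        ≡⟨ right a b c a′ b′ c′ ⟩
    + 4 * (a * a′) * (a * a′) * (+ 2 * (a * c - b * b) * (+ 2 * (a′ * c′ - b′ * b′)))  ≡⟨ cong₂ (λ x y → + 4 * (a * a′) * (a * a′) * (+ 2 * x * (+ 2 * y))) Δ Δ′ ⟩
    + 4 * (a * a′) * (a * a′) * (+ 2 * n * (+ 2 * n))        ∎)
  where
  z = form β (g 0F 1F) (g 1F 0F)
  t = multiplicative-gram a b c a′ b′ c′ β g mult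
  left : ∀ a b a′ b′ z → + 4 * (a * a′) * (a * a′) * ((z - + 2 * (b * b′)) * (z - + 2 * (b * b′))) ≡
    (+ 2 * (a * b′) * (+ 2 * (b * a′)) - + 2 * (a * a′) * z) * (+ 2 * (a * b′) * (+ 2 * (b * a′)) - + 2 * (a * a′) * z)
  left = solve-∀
  right : ∀ a b c a′ b′ c′ →
    (+ 2 * (a * b′) * (+ 2 * (a * b′)) - + 2 * (a * a′) * (+ 2 * (a * c′))) * (+ 2 * (b * a′) * (+ 2 * (b * a′)) - + 2 * (a * a′) * (+ 2 * (c * a′))) ≡
    + 4 * (a * a′) * (a * a′) * (+ 2 * (a * c - b * b) * (+ 2 * (a′ * c′ - b′ * b′)))
  right = solve-∀

-- Imaginary parts of quaternion products

-- Im(x ȳ) for quaternions x and y.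
Φ : Vecℤ 4 → Vecℤ 4 → Vecℤ 3
Φ x y 0F = x 1F * y 0F - x 0F * y 1F - x 2F * y 3F + x 3F * y 2F
Φ x y 1F = x 2F * y 0F - x 0F * y 2F - x 3F * y 1F + x 1F * y 3F
Φ x y 2F = x 3F * y 0F - x 0F * y 3F - x 1F * y 2F + x 2F * y 1F

-- Gives the second product without a second definition: `Φ (conj x) (conj y)` is Im(x̄ y).
conj : Vecℤ 4 → Vecℤ 4
conj x 0F = x 0F
conj x (suc i) = - x (suc i)

conj-dot : ∀ x y → dot (conj x) (conj y) ≡ dot x y
conj-dot x y = identity (x 0F) (x 1F) (x 2F) (x 3F) (y 0F) (y 1F) (y 2F) (y 3F)
  where
  identity : ∀ a b c d p q r s → a * p + (- b * - q + (- c * - r + (- d * - s + + 0))) ≡ a * p + (b * q + (c * r + (d * s + + 0)))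
  identity = solve-∀

-- The quaternions x ȳ and x z̄ have inner product N(x)⟨y, z⟩ and real parts ⟨x, y⟩ and ⟨x, z⟩; the
-- product of the real parts is subtracted. For y = z this is the Gram determinant of x and y.
Φ-dot : ∀ x y z → dot (Φ x y) (Φ x z) ≡ dot x x * dot y z - dot x y * dot x z
Φ-dot x y z = identity (x 0F) (x 1F) (x 2F) (x 3F) (y 0F) (y 1F) (y 2F) (y 3F) (z 0F) (z 1F) (z 2F) (z 3F)
  where
  identity : ∀ a b c d p q r s t u v w →
    let φ₁ = λ a b c d p q r s → b * p - a * q - c * s + d * r
        φ₂ = λ a b c d p q r s → c * p - a * r - d * q + b * s
        φ₃ = λ a b c d p q r s → d * p - a * s - b * r + c * q
        D  = λ a b c d p q r s → a * p + (b * q + (c * r + (d * s + + 0))) in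
    φ₁ a b c d p q r s * φ₁ a b c d t u v w + (φ₂ a b c d p q r s * φ₂ a b c d t u v w + (φ₃ a b c d p q r s * φ₃ a b c d t u v w + + 0)) ≡
    D a b c d a b c d * D p q r s t u v w - D a b c d p q r s * D a b c d t u v w
  identity = solve-∀

Φ-antisym-dot : ∀ x y w → dot w (Φ x y) ≡ - dot w (Φ y x)
Φ-antisym-dot x y w = identity (w 0F) (w 1F) (w 2F) (x 0F) (x 1F) (x 2F) (x 3F) (y 0F) (y 1F) (y 2F) (y 3F)
  where
  identity : ∀ t u v a b c d p q r s →
    let φ₁ = λ a b c d p q r s → b * p - a * q - c * s + d * r
        φ₂ = λ a b c d p q r s → c * p - a * r - d * q + b * s
        φ₃ = λ a b c d p q r s → d * p - a * s - b * r + c * q in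
    t * φ₁ a b c d p q r s + (u * φ₂ a b c d p q r s + (v * φ₃ a b c d p q r s + + 0)) ≡
    - (t * φ₁ p q r s a b c d + (u * φ₂ p q r s a b c d + (v * φ₃ p q r s a b c d + + 0)))
  identity = solve-∀

-- When x ⊥ y the last term drops out. The values of the undetermined Gram number for the two
-- products are then mirror images of each other, so they take the two opposite signs allowed by
-- `coplanar-gram`.
Φ-conj-dot : ∀ x x′ y y′ →
  dot (Φ x y′) (Φ x′ y) + dot (Φ (conj x) (conj y′)) (Φ (conj x′) (conj y)) ≡
  + 2 * (dot x x′ * dot y y′) - + 2 * (dot x y * dot x′ y′)
Φ-conj-dot x x′ y y′ = identity (x 0F) (x 1F) (x 2F) (x 3F) (y 0F) (y 1F) (y 2F) (y 3F) (x′ 0F) (x′ 1F) (x′ 2F) (x′ 3F) (y′ 0F) (y′ 1F) (y′ 2F) (y′ 3F)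
  where
  identity : ∀ a b c d p q r s a′ b′ c′ d′ p′ q′ r′ s′ →
    let φ₁ = λ a b c d p q r s → b * p - a * q - c * s + d * r
        φ₂ = λ a b c d p q r s → c * p - a * r - d * q + b * s
        φ₃ = λ a b c d p q r s → d * p - a * s - b * r + c * q
        N  = λ a b c d p q r s a′ b′ c′ d′ p′ q′ r′ s′ → φ₁ a b c d p′ q′ r′ s′ * φ₁ a′ b′ c′ d′ p q r s +
               (φ₂ a b c d p′ q′ r′ s′ * φ₂ a′ b′ c′ d′ p q r s + (φ₃ a b c d p′ q′ r′ s′ * φ₃ a′ b′ c′ d′ p q r s + + 0))
        D  = λ a b c d p q r s → a * p + (b * q + (c * r + (d * s + + 0))) in
    N a b c d p q r s a′ b′ c′ d′ p′ q′ r′ s′ +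
    N a (- b) (- c) (- d) p (- q) (- r) (- s) a′ (- b′) (- c′) (- d′) p′ (- q′) (- r′) (- s′) ≡
    + 2 * (D a b c d a′ b′ c′ d′ * D p q r s p′ q′ r′ s′) - + 2 * (D a b c d p q r s * D a′ b′ c′ d′ p′ q′ r′ s′)
  identity = solve-∀

-- Expansion in the basis u, v, u × v; the hypothesis kills the third coordinate.
cross-span : ∀ u v w → dot w (cross u v) ≡ + 0 →
  ∀ i → gramDet u v * w i ≡ cramer₁ u v w * u i + cramer₂ u v w * v i
cross-span u v w ⊥ i = trans (identities i)
  (trans (cong (λ t → cramer₁ u v w * u i + cramer₂ u v w * v i + t * cross u v i) ⊥)
    (drop (cramer₁ u v w * u i + cramer₂ u v w * v i) (cross u v i)))
  where
  drop : ∀ x y → x + + 0 * y ≡ x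
  drop = solve-∀
  identities : ∀ i → gramDet u v * w i ≡ cramer₁ u v w * u i + cramer₂ u v w * v i + dot w (cross u v) * cross u v i
  identities 0F = identity (u 0F) (u 1F) (u 2F) (v 0F) (v 1F) (v 2F) (w 0F) (w 1F) (w 2F)
    where
    identity : ∀ a b c d e f x y z →
      let D = λ a b c x y z → a * x + (b * y + (c * z + + 0))
          uu = D a b c a b c ; uv = D a b c d e f ; vv = D d e f d e f ; wu = D x y z a b c ; wv = D x y z d e f in
      (uu * vv - uv * uv) * x ≡ (wu * vv - wv * uv) * a + (wv * uu - wu * uv) * d + D x y z (b * f - c * e) (c * d - a * f) (a * e - b * d) * (b * f - c * e)
    identity = solve-∀
  identities 1F = identity (u 0F) (u 1F) (u 2F) (v 0F) (v 1F) (v 2F) (w 0F) (w 1F) (w 2F)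
    where
    identity : ∀ a b c d e f x y z →
      let D = λ a b c x y z → a * x + (b * y + (c * z + + 0))
          uu = D a b c a b c ; uv = D a b c d e f ; vv = D d e f d e f ; wu = D x y z a b c ; wv = D x y z d e f in
      (uu * vv - uv * uv) * y ≡ (wu * vv - wv * uv) * b + (wv * uu - wu * uv) * e + D x y z (b * f - c * e) (c * d - a * f) (a * e - b * d) * (c * d - a * f)
    identity = solve-∀
  identities 2F = identity (u 0F) (u 1F) (u 2F) (v 0F) (v 1F) (v 2F) (w 0F) (w 1F) (w 2F)
    where
    identity : ∀ a b c d e f x y z →
      let D = λ a b c x y z → a * x + (b * y + (c * z + + 0))
          uu = D a b c a b c ; uv = D a b c d e f ; vv = D d e f d e f ; wu = D x y z a b c ; wv = D x y z d e f in
      (uu * vv - uv * uv) * z ≡ (wu * vv - wv * uv) * c + (wv * uu - wu * uv) * f + D x y z (b * f - c * e) (c * d - a * f) (a * e - b * d) * (a * e - b * d)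
    identity = solve-∀

-- The normal vector e × f has norm n by Lagrange's identity. Its orthogonal complement could a
-- priori be larger than ⟨e, f⟩; squarefreeness of n rules this out.
squareFree-genus : ∀ {n} → SquareFree n → ∀ e f → gramDet e f ≡ + n → InGenusG n (FormOf e f)
squareFree-genus sf e f Δ = cross e f , trans (cross-norm e f) Δ , e , f ,
  (cross-⊥ˡ e f , cross-⊥ʳ e f , gramDet-independent e f (λ p → squareFree⇒≢0 sf (trans (sym Δ) p)) ,
   λ w ⊥ → squareFree-span sf e f w Δ λ i → trans (cong (_* w i) (sym Δ)) (cross-span e f w ⊥ i)) ,
  equiv-refl (FormOf e f)
  where
  equiv-refl : ∀ f → Equiv f f
  equiv-refl f = + 1 , + 0 , + 0 , + 1 , inj₁ refl , λ x y → cong₂ (evalF f) (first x y) (second x y)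
    where
    first : ∀ x y → + 1 * x + + 0 * y ≡ x
    first = solve-∀
    second : ∀ x y → + 0 * x + + 1 * y ≡ y
    second = solve-∀

evalF-FormOf : ∀ {k} (u v : Vecℤ k) x y → evalF (FormOf u v) x y ≡ dot (comb x u y v) (comb x u y v)
evalF-FormOf u v x y = sym (trans (dot-bilinear x y x y u v) (identity (dot u u) (dot u v) (dot v v) x y))
  where
  identity : ∀ a b c x y → x * x * a + (x * y + y * x) * b + y * y * c ≡ a * (x * x) + + 2 * b * (x * y) + c * (y * y)
  identity = solve-∀

dot-comb-zero : ∀ {k} x y (u v w : Vecℤ k) → dot u w ≡ + 0 → dot v w ≡ + 0 → dot (comb x u y v) w ≡ + 0
dot-comb-zero x y u v w p q = trans (dot-linearˡ x y u v w) (trans (cong₂ (λ s t → x * s + y * t) p q) (zeros x y))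
  where
  zeros : ∀ x y → x * + 0 + y * + 0 ≡ + 0
  zeros = solve-∀

-- The quaternion norm is multiplicative, and x ȳ is purely imaginary for orthogonal x and y.
Φ-multiplicative : ∀ (x y : Fin 2 → Vecℤ 4) → (∀ i j → dot (x i) (y j) ≡ + 0) →
  Multiplicative (FormOf (x 0F) (x 1F)) (FormOf (y 0F) (y 1F)) twiceDot (λ i j → Φ (x i) (y j))
Φ-multiplicative x y x⊥y s t = cong (+ 2 *_) (begin
  dot M M                                     ≡⟨ dot-congˡ M M≡ ⟩
  dot (Φ X Y) M                               ≡⟨ dot-comm (Φ X Y) M ⟩
  dot M (Φ X Y)                               ≡⟨ dot-congˡ (Φ X Y) M≡ ⟩
  dot (Φ X Y) (Φ X Y)                         ≡⟨ Φ-dot X Y Y ⟩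
  dot X X * dot Y Y - dot X Y * dot X Y       ≡⟨ cong (λ t → dot X X * dot Y Y - t * dot X Y) X⊥Y ⟩
  dot X X * dot Y Y - + 0 * dot X Y           ≡⟨ drop (dot X X) (dot Y Y) (dot X Y) ⟩
  dot X X * dot Y Y                           ≡⟨ cong₂ _*_ (sym (evalF-FormOf (x 0F) (x 1F) (s 0F) (s 1F))) (sym (evalF-FormOf (y 0F) (y 1F) (t 0F) (t 1F))) ⟩
  evalF (FormOf (x 0F) (x 1F)) (s 0F) (s 1F) * evalF (FormOf (y 0F) (y 1F)) (t 0F) (t 1F) ∎)
  where
  M = tensorMap (λ i j → Φ (x i) (y j)) (s ⊗ t)
  X = comb (s 0F) (x 0F) (s 1F) (x 1F)
  Y = comb (t 0F) (y 0F) (t 1F) (y 1F)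
  drop : ∀ a b c → a * b - + 0 * c ≡ a * b
  drop = solve-∀
  X⊥Y : dot X Y ≡ + 0
  X⊥Y = dot-comb-zero (s 0F) (s 1F) (x 0F) (x 1F) Y (⊥Y 0F) (⊥Y 1F)
    where
    ⊥Y : ∀ i → dot (x i) Y ≡ + 0
    ⊥Y i = trans (dot-comm (x i) Y) (dot-comb-zero (t 0F) (t 1F) (y 0F) (y 1F) (x i)
      (trans (dot-comm (y 0F) (x i)) (x⊥y i 0F)) (trans (dot-comm (y 1F) (x i)) (x⊥y i 1F)))
  bilinear : ∀ s₀ s₁ t₀ t₁ a b c d a′ b′ c′ d′ p q r s p′ q′ r′ s′ →
    let φ = λ a b c d p q r s → b * p - a * q - c * s + d * r in
    s₀ * t₀ * φ a b c d p q r s + s₀ * t₁ * φ a b c d p′ q′ r′ s′ + s₁ * t₀ * φ a′ b′ c′ d′ p q r s + s₁ * t₁ * φ a′ b′ c′ d′ p′ q′ r′ s′ ≡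
    φ (s₀ * a + s₁ * a′) (s₀ * b + s₁ * b′) (s₀ * c + s₁ * c′) (s₀ * d + s₁ * d′) (t₀ * p + t₁ * p′) (t₀ * q + t₁ * q′) (t₀ * r + t₁ * r′) (t₀ * s + t₁ * s′)
  bilinear = solve-∀
  M≡ : ∀ i → M i ≡ Φ X Y i
  -- `Φ` is equivariant under cyclic permutation of the imaginary units, so one polynomial identity
  -- serves all three components.
  M≡ 0F = bilinear (s 0F) (s 1F) (t 0F) (t 1F) (x 0F 0F) (x 0F 1F) (x 0F 2F) (x 0F 3F) (x 1F 0F) (x 1F 1F) (x 1F 2F) (x 1F 3F)
                   (y 0F 0F) (y 0F 1F) (y 0F 2F) (y 0F 3F) (y 1F 0F) (y 1F 1F) (y 1F 2F) (y 1F 3F)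
  M≡ 1F = bilinear (s 0F) (s 1F) (t 0F) (t 1F) (x 0F 0F) (x 0F 2F) (x 0F 3F) (x 0F 1F) (x 1F 0F) (x 1F 2F) (x 1F 3F) (x 1F 1F)
                   (y 0F 0F) (y 0F 2F) (y 0F 3F) (y 0F 1F) (y 1F 0F) (y 1F 2F) (y 1F 3F) (y 1F 1F)
  M≡ 2F = bilinear (s 0F) (s 1F) (t 0F) (t 1F) (x 0F 0F) (x 0F 3F) (x 0F 1F) (x 0F 2F) (x 1F 0F) (x 1F 3F) (x 1F 1F) (x 1F 2F)
                   (y 0F 0F) (y 0F 3F) (y 0F 1F) (y 0F 2F) (y 1F 0F) (y 1F 3F) (y 1F 1F) (y 1F 2F)

-- All products x ȳ are orthogonal to Im(x₀ x̄₁).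
Φ-coplanar : ∀ (x y : Fin 2 → Vecℤ 4) → (∀ i j → dot (x i) (y j) ≡ + 0) → gramDet (x 0F) (x 1F) ≢ + 0 →
  Coplanar twiceDot (Φ (x 0F) (y 0F)) (Φ (x 0F) (y 1F)) (Φ (x 1F) (y 0F))
Φ-coplanar x y x⊥y Δ≢0 = dot-coplanar (Φ (x 0F) (y 0F)) (Φ (x 0F) (y 1F)) (Φ (x 1F) (y 0F)) W (λ p → Δ≢0 (trans (sym (Φ-dot (x 0F) (x 1F) (x 1F))) p)) (⊥₀ 0F) (⊥₀ 1F) (⊥₁ 0F)
  where
  W = Φ (x 0F) (x 1F)
  zeros : ∀ a b → a * + 0 - + 0 * b ≡ + 0
  zeros = solve-∀
  ⊥ : ∀ i k j → dot (Φ (x i) (y j)) (Φ (x i) (x k)) ≡ + 0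
  ⊥ i k j = trans (Φ-dot (x i) (y j) (x k)) (trans
    (cong₂ (λ s t → dot (x i) (x i) * s - t * dot (x i) (x k)) (trans (dot-comm (y j) (x k)) (x⊥y k j)) (x⊥y i j))
    (zeros (dot (x i) (x i)) (dot (x i) (x k))))
  ⊥₀ : ∀ j → dot (Φ (x 0F) (y j)) W ≡ + 0
  ⊥₀ = ⊥ 0F 1F
  ⊥₁ : ∀ j → dot (Φ (x 1F) (y j)) W ≡ + 0
  ⊥₁ j = trans (Φ-antisym-dot (x 0F) (x 1F) (Φ (x 1F) (y j))) (cong -_ (⊥ 1F 0F j))

-- The discriminant of a composite

det⇒≢0 : ∀ {n} → SquareFree n → ∀ {i j} b → i * j ≡ b * b + + n → i ≢ + 0
det⇒≢0 {n} sf {i} {j} b p refl = squareFree⇒≢0 sf (ℤ.≤-antisym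
  (subst₂ ℤ._≤_ (ℤ.+-identityˡ (+ n)) (sym p) (ℤ.+-monoˡ-≤ (+ n) (square-nonNeg b))) (ℤ.+≤+ ℕ.z≤n))

-- Restricted to s ⊗ ℤ², μ is a linear map of determinant d carrying q to q₁(s) q₂; compare discriminants.
composition-disc : ∀ {q₁ q₂ q} m n → disc q ≡ - (+ 4 * m) → disc q₂ ≡ - (+ 4 * n) → IsLegendreComposition q₁ q₂ q →
  ∀ s₀ s₁ → ∃[ d ] m * (d * d) ≡ n * (evalF q₁ s₀ s₁ * evalF q₁ s₀ s₁)
composition-disc {q₁} {q₂@(bqf a b c)} {q} m n Dq Dq₂ (μ , _ , mult) s₀ s₁ = d ,
  *-cancelˡ {i = - (+ 4)} (λ ()) (begin
    - (+ 4) * (m * (d * d))             ≡⟨ assoc m (d * d) ⟩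
    - (+ 4 * m) * (d * d)               ≡⟨ cong (_* (d * d)) (sym Dq) ⟩
    disc q * (d * d)                    ≡⟨ sym (disc-act q (p 0F) (r 0F) (p 1F) (r 1F)) ⟩
    disc (act q (p 0F) (r 0F) (p 1F) (r 1F)) ≡⟨ cong disc scaled ⟩
    disc (bqf (v * a) (v * b) (v * c))  ≡⟨ disc-scale v a b c ⟩
    v * v * disc q₂                     ≡⟨ cong (v * v *_) Dq₂ ⟩
    v * v * - (+ 4 * n)                 ≡⟨ assoc′ v n ⟩
    - (+ 4) * (n * (v * v))             ∎)
  where
  v = evalF q₁ s₀ s₁
  p r : Vecℤ 2
  p k = s₀ * μ 0F 0F k + s₁ * μ 1F 0F k
  r k = s₀ * μ 0F 1F k + s₁ * μ 1F 1F k
  d = p 0F * r 1F - r 0F * p 1F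
  assoc : ∀ m d → - (+ 4) * (m * d) ≡ - (+ 4 * m) * d
  assoc = solve-∀
  assoc′ : ∀ v n → v * v * - (+ 4 * n) ≡ - (+ 4) * (n * (v * v))
  assoc′ = solve-∀
  disc-scale : ∀ v a b c → v * b * (v * b) - + 4 * (v * a * (v * c)) ≡ v * v * (b * b - + 4 * (a * c))
  disc-scale = solve-∀
  apply : ∀ x y k → p k * x + r k * y ≡ tensorApply μ (λ i j → vec2 s₀ s₁ i * vec2 x y j) k
  apply x y k = identity s₀ s₁ x y (μ 0F 0F k) (μ 0F 1F k) (μ 1F 0F k) (μ 1F 1F k)
    where
    identity : ∀ s t x y a b c d → (s * a + t * c) * x + (s * b + t * d) * y ≡ s * x * a + s * y * b + t * x * c + t * y * d
    identity = solve-∀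
  scaled : act q (p 0F) (r 0F) (p 1F) (r 1F) ≡ bqf (v * a) (v * b) (v * c)
  scaled = bqf-ext (act q (p 0F) (r 0F) (p 1F) (r 1F)) (bqf (v * a) (v * b) (v * c)) λ x y → trans (evalF-act q (p 0F) (r 0F) (p 1F) (r 1F) x y)
    (trans (cong₂ (evalF q) (apply x y 0F) (apply x y 1F))
    (trans (sym (mult (vec2 s₀ s₁) (vec2 x y))) (distrib v a b c x y)))
    where
    distrib : ∀ v a b c x y → v * (a * (x * x) + b * (x * y) + c * (y * y)) ≡ v * a * (x * x) + v * b * (x * y) + v * c * (y * y)
    distrib = solve-∀

-- The ratio m / n is the square of a divisor k of the value v. For different v the k agree up to
-- sign, since they have the same square.
SquareRatio : ℤ → ℤ → ℤ → Set
SquareRatio m n v = Σ ℤ λ k → (∃[ d ] v ≡ k * d) × m ≡ n * (k * k)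

-- From m d² = n v² and squarefreeness of n, the determinant d divides v; the quotient is k.
composition-ratio : ∀ {n} → SquareFree n → ∀ q₁ q₂ q m → disc q ≡ - (+ 4 * m) → disc q₂ ≡ - (+ 4 * + n) →
  IsLegendreComposition q₁ q₂ q → ∀ s₀ s₁ v → evalF q₁ s₀ s₁ ≡ v → v ≢ + 0 → SquareRatio m (+ n) v
composition-ratio {n} sf q₁ q₂ q m Dq Dq₂ comp s₀ s₁ v refl v≢0 =
  k , (d , v≡) , *-cancelˡ (*-≢0 d≢0 d≢0) (trans (ℤ.*-comm (d * d) m) (trans p
    (trans (cong (λ t → + n * (t * t)) v≡) (rearr (+ n) k d))))
  where
  dp = composition-disc {q₁} {q₂} {q} m (+ n) Dq Dq₂ comp s₀ s₁
  d = proj₁ dp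
  p = proj₂ dp
  d≢0 : d ≢ + 0
  d≢0 d≡0 = *-≢0 (squareFree⇒≢0 sf) (*-≢0 v≢0 v≢0)
    (trans (sym p) (trans (cong (λ t → m * (t * t)) d≡0) (ℤ.*-zeroʳ m)))
  dv = squareFree-²∣² sf d v m d≢0 p
  k = proj₁ dv
  v≡ = proj₂ dv
  rearr : ∀ n k d → n * (k * d * (k * d)) ≡ d * d * (n * (k * k))
  rearr = solve-∀

-- A single k divides a, c and a + 2b + c, hence is ±1 by `content-unit`.
squareRatio-unit : ∀ {n} → SquareFree n → n % 4 ≡ 1 → ∀ m a b c → a * c - b * b ≡ + n →
  SquareRatio m (+ n) a → SquareRatio m (+ n) c → SquareRatio m (+ n) (a + + 2 * b + c) → m ≡ + n
squareRatio-unit {n} sf n≡1 m _ b c Δ (k , (α , refl) , m≡) r₂ r₃ =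
  trans m≡ (trans (cong (+ n *_) k²≡1) (ℤ.*-identityʳ (+ n)))
  where
  divides-by-k : ∀ {v} → SquareRatio m (+ n) v → ∃[ d ] v ≡ k * d
  divides-by-k (k′ , (d , v≡) , m≡′) with squares-equal k k′ (*-cancelˡ (squareFree⇒≢0 sf) (trans (sym m≡) m≡′))
  ... | inj₁ k≡ = d , trans v≡ (cong (_* d) (sym k≡))
  ... | inj₂ k≡ = - d , trans v≡ (trans (sign k′ d) (cong (_* - d) (sym k≡)))
    where
    sign : ∀ k d → k * d ≡ - k * - d
    sign = solve-∀
  γ = proj₁ (divides-by-k r₂)
  c≡ = proj₂ (divides-by-k r₂)
  ε = proj₁ (divides-by-k r₃)
  e≡ = proj₂ (divides-by-k r₃)
  k²≡1 : k * k ≡ + 1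
  k²≡1 = content-unit sf n≡1 k α γ ε b (trans (cong (λ t → k * α * t - b * b) (sym c≡)) Δ)
    (trans (cong (λ t → k * α + + 2 * b + t) (sym c≡)) e≡)

det⇒product : ∀ a b c {n} → a * c - b * b ≡ n → a * c ≡ b * b + n
det⇒product a b c refl = identity a b c
  where
  identity : ∀ a b c → a * c ≡ b * b + (a * c - b * b)
  identity = solve-∀

-- Comparison of determinants is made at the vectors (1,0), (0,1) and (1,1), whose values control
-- the content of the form. They are nonzero because each divides a number of the form square plus
-- n.
composition-det : ∀ {n} → SquareFree n → n % 4 ≡ 1 → ∀ a b c q₂ q m → a * c - b * b ≡ + n →
  disc q ≡ - (+ 4 * m) → disc q₂ ≡ - (+ 4 * + n) → IsLegendreComposition (bqf a (+ 2 * b) c) q₂ q → m ≡ + n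
composition-det {n} sf n≡1 a b c q₂ q m Δ Dq Dq₂ comp = squareRatio-unit sf n≡1 m a b c Δ
  (ratio (+ 1) (+ 0) a (value₁ a b c) (det⇒≢0 sf b (det⇒product a b c Δ)))
  (ratio (+ 0) (+ 1) c (value₂ a b c) (det⇒≢0 sf b (trans (ℤ.*-comm c a) (det⇒product a b c Δ))))
  (ratio (+ 1) (+ 1) (a + + 2 * b + c) (value₃ a b c) (det⇒≢0 sf (a + b) (trans (completeSquare a b c) (cong (λ t → (a + b) * (a + b) + t) Δ))))
  where
  ratio = composition-ratio sf (bqf a (+ 2 * b) c) q₂ q m Dq Dq₂ comp
  value₁ : ∀ a b c → a * (+ 1 * + 1) + + 2 * b * (+ 1 * + 0) + c * (+ 0 * + 0) ≡ a
  value₁ = solve-∀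
  value₂ : ∀ a b c → a * (+ 0 * + 0) + + 2 * b * (+ 0 * + 1) + c * (+ 1 * + 1) ≡ c
  value₂ = solve-∀
  value₃ : ∀ a b c → a * (+ 1 * + 1) + + 2 * b * (+ 1 * + 1) + c * (+ 1 * + 1) ≡ a + + 2 * b + c
  value₃ = solve-∀
  completeSquare : ∀ a b c → (a + + 2 * b + c) * a ≡ (a + b) * (a + b) + (a * c - b * b)
  completeSquare = solve-∀

disc⇒det : ∀ a b c n → disc (bqf a (+ 2 * b) c) ≡ - (+ 4 * n) → a * c - b * b ≡ n
disc⇒det a b c n p = *-cancelˡ {i = - (+ 4)} (λ ()) (trans (identity a b c) (trans p (identity′ n)))
  where
  identity : ∀ a b c → - (+ 4) * (a * c - b * b) ≡ + 2 * b * (+ 2 * b) - + 4 * (a * c)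
  identity = solve-∀
  identity′ : ∀ n → - (+ 4 * n) ≡ - (+ 4) * n
  identity′ = solve-∀

-- From orthogonal planes to the genus

-- Once the remaining Gram number agrees, the whole Gram tables of μ and g agree. Preimages under μ
-- of the two unit vectors, pushed forward by g, therefore form a pair in ℤ³ with exactly the form
-- q.
isometric-genus : ∀ {n} → SquareFree n → n % 4 ≡ 1 → ∀ a b c a′ b′ c′ q → a * c - b * b ≡ + n → a′ * c′ - b′ * b′ ≡ + n →
  (C@(μ , _) : IsLegendreComposition (bqf a (+ 2 * b) c) (bqf a′ (+ 2 * b′) c′) q) → ∀ g →
  Multiplicative (bqf a (+ 2 * b) c) (bqf a′ (+ 2 * b′) c′) (polar q) μ →
  Multiplicative (bqf a (+ 2 * b) c) (bqf a′ (+ 2 * b′) c′) (twiceDot {3}) g →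
  form (polar q) (μ 0F 1F) (μ 1F 0F) ≡ form (twiceDot {3}) (g 0F 1F) (g 1F 0F) → InGenusG n q
isometric-genus {n} sf n≡1 a b c a′ b′ c′ q@(bqf A B′ C) Δ Δ′ comp@(μ , surj , _) g μ-mult g-mult z≡ =
  subst (InGenusG n) q≡ (squareFree-genus sf e f Δef)
  where
  unit : Fin 2 → Vecℤ 2
  unit 0F 0F = + 1
  unit 0F 1F = + 0
  unit 1F 0F = + 0
  unit 1F 1F = + 1
  τ : Fin 2 → Fin 2 → Fin 2 → ℤ
  τ i = proj₁ (surj (unit i))
  e f : Vecℤ 3
  e = tensorMap g (τ 0F)
  f = tensorMap g (τ 1F)
  gram : ∀ i j k l → form twiceDot (g i j) (g k l) ≡ form (polar q) (μ i j) (μ k l)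
  gram i j k l = trans (multiplicative-gram a b c a′ b′ c′ twiceDot g g-mult i j k l)
    (trans (cong (λ z → gramTable a b c a′ b′ c′ z i j k l) (sym z≡)) (sym (multiplicative-gram a b c a′ b′ c′ (polar q) μ μ-mult i j k l)))
  isometry : ∀ t t′ → form twiceDot (tensorMap g t) (tensorMap g t′) ≡ form (polar q) (tensorMap μ t) (tensorMap μ t′)
  isometry t t′ = trans (form-expand twiceDot g t t′) (trans (Σ₄-cong t λ i j → Σ₄-cong t′ λ k l → gram i j k l) (sym (form-expand (polar q) μ t t′)))
  pol : ℤ → ℤ → ℤ → ℤ → ℤ
  pol x y z w = + 2 * A * (x * z) + B′ * (x * w + y * z) + + 2 * C * (y * w)
  on-basis : ∀ i j → + 2 * dot (tensorMap g (τ i)) (tensorMap g (τ j)) ≡ form (polar q) (unit i) (unit j)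
  on-basis i j = trans (isometry (τ i) (τ j)) (cong₄ pol (proj₂ (surj (unit i)) 0F) (proj₂ (surj (unit i)) 1F) (proj₂ (surj (unit j)) 0F) (proj₂ (surj (unit j)) 1F))
    where
    cong₄ : ∀ (f : ℤ → ℤ → ℤ → ℤ → ℤ) {x x′ y y′ z z′ u u′} → x ≡ x′ → y ≡ y′ → z ≡ z′ → u ≡ u′ → f x y z u ≡ f x′ y′ z′ u′
    cong₄ f refl refl refl refl = refl
  pol₁₁ : ∀ A B C → + 2 * A * (+ 1 * + 1) + B * (+ 1 * + 0 + + 0 * + 1) + + 2 * C * (+ 0 * + 0) ≡ + 2 * A
  pol₁₁ = solve-∀
  pol₁₂ : ∀ A B C → + 2 * A * (+ 1 * + 0) + B * (+ 1 * + 1 + + 0 * + 0) + + 2 * C * (+ 0 * + 1) ≡ B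
  pol₁₂ = solve-∀
  pol₂₂ : ∀ A B C → + 2 * A * (+ 0 * + 0) + B * (+ 0 * + 1 + + 1 * + 0) + + 2 * C * (+ 1 * + 1) ≡ + 2 * C
  pol₂₂ = solve-∀
  q≡ : FormOf e f ≡ q
  q≡ = bqf-cong (*-cancelˡ {+ 2} (λ ()) (trans (on-basis 0F 0F) (pol₁₁ A B′ C))) (trans (on-basis 0F 1F) (pol₁₂ A B′ C))
                (*-cancelˡ {+ 2} (λ ()) (trans (on-basis 1F 1F) (pol₂₂ A B′ C)))
  Δef : gramDet e f ≡ + n
  Δef = composition-det sf n≡1 a b c (bqf a′ (+ 2 * b′) c′) q (gramDet e f) Δ
    (trans (cong disc (sym q≡)) (disc-FormOf e f))
    (trans (identity a′ b′ c′) (cong (λ t → - (+ 4 * t)) Δ′)) comp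
    where
    identity : ∀ a b c → + 2 * b * (+ 2 * b) - + 4 * (a * c) ≡ - (+ 4 * (a * c - b * b))
    identity = solve-∀

-- The products x ȳ and x̄ y realise the two possible values of the remaining Gram number.
orthogonal⇒genus : ∀ {n} → SquareFree n → n % 4 ≡ 1 → ∀ (x y : Fin 2 → Vecℤ 4) → (∀ i j → dot (x i) (y j) ≡ + 0) →
  gramDet (x 0F) (x 1F) ≡ + n → gramDet (y 0F) (y 1F) ≡ + n →
  ∀ q → IsLegendreComposition (FormOf (x 0F) (x 1F)) (FormOf (y 0F) (y 1F)) q → InGenusG n q
orthogonal⇒genus {n} sf n≡1 x y x⊥y Δx Δy q comp@(μ , surj , mult)
  -- Both squares are (2n)². So z is the Gram number of x ȳ or its reflection in 2bb′, and the
  -- reflection is the Gram number of x̄ y.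
  = conclude (squares-equal (z - + 2 * (b * b′)) (+ 2 * zΦ - + 2 * (b * b′)) (trans μ-square (sym Φ-square)))
  where
  a = dot (x 0F) (x 0F) ; b = dot (x 0F) (x 1F) ; c = dot (x 1F) (x 1F)
  a′ = dot (y 0F) (y 0F) ; b′ = dot (y 0F) (y 1F) ; c′ = dot (y 1F) (y 1F)
  a≢0 = det⇒≢0 sf b (det⇒product a b c Δx)
  a′≢0 = det⇒≢0 sf b′ (det⇒product a′ b′ c′ Δy)
  μ-mult : Multiplicative (FormOf (x 0F) (x 1F)) (FormOf (y 0F) (y 1F)) (polar q) μ
  μ-mult s t = trans (polar-diag q (tensorMap μ (s ⊗ t))) (cong (+ 2 *_) (sym (mult s t)))
  μ-square = coplanar-gram (+ n) a b c a′ b′ c′ (polar q) μ a≢0 a′≢0 Δx Δy μ-mult (polar-coplanar q (μ 0F 0F) (μ 0F 1F) (μ 1F 0F))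
  Φ-square = coplanar-gram (+ n) a b c a′ b′ c′ twiceDot (λ i j → Φ (x i) (y j)) a≢0 a′≢0 Δx Δy (Φ-multiplicative x y x⊥y)
    (Φ-coplanar x y x⊥y (λ p → squareFree⇒≢0 sf (trans (sym Δx) p)))
  Q₁ = FormOf (x 0F) (x 1F)
  Q₂ = FormOf (y 0F) (y 1F)
  Ψ-mult : Multiplicative Q₁ Q₂ twiceDot (λ i j → Φ (conj (x i)) (conj (y j)))
  Ψ-mult = subst₂ (λ p r → Multiplicative p r twiceDot (λ i j → Φ (conj (x i)) (conj (y j))))
    (FormOf-conj (x 0F) (x 1F)) (FormOf-conj (y 0F) (y 1F))
    (Φ-multiplicative (λ i → conj (x i)) (λ i → conj (y i)) (λ i j → trans (conj-dot (x i) (y j)) (x⊥y i j)))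
    where
    FormOf-conj : ∀ u v → FormOf (conj u) (conj v) ≡ FormOf u v
    FormOf-conj u v = bqf-cong (conj-dot u u) (cong (+ 2 *_) (conj-dot u v)) (conj-dot v v)
  z zΦ zΨ : ℤ
  z  = form (polar q) (μ 0F 1F) (μ 1F 0F)
  zΦ = dot (Φ (x 0F) (y 1F)) (Φ (x 1F) (y 0F))
  zΨ = dot (Φ (conj (x 0F)) (conj (y 1F))) (Φ (conj (x 1F)) (conj (y 0F)))
  sum : zΦ + zΨ ≡ + 2 * (b * b′)
  sum = trans (Φ-conj-dot (x 0F) (x 1F) (y 0F) (y 1F))
    (trans (cong (λ t → + 2 * (b * b′) - + 2 * (t * dot (x 1F) (y 1F))) (x⊥y 0F 0F)) (drop (b * b′) (dot (x 1F) (y 1F))))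
    where
    drop : ∀ s t → + 2 * s - + 2 * (+ 0 * t) ≡ + 2 * s
    drop = solve-∀
  conclude : z - + 2 * (b * b′) ≡ + 2 * zΦ - + 2 * (b * b′) ⊎ z - + 2 * (b * b′) ≡ - (+ 2 * zΦ - + 2 * (b * b′)) → InGenusG n q
  conclude (inj₁ p) = isometric-genus sf n≡1 a b c a′ b′ c′ q Δx Δy comp (λ i j → Φ (x i) (y j)) μ-mult (Φ-multiplicative x y x⊥y)
    (trans (shift z (+ 2 * (b * b′))) (trans (cong (_+ + 2 * (b * b′)) p) (sym (shift (+ 2 * zΦ) (+ 2 * (b * b′))))))
    where
    shift : ∀ z t → z ≡ z - t + t
    shift = solve-∀
  conclude (inj₂ p) = isometric-genus sf n≡1 a b c a′ b′ c′ q Δx Δy comp (λ i j → Φ (conj (x i)) (conj (y j))) μ-mult Ψ-mult (begin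
    z                                                    ≡⟨ shift z (+ 2 * (b * b′)) ⟩
    z - + 2 * (b * b′) + + 2 * (b * b′)                  ≡⟨ cong (_+ + 2 * (b * b′)) p ⟩
    - (+ 2 * zΦ - + 2 * (b * b′)) + + 2 * (b * b′)       ≡⟨ cong (λ t → - (+ 2 * zΦ - t) + t) (sym sum) ⟩
    - (+ 2 * zΦ - (zΦ + zΨ)) + (zΦ + zΨ)                 ≡⟨ cancel zΦ zΨ ⟩
    + 2 * zΨ                                             ∎)
    where
    shift : ∀ z t → z ≡ z - t + t
    shift = solve-∀
    cancel : ∀ s t → - (+ 2 * s - (s + t)) + (s + t) ≡ + 2 * t
    cancel = solve-∀

-- Lipschitz quaternions

-- A record in place of `Vecℤ 4`, so that componentwise equality gives propositional equality and
-- quaternion equations can be substituted; vectors as functions would require extensionality.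
record ℍ : Set where
  constructor quat
  field
    re im₁ im₂ im₃ : ℤ

quat-cong : ∀ {a a′ b b′ c c′ d d′} → a ≡ a′ → b ≡ b′ → c ≡ c′ → d ≡ d′ → quat a b c d ≡ quat a′ b′ c′ d′
quat-cong refl refl refl refl = refl

infixl 7 _·_
infixr 8 _⋆_
infixl 6 _⊖_

_·_ : ℍ → ℍ → ℍ
quat a b c d · quat p q r s = quat (a * p - b * q - c * r - d * s)
  (a * q + b * p + c * s - d * r) (a * r + c * p + d * q - b * s) (a * s + d * p + b * r - c * q)

_⋆_ : ℤ → ℍ → ℍ
k ⋆ quat a b c d = quat (k * a) (k * b) (k * c) (k * d)

_⊖_ : ℍ → ℍ → ℍ
quat a b c d ⊖ quat p q r s = quat (a - p) (b - q) (c - r) (d - s)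

1ℍ : ℍ
1ℍ = quat (+ 1) (+ 0) (+ 0) (+ 0)

conjugate : ℍ → ℍ
conjugate (quat a b c d) = quat a (- b) (- c) (- d)

⟪_,_⟫ : ℍ → ℍ → ℤ
⟪ quat a b c d , quat p q r s ⟫ = a * p + (b * q + (c * r + (d * s + + 0)))

N : ℍ → ℤ
N x = ⟪ x , x ⟫

N-· : ∀ x y → N (x · y) ≡ N x * N y
N-· (quat a b c d) (quat p q r s) = identity a b c d p q r s
  where
  identity : ∀ a b c d p q r s →
    let M = λ a b c d → a * a + (b * b + (c * c + (d * d + + 0))) in
    M (a * p - b * q - c * r - d * s) (a * q + b * p + c * s - d * r) (a * r + c * p + d * q - b * s) (a * s + d * p + b * r - c * q) ≡
    M a b c d * M p q r s
  identity = solve-∀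

·-assoc : ∀ x y z → (x · y) · z ≡ x · (y · z)
·-assoc (quat a b c d) (quat p q r s) (quat t u v w) = quat-cong
  (real a b c d p q r s t u v w) (imag₁ a b c d p q r s t u v w) (imag₂ a b c d p q r s t u v w) (imag₃ a b c d p q r s t u v w)
  where
  real : ∀ a b c d p q r s t u v w →
    let R = λ a b c d p q r s → a * p - b * q - c * r - d * s ; I = λ a b c d p q r s → a * q + b * p + c * s - d * r
        J = λ a b c d p q r s → a * r + c * p + d * q - b * s ; K = λ a b c d p q r s → a * s + d * p + b * r - c * q in
    R (R a b c d p q r s) (I a b c d p q r s) (J a b c d p q r s) (K a b c d p q r s) t u v w ≡
    R a b c d (R p q r s t u v w) (I p q r s t u v w) (J p q r s t u v w) (K p q r s t u v w)
  real = solve-∀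
  imag₁ : ∀ a b c d p q r s t u v w →
    let R = λ a b c d p q r s → a * p - b * q - c * r - d * s ; I = λ a b c d p q r s → a * q + b * p + c * s - d * r
        J = λ a b c d p q r s → a * r + c * p + d * q - b * s ; K = λ a b c d p q r s → a * s + d * p + b * r - c * q in
    I (R a b c d p q r s) (I a b c d p q r s) (J a b c d p q r s) (K a b c d p q r s) t u v w ≡
    I a b c d (R p q r s t u v w) (I p q r s t u v w) (J p q r s t u v w) (K p q r s t u v w)
  imag₁ = solve-∀
  imag₂ : ∀ a b c d p q r s t u v w →
    let R = λ a b c d p q r s → a * p - b * q - c * r - d * s ; I = λ a b c d p q r s → a * q + b * p + c * s - d * r
        J = λ a b c d p q r s → a * r + c * p + d * q - b * s ; K = λ a b c d p q r s → a * s + d * p + b * r - c * q in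
    J (R a b c d p q r s) (I a b c d p q r s) (J a b c d p q r s) (K a b c d p q r s) t u v w ≡
    J a b c d (R p q r s t u v w) (I p q r s t u v w) (J p q r s t u v w) (K p q r s t u v w)
  imag₂ = solve-∀
  imag₃ : ∀ a b c d p q r s t u v w →
    let R = λ a b c d p q r s → a * p - b * q - c * r - d * s ; I = λ a b c d p q r s → a * q + b * p + c * s - d * r
        J = λ a b c d p q r s → a * r + c * p + d * q - b * s ; K = λ a b c d p q r s → a * s + d * p + b * r - c * q in
    K (R a b c d p q r s) (I a b c d p q r s) (J a b c d p q r s) (K a b c d p q r s) t u v w ≡
    K a b c d (R p q r s t u v w) (I p q r s t u v w) (J p q r s t u v w) (K p q r s t u v w)
  imag₃ = solve-∀

·-distribˡ-⊖ : ∀ x y z → x · (y ⊖ z) ≡ x · y ⊖ x · z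
·-distribˡ-⊖ (quat a b c d) (quat p q r s) (quat t u v w) = quat-cong
  (real a b c d p q r s t u v w) (imag a b c d p q r s t u v w) (imag a c d b p r s q t v w u) (imag a d b c p s q r t w u v)
  where
  real : ∀ a b c d p q r s t u v w → a * (p - t) - b * (q - u) - c * (r - v) - d * (s - w) ≡
    a * p - b * q - c * r - d * s - (a * t - b * u - c * v - d * w)
  real = solve-∀
  imag : ∀ a b c d p q r s t u v w → a * (q - u) + b * (p - t) + c * (s - w) - d * (r - v) ≡
    a * q + b * p + c * s - d * r - (a * u + b * t + c * w - d * v)
  imag = solve-∀

·-⋆ : ∀ k x y → x · (k ⋆ y) ≡ k ⋆ (x · y)
·-⋆ k (quat a b c d) (quat p q r s) = quat-cong
  (real k a b c d p q r s) (imag k a b c d p q r s) (imag k a c d b p r s q) (imag k a d b c p s q r)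
  where
  real : ∀ k a b c d p q r s → a * (k * p) - b * (k * q) - c * (k * r) - d * (k * s) ≡ k * (a * p - b * q - c * r - d * s)
  real = solve-∀
  imag : ∀ k a b c d p q r s → a * (k * q) + b * (k * p) + c * (k * s) - d * (k * r) ≡ k * (a * q + b * p + c * s - d * r)
  imag = solve-∀

⋆-· : ∀ k x y → (k ⋆ x) · y ≡ k ⋆ (x · y)
⋆-· k (quat a b c d) (quat p q r s) = quat-cong
  (real k a b c d p q r s) (imag k a b c d p q r s) (imag k a c d b p r s q) (imag k a d b c p s q r)
  where
  real : ∀ k a b c d p q r s → k * a * p - k * b * q - k * c * r - k * d * s ≡ k * (a * p - b * q - c * r - d * s)
  real = solve-∀
  imag : ∀ k a b c d p q r s → k * a * q + k * b * p + k * c * s - k * d * r ≡ k * (a * q + b * p + c * s - d * r)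
  imag = solve-∀

⋆-⊖ : ∀ k x y → k ⋆ (x ⊖ y) ≡ k ⋆ x ⊖ k ⋆ y
⋆-⊖ k (quat a b c d) (quat p q r s) = quat-cong (distrib k a p) (distrib k b q) (distrib k c r) (distrib k d s)
  where
  distrib : ∀ k a p → k * (a - p) ≡ k * a - k * p
  distrib = solve-∀

⋆-⋆ : ∀ k l x → k ⋆ (l ⋆ x) ≡ (k * l) ⋆ x
⋆-⋆ k l (quat a b c d) = sym (quat-cong (ℤ.*-assoc k l a) (ℤ.*-assoc k l b) (ℤ.*-assoc k l c) (ℤ.*-assoc k l d))

⋆-cancelˡ : ∀ {k x y} → k ≢ + 0 → k ⋆ x ≡ k ⋆ y → x ≡ y
⋆-cancelˡ k≢0 p = quat-cong (*-cancelˡ k≢0 (cong ℍ.re p)) (*-cancelˡ k≢0 (cong ℍ.im₁ p))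
                            (*-cancelˡ k≢0 (cong ℍ.im₂ p)) (*-cancelˡ k≢0 (cong ℍ.im₃ p))

N-⋆ : ∀ k x → N (k ⋆ x) ≡ k * k * N x
N-⋆ k (quat a b c d) = identity k a b c d
  where
  identity : ∀ k a b c d → k * a * (k * a) + (k * b * (k * b) + (k * c * (k * c) + (k * d * (k * d) + + 0))) ≡
    k * k * (a * a + (b * b + (c * c + (d * d + + 0))))
  identity = solve-∀

N-conjugate : ∀ x → N (conjugate x) ≡ N x
N-conjugate (quat a b c d) = identity a b c d
  where
  identity : ∀ a b c d → a * a + (- b * - b + (- c * - c + (- d * - d + + 0))) ≡ a * a + (b * b + (c * c + (d * d + + 0)))
  identity = solve-∀

conjugate-·-· : ∀ x y → conjugate x · (x · y) ≡ N x ⋆ y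
conjugate-·-· (quat a b c d) (quat p q r s) = quat-cong
  (real a b c d p q r s) (imag₁ a b c d p q r s) (imag₂ a b c d p q r s) (imag₃ a b c d p q r s)
  where
  real : ∀ a b c d p q r s →
    a * (a * p - b * q - c * r - d * s) - - b * (a * q + b * p + c * s - d * r) - - c * (a * r + c * p + d * q - b * s) - - d * (a * s + d * p + b * r - c * q) ≡
    (a * a + (b * b + (c * c + (d * d + + 0)))) * p
  real = solve-∀
  imag₁ : ∀ a b c d p q r s →
    a * (a * q + b * p + c * s - d * r) + - b * (a * p - b * q - c * r - d * s) + - c * (a * s + d * p + b * r - c * q) - - d * (a * r + c * p + d * q - b * s) ≡
    (a * a + (b * b + (c * c + (d * d + + 0)))) * q
  imag₁ = solve-∀
  imag₂ : ∀ a b c d p q r s →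
    a * (a * r + c * p + d * q - b * s) + - c * (a * p - b * q - c * r - d * s) + - d * (a * q + b * p + c * s - d * r) - - b * (a * s + d * p + b * r - c * q) ≡
    (a * a + (b * b + (c * c + (d * d + + 0)))) * r
  imag₂ = solve-∀
  imag₃ : ∀ a b c d p q r s →
    a * (a * s + d * p + b * r - c * q) + - d * (a * p - b * q - c * r - d * s) + - b * (a * r + c * p + d * q - b * s) - - c * (a * q + b * p + c * s - d * r) ≡
    (a * a + (b * b + (c * c + (d * d + + 0)))) * s
  imag₃ = solve-∀

N-nonNeg : ∀ x → + 0 ℤ.≤ N x
N-nonNeg (quat a b c d) = ℤ.+-mono-≤ (square-nonNeg a) (ℤ.+-mono-≤ (square-nonNeg b)
  (ℤ.+-mono-≤ (square-nonNeg c) (ℤ.+-mono-≤ (square-nonNeg d) ℤ.≤-refl)))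

sum≡0⇒≡0 : ∀ {x y} → + 0 ℤ.≤ x → + 0 ℤ.≤ y → x + y ≡ + 0 → x ≡ + 0
sum≡0⇒≡0 {x} {y} 0≤x 0≤y p = ℤ.≤-antisym (subst₂ ℤ._≤_ (ℤ.+-identityʳ x) p (ℤ.+-monoʳ-≤ x 0≤y)) 0≤x

square≡0⇒≡0 : ∀ {x} → x * x ≡ + 0 → x ≡ + 0
square≡0⇒≡0 {x} p with ℤ.i*j≡0⇒i≡0∨j≡0 x {x} p
... | inj₁ q = q
... | inj₂ q = q

N≡0⇒≡0 : ∀ x y → N (x ⊖ y) ≡ + 0 → x ≡ y
N≡0⇒≡0 (quat a b c d) (quat p q r s) eq = quat-cong (equal a p (proj₁ e₁)) (equal b q (proj₁ e₂)) (equal c r (proj₁ e₃)) (equal d s (proj₁ e₄))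
  where
  equal : ∀ x y → (x - y) * (x - y) ≡ + 0 → x ≡ y
  equal x y p = ℤ.i-j≡0⇒i≡j x y (square≡0⇒≡0 p)
  split : ∀ {x y} → + 0 ℤ.≤ x → + 0 ℤ.≤ y → x + y ≡ + 0 → x ≡ + 0 × y ≡ + 0
  split {x} {y} 0≤x 0≤y p = sum≡0⇒≡0 0≤x 0≤y p , sum≡0⇒≡0 0≤y 0≤x (trans (ℤ.+-comm y x) p)
  sq = square-nonNeg
  e₁ = split (sq (a - p)) (ℤ.+-mono-≤ (sq (b - q)) (ℤ.+-mono-≤ (sq (c - r)) (ℤ.+-mono-≤ (sq (d - s)) ℤ.≤-refl))) eq
  e₂ = split (sq (b - q)) (ℤ.+-mono-≤ (sq (c - r)) (ℤ.+-mono-≤ (sq (d - s)) ℤ.≤-refl)) (proj₂ e₁)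
  e₃ = split (sq (c - r)) (ℤ.+-mono-≤ (sq (d - s)) ℤ.≤-refl) (proj₂ e₂)
  e₄ = split (sq (d - s)) ℤ.≤-refl (proj₂ e₃)

-- The residue of a + h lies between 0 and 2h, and shifting it back by h centres it. The bound is
-- put on the square of the remainder because it will be summed into a norm.
centredDivision : ∀ h a → ∃[ q ] ∃[ r ] a ≡ + suc (2 ℕ.* h) * q + r × r * r ℤ.≤ + h * + h
centredDivision h a = (a + + h) /ℕ m , + r₀ - + h , a≡ , bound
  where
  m = suc (2 ℕ.* h)
  r₀ = (a + + h) %ℕ m
  a≡ : a ≡ + m * ((a + + h) /ℕ m) + (+ r₀ - + h)
  a≡ = trans (shift a (+ h)) (trans (cong (_- + h) (a≡a%ℕn+[a/ℕn]*n (a + + h) m)) (rearr (+ r₀) ((a + + h) /ℕ m) (+ m) (+ h)))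
    where
    shift : ∀ a h → a ≡ a + h - h
    shift = solve-∀
    rearr : ∀ r q m h → r + q * m - h ≡ m * q + (r - h)
    rearr = solve-∀
  -- With k = 2h - r₀ one has h² - (r₀ - h)² = r₀k ≥ 0.
  k = 2 ℕ.* h ℕ.∸ r₀
  2h≡ : + 2 * + h ≡ + r₀ + + k
  2h≡ = trans (sym (ℤ.pos-* 2 h)) (cong +_ (sym (ℕ.m+[n∸m]≡n (ℕ.≤-pred (n%ℕd<d (a + + h) m)))))
  bound : (+ r₀ - + h) * (+ r₀ - + h) ℤ.≤ + h * + h
  bound = subst ((+ r₀ - + h) * (+ r₀ - + h) ℤ.≤_)
    (trans (cong (λ t → (+ r₀ - + h) * (+ r₀ - + h) + t) (ℤ.pos-* r₀ k)) (trans (expand (+ r₀) (+ h) (+ k)) (trans (cong (λ t → + r₀ * (+ r₀ + + k - t) + + h * + h) 2h≡) (collapse (+ r₀) (+ h) (+ k)))))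
    (ℤ.i≤i+j ((+ r₀ - + h) * (+ r₀ - + h)) (+ (r₀ ℕ.* k)))
    where
    expand : ∀ r h k → (r - h) * (r - h) + r * k ≡ r * (r + k - + 2 * h) + h * h
    expand = solve-∀
    collapse : ∀ r h k → r * (r + k - (r + k)) + h * h ≡ h * h
    collapse = solve-∀

-- Lipschitz quaternions admit division with remainder by quaternions of odd norm m:
-- divide β̄α by m with coordinates of absolute value at most (m − 1)/2.
division : ∀ h α β → N β ≡ + suc (2 ℕ.* h) → ∃[ q ] N (α ⊖ β · q) ℤ.< N β
division h α β Nβ with conjugate β · α in t≡
... | quat t₀ t₁ t₂ t₃ = q , subst (N ρ ℤ.<_) (sym Nβ) (ℤ.*-cancelˡ-<-nonNeg {N ρ} {+ m} (+ m) (subst (ℤ._< + m * + m) Nr≡ Nr<))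
  where
  m = suc (2 ℕ.* h)
  d₀ = centredDivision h t₀
  d₁ = centredDivision h t₁
  d₂ = centredDivision h t₂
  d₃ = centredDivision h t₃
  q = quat (proj₁ d₀) (proj₁ d₁) (proj₁ d₂) (proj₁ d₃)
  r₀ = proj₁ (proj₂ d₀)
  r₁ = proj₁ (proj₂ d₁)
  r₂ = proj₁ (proj₂ d₂)
  r₃ = proj₁ (proj₂ d₃)
  ρ = α ⊖ β · q
  remainder : ∀ {t q r} → t ≡ + m * q + r → t - + m * q ≡ r
  remainder {_} {q} {r} refl = cancel (+ m * q) r
    where
    cancel : ∀ x r → x + r - x ≡ r
    cancel = solve-∀
  r≡ : conjugate β · ρ ≡ quat r₀ r₁ r₂ r₃
  r≡ = begin
    conjugate β · (α ⊖ β · q)                      ≡⟨ ·-distribˡ-⊖ (conjugate β) α (β · q) ⟩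
    conjugate β · α ⊖ conjugate β · (β · q)        ≡⟨ cong₂ _⊖_ t≡ (conjugate-·-· β q) ⟩
    quat t₀ t₁ t₂ t₃ ⊖ N β ⋆ q                     ≡⟨ cong (λ n → quat t₀ t₁ t₂ t₃ ⊖ n ⋆ q) Nβ ⟩
    quat t₀ t₁ t₂ t₃ ⊖ (+ m) ⋆ q                   ≡⟨ quat-cong (remainder (proj₁ (proj₂ (proj₂ d₀)))) (remainder (proj₁ (proj₂ (proj₂ d₁))))
                                                                (remainder (proj₁ (proj₂ (proj₂ d₂)))) (remainder (proj₁ (proj₂ (proj₂ d₃)))) ⟩
    quat r₀ r₁ r₂ r₃                               ∎
  Nr≡ : N (quat r₀ r₁ r₂ r₃) ≡ + m * N ρ
  Nr≡ = begin
    N (quat r₀ r₁ r₂ r₃)       ≡⟨ cong N (sym r≡) ⟩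
    N (conjugate β · ρ)        ≡⟨ N-· (conjugate β) ρ ⟩
    N (conjugate β) * N ρ      ≡⟨ cong (_* N ρ) (trans (N-conjugate β) Nβ) ⟩
    + m * N ρ                  ∎
  bound = λ {t} (d : ∃[ q ] ∃[ r ] t ≡ + m * q + r × r * r ℤ.≤ + h * + h) → proj₂ (proj₂ (proj₂ d))
  -- Oddness gives strictness here: four squares of at most h² sum to at most 4h², which falls short
  -- of m² = (2h + 1)² by 4h + 1.
  m²≡ : + 4 * (+ h * + h) + + suc (4 ℕ.* h) ≡ + m * + m
  m²≡ = trans (cong (λ t → + 4 * (+ h * + h) + (+ 1 + t)) (ℤ.pos-* 4 h)) (trans (identity (+ h)) (cong (λ t → (+ 1 + t) * (+ 1 + t)) (sym (ℤ.pos-* 2 h))))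
    where
    identity : ∀ h → + 4 * (h * h) + (+ 1 + + 4 * h) ≡ (+ 1 + + 2 * h) * (+ 1 + + 2 * h)
    identity = solve-∀
  4h²≡ : ∀ h → h * h + (h * h + (h * h + (h * h + + 0))) ≡ + 4 * (h * h)
  4h²≡ = solve-∀
  Nr< : N (quat r₀ r₁ r₂ r₃) ℤ.< + m * + m
  Nr< = ℤ.≤-<-trans
    (ℤ.+-mono-≤ (bound d₀) (ℤ.+-mono-≤ (bound d₁) (ℤ.+-mono-≤ (bound d₂) (ℤ.+-mono-≤ (bound d₃) ℤ.≤-refl))))
    (subst₂ ℤ._<_ (trans (ℤ.+-identityʳ (+ 4 * (+ h * + h))) (sym (4h²≡ (+ h)))) m²≡ (ℤ.+-monoʳ-< (+ 4 * (+ h * + h)) (ℤ.+<+ (ℕ.s≤s ℕ.z≤n))))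

2*≢1 : ∀ x → + 2 * x ≢ + 1
2*≢1 x p with 4*⇒%4≡0 x 2 (trans (quad x) (cong (+ 2 *_) p))
  where
  quad : ∀ x → + 4 * x ≡ + 2 * (+ 2 * x)
  quad = solve-∀
... | ()

-- Since p² + q² is even, so is r² + s².
N-even⇒pairing : ∀ p q r s k M → p ≡ q + + 2 * k → N (quat p q r s) ≡ + 2 * M → ∃[ l ] r ≡ s + + 2 * l
N-even⇒pairing _ q r s k M refl even with parity (r - s)
... | l , inj₁ r-s = l , trans (shift r s) (cong (λ t → s + t) r-s)
  where
  shift : ∀ r s → r ≡ s + (r - s)
  shift = solve-∀
... | l , inj₂ r-s = ⊥-elim (2*≢1 (M - c) (trans (distrib M c) (trans (cong (_- + 2 * c) (sym even))
    (trans (cong (λ t → N (quat (q + + 2 * k) q t s) - + 2 * c) r≡) (identity q k s l)))))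
  where
  -- If r and s had different parity, the norm would be 2c + 1.
  c = q * q + + 2 * q * k + + 2 * k * k + s * s + s + + 2 * s * l + + 2 * l * l + + 2 * l
  r≡ : r ≡ s + (+ 1 + + 2 * l)
  r≡ = trans (shift r s) (cong (λ t → s + t) r-s)
    where
    shift : ∀ r s → r ≡ s + (r - s)
    shift = solve-∀
  distrib : ∀ M c → + 2 * (M - c) ≡ + 2 * M - + 2 * c
  distrib = solve-∀
  identity : ∀ q k s l →
    (q + + 2 * k) * (q + + 2 * k) + (q * q + ((s + (+ 1 + + 2 * l)) * (s + (+ 1 + + 2 * l)) + (s * s + + 0))) -
    + 2 * (q * q + + 2 * q * k + + 2 * k * k + s * s + s + + 2 * s * l + + 2 * l * l + + 2 * l) ≡ + 1
  identity = solve-∀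

-- h is one of 1+i, 1+j, 1+k.
halving : ∀ z M → N z ≡ + 2 * M → ∃[ h ] ∃[ z′ ] z · h ≡ (+ 2) ⋆ z′ × N z′ ≡ M
halving (quat p q r s) M even with parity (p - q) | parity (p - r)
... | k , inj₁ p-q | _ = quat (+ 1) (+ 1) (+ 0) (+ 0) , quat k (q + k) (s + l) (- l) ,
    trans (cong₂ (λ p r → quat p q r s · quat (+ 1) (+ 1) (+ 0) (+ 0)) p≡ r≡) (quat-cong (c₁ q k s l) (c₂ q k s l) (c₃ q k s l) (c₄ q k s l)) ,
    *-cancelˡ {+ 2} (λ ()) (trans (norm q k s l) (trans (sym (cong₂ (λ p r → N (quat p q r s)) p≡ r≡)) even))
  where
  shift : ∀ p q → p ≡ q + (p - q)
  shift = solve-∀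
  p≡ : p ≡ q + + 2 * k
  p≡ = trans (shift p q) (cong (λ t → q + t) p-q)
  pair = N-even⇒pairing p q r s k M p≡ even
  l = proj₁ pair
  r≡ = proj₂ pair
  c₁ : ∀ q k s l → (q + + 2 * k) * + 1 - q * + 1 - (s + + 2 * l) * + 0 - s * + 0 ≡ + 2 * k
  c₁ = solve-∀
  c₂ : ∀ q k s l → (q + + 2 * k) * + 1 + q * + 1 + (s + + 2 * l) * + 0 - s * + 0 ≡ + 2 * (q + k)
  c₂ = solve-∀
  c₃ : ∀ q k s l → (q + + 2 * k) * + 0 + (s + + 2 * l) * + 1 + s * + 1 - q * + 0 ≡ + 2 * (s + l)
  c₃ = solve-∀
  c₄ : ∀ q k s l → (q + + 2 * k) * + 0 + s * + 1 + q * + 0 - (s + + 2 * l) * + 1 ≡ + 2 * - l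
  c₄ = solve-∀
  norm : ∀ q k s l → + 2 * (k * k + ((q + k) * (q + k) + ((s + l) * (s + l) + (- l * - l + + 0)))) ≡
    (q + + 2 * k) * (q + + 2 * k) + (q * q + ((s + + 2 * l) * (s + + 2 * l) + (s * s + + 0)))
  norm = solve-∀
... | _ , inj₂ _ | k , inj₁ p-r = quat (+ 1) (+ 0) (+ 1) (+ 0) , quat k l (r + k) (s + l) ,
    trans (cong₂ (λ p q → quat p q r s · quat (+ 1) (+ 0) (+ 1) (+ 0)) p≡ q≡) (quat-cong (c₁ r k s l) (c₂ r k s l) (c₃ r k s l) (c₄ r k s l)) ,
    *-cancelˡ {+ 2} (λ ()) (trans (norm r k s l) (trans (sym (cong₂ (λ p q → N (quat p q r s)) p≡ q≡)) even))
  where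
  shift : ∀ p q → p ≡ q + (p - q)
  shift = solve-∀
  p≡ : p ≡ r + + 2 * k
  p≡ = trans (shift p r) (cong (λ t → r + t) p-r)
  swap : ∀ p q r s → p * p + (r * r + (q * q + (s * s + + 0))) ≡ p * p + (q * q + (r * r + (s * s + + 0)))
  swap = solve-∀
  pair = N-even⇒pairing p r q s k M p≡ (trans (swap p q r s) even)
  l = proj₁ pair
  q≡ = proj₂ pair
  c₁ : ∀ r k s l → (r + + 2 * k) * + 1 - (s + + 2 * l) * + 0 - r * + 1 - s * + 0 ≡ + 2 * k
  c₁ = solve-∀
  c₂ : ∀ r k s l → (r + + 2 * k) * + 0 + (s + + 2 * l) * + 1 + r * + 0 - s * + 1 ≡ + 2 * l
  c₂ = solve-∀
  c₃ : ∀ r k s l → (r + + 2 * k) * + 1 + r * + 1 + s * + 0 - (s + + 2 * l) * + 0 ≡ + 2 * (r + k)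
  c₃ = solve-∀
  c₄ : ∀ r k s l → (r + + 2 * k) * + 0 + s * + 1 + (s + + 2 * l) * + 1 - r * + 0 ≡ + 2 * (s + l)
  c₄ = solve-∀
  norm : ∀ r k s l → + 2 * (k * k + (l * l + ((r + k) * (r + k) + ((s + l) * (s + l) + + 0)))) ≡
    (r + + 2 * k) * (r + + 2 * k) + ((s + + 2 * l) * (s + + 2 * l) + (r * r + (s * s + + 0)))
  norm = solve-∀
-- Here p differs in parity from both q and r, so q ≡ r, and the even norm gives p ≡ s; this pairing
-- calls for 1 + k.
... | i , inj₂ p-q | j , inj₂ p-r = quat (+ 1) (+ 0) (+ 0) (+ 1) , quat l (r + m) (- m) (s + l) ,
    trans (cong₂ (λ p q → quat p q r s · quat (+ 1) (+ 0) (+ 0) (+ 1)) p≡ q≡) (quat-cong (c₁ r m s l) (c₂ r m s l) (c₃ r m s l) (c₄ r m s l)) ,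
    *-cancelˡ {+ 2} (λ ()) (trans (norm r m s l) (trans (sym (cong₂ (λ p q → N (quat p q r s)) p≡ q≡)) even))
  where
  m = j - i
  q≡ : q ≡ r + + 2 * m
  q≡ = trans (shift p q r) (trans (cong₂ (λ s t → r + (t - s)) p-q p-r) (cancel r i j))
    where
    shift : ∀ p q r → q ≡ r + ((p - r) - (p - q))
    shift = solve-∀
    cancel : ∀ r i j → r + ((+ 1 + + 2 * j) - (+ 1 + + 2 * i)) ≡ r + + 2 * (j - i)
    cancel = solve-∀
  swap : ∀ p q r s → q * q + (r * r + (p * p + (s * s + + 0))) ≡ p * p + (q * q + (r * r + (s * s + + 0)))
  swap = solve-∀
  pair = N-even⇒pairing q r p s m M q≡ (trans (swap p q r s) even)
  l = proj₁ pair
  p≡ = proj₂ pair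
  c₁ : ∀ r m s l → (s + + 2 * l) * + 1 - (r + + 2 * m) * + 0 - r * + 0 - s * + 1 ≡ + 2 * l
  c₁ = solve-∀
  c₂ : ∀ r m s l → (s + + 2 * l) * + 0 + (r + + 2 * m) * + 1 + r * + 1 - s * + 0 ≡ + 2 * (r + m)
  c₂ = solve-∀
  c₃ : ∀ r m s l → (s + + 2 * l) * + 0 + r * + 1 + s * + 0 - (r + + 2 * m) * + 1 ≡ + 2 * - m
  c₃ = solve-∀
  c₄ : ∀ r m s l → (s + + 2 * l) * + 1 + s * + 1 + (r + + 2 * m) * + 0 - r * + 0 ≡ + 2 * (s + l)
  c₄ = solve-∀
  norm : ∀ r m s l → + 2 * (l * l + ((r + m) * (r + m) + (- m * - m + ((s + l) * (s + l) + + 0)))) ≡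
    (s + + 2 * l) * (s + + 2 * l) + ((r + + 2 * m) * (r + + 2 * m) + (r * r + (s * s + + 0)))
  norm = solve-∀

-- Descent in the ideal of quaternions z with e z divisible by a₁

∣-∣-mono-< : ∀ {x y} → + 0 ℤ.≤ x → x ℤ.< y → ∣ x ∣ ℕ.< ∣ y ∣
∣-∣-mono-< {x} {y} 0≤x x<y = ℤ.drop‿+<+ (subst₂ ℤ._<_ (sym (ℤ.0≤i⇒+∣i∣≡i 0≤x)) (sym (ℤ.0≤i⇒+∣i∣≡i (ℤ.≤-trans 0≤x (ℤ.<⇒≤ x<y)))) x<y)

∣-∣-half-< : ∀ M → M ≢ + 0 → ∣ M ∣ ℕ.< ∣ + 2 * M ∣
∣-∣-half-< M M≢0 = subst (∣ M ∣ ℕ.<_) (trans (cong (∣ M ∣ ℕ.+_) (sym (ℕ.+-identityʳ ∣ M ∣))) (sym (ℤ.abs-* (+ 2) M)))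
  (ℕ.m<m+n ∣ M ∣ (ℕ.n≢0⇒n>0 (λ p → M≢0 (ℤ.∣i∣≡0⇒i≡0 p))))

odd-nonNeg : ∀ x K → + 0 ℤ.≤ x → x ≡ + 1 + + 2 * K → ∃[ h ] x ≡ + suc (2 ℕ.* h)
odd-nonNeg x (+ h) 0≤x p = h , trans p (cong (λ t → + 1 + t) (sym (ℤ.pos-* 2 h)))
odd-nonNeg x K@(-[1+ k ]) 0≤x p with ℤ.≤-trans (subst (+ 0 ℤ.≤_) p 0≤x) (ℤ.+-monoʳ-≤ (+ 1) (ℤ.*-monoˡ-≤-nonNeg (+ 2) (ℤ.-≤- (ℕ.z≤n {k}))))
... | ()

*≡1⇒unit : ∀ i j → i * j ≡ + 1 → Unit i
*≡1⇒unit i j p = unit i (ℕ.m*n≡1⇒m≡1 ∣ i ∣ ∣ j ∣ (trans (sym (ℤ.abs-* i j)) (cong ∣_∣ p)))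
  where
  unit : ∀ i → ∣ i ∣ ≡ 1 → Unit i
  unit (+ 1) refl = inj₁ refl
  unit -[1+ 0 ] refl = inj₂ refl

-- A right ideal, since e multiplies from the left. Remainders of the shape w - z q therefore stay
-- in it, which fixes the side on which `division` and `halving` multiply.
InIdeal : ℍ → ℤ → ℍ → Set
InIdeal e a z = ∃[ y ] e · z ≡ a ⋆ y

InIdeal-· : ∀ e a z q → InIdeal e a z → InIdeal e a (z · q)
InIdeal-· e a z q (y , p) = y · q , trans (sym (·-assoc e z q)) (trans (cong (_· q) p) (⋆-· a y q))

InIdeal-⊖ : ∀ e a z w → InIdeal e a z → InIdeal e a w → InIdeal e a (z ⊖ w)
InIdeal-⊖ e a z w (y , p) (y′ , p′) = y ⊖ y′ , trans (·-distribˡ-⊖ e z w) (trans (cong₂ _⊖_ p p′) (sym (⋆-⊖ a y y′)))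

-- 2 is invertible modulo the odd number a: e z = a (e z) - κ (2 e z), and both terms are divisible
-- by a.
InIdeal-half : ∀ e a z κ → a ≡ + 1 + + 2 * κ → InIdeal e a ((+ 2) ⋆ z) → InIdeal e a z
InIdeal-half e a z κ a≡ (y , p) = (e · z) ⊖ κ ⋆ y , sym (begin
  a ⋆ ((e · z) ⊖ κ ⋆ y)                               ≡⟨ ⋆-⊖ a (e · z) (κ ⋆ y) ⟩
  a ⋆ (e · z) ⊖ a ⋆ (κ ⋆ y)                           ≡⟨ cong (a ⋆ (e · z) ⊖_) (⋆-comm a κ y) ⟩
  a ⋆ (e · z) ⊖ κ ⋆ (a ⋆ y)                           ≡⟨ cong (λ t → a ⋆ (e · z) ⊖ κ ⋆ t) (trans (sym p) (·-⋆ (+ 2) e z)) ⟩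
  a ⋆ (e · z) ⊖ κ ⋆ ((+ 2) ⋆ (e · z))                 ≡⟨ cong (λ t → t ⋆ (e · z) ⊖ κ ⋆ ((+ 2) ⋆ (e · z))) a≡ ⟩
  (+ 1 + + 2 * κ) ⋆ (e · z) ⊖ κ ⋆ ((+ 2) ⋆ (e · z))   ≡⟨ collapse κ (e · z) ⟩
  e · z                                               ∎)
  where
  ⋆-comm : ∀ k l x → k ⋆ (l ⋆ x) ≡ l ⋆ (k ⋆ x)
  ⋆-comm k l x = trans (⋆-⋆ k l x) (trans (cong (_⋆ x) (ℤ.*-comm k l)) (sym (⋆-⋆ l k x)))
  collapse : ∀ κ x → (+ 1 + + 2 * κ) ⋆ x ⊖ κ ⋆ ((+ 2) ⋆ x) ≡ x
  collapse κ (quat a b c d) = quat-cong (identity κ a) (identity κ b) (identity κ c) (identity κ d)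
    where
    identity : ∀ κ a → (+ 1 + + 2 * κ) * a - κ * (+ 2 * a) ≡ a
    identity = solve-∀

-- A common left divisor z of a₁ and e inside the ideal: N z divides a₁² and a₁a₂, and a₁ divides N z.
generator-norm : ∀ e a₁ a₂ z q₁ q₂ → N e ≡ a₁ * a₂ → + 0 ℤ.< a₁ → Bezout a₁ a₂ → InIdeal e a₁ z →
  a₁ ⋆ 1ℍ ≡ z · q₁ → e ≡ z · q₂ → N z ≡ a₁
generator-norm e a₁ a₂ z q₁ q₂ Ne a₁>0 (s , t , st) (y , p) div₁ div₂ = conclude (*≡1⇒unit k (s * N q₁ + t * N q₂) k-inverse)
  where
  a₁≢0 : a₁ ≢ + 0
  a₁≢0 q = ℤ.<⇒≢ a₁>0 (sym q)
  a₂Nz : a₂ * N z ≡ a₁ * N y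
  a₂Nz = *-cancelˡ a₁≢0 (begin
    a₁ * (a₂ * N z)     ≡⟨ sym (ℤ.*-assoc a₁ a₂ (N z)) ⟩
    a₁ * a₂ * N z       ≡⟨ cong (_* N z) (sym Ne) ⟩
    N e * N z           ≡⟨ sym (N-· e z) ⟩
    N (e · z)           ≡⟨ cong N p ⟩
    N (a₁ ⋆ y)          ≡⟨ N-⋆ a₁ y ⟩
    a₁ * a₁ * N y       ≡⟨ ℤ.*-assoc a₁ a₁ (N y) ⟩
    a₁ * (a₁ * N y)     ∎)
  -- Obtained from N z = (s a₁ + t a₂) N z by replacing a₂ N z with a₁ N y.
  k = s * N z + t * N y
  Nz≡ : N z ≡ a₁ * k
  Nz≡ = begin
    N z                                   ≡⟨ sym (ℤ.*-identityˡ (N z)) ⟩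
    + 1 * N z                             ≡⟨ cong (_* N z) (sym st) ⟩
    (s * a₁ + t * a₂) * N z               ≡⟨ split s a₁ t a₂ (N z) ⟩
    s * a₁ * N z + t * (a₂ * N z)         ≡⟨ cong (λ x → s * a₁ * N z + t * x) a₂Nz ⟩
    s * a₁ * N z + t * (a₁ * N y)         ≡⟨ collect s a₁ (N z) t (N y) ⟩
    a₁ * (s * N z + t * N y)              ∎
    where
    split : ∀ s a t b n → (s * a + t * b) * n ≡ s * a * n + t * (b * n)
    split = solve-∀
    collect : ∀ s a n t m → s * a * n + t * (a * m) ≡ a * (s * n + t * m)
    collect = solve-∀
  k-q₁ : k * N q₁ ≡ a₁
  k-q₁ = *-cancelˡ a₁≢0 (begin
    a₁ * (k * N q₁)     ≡⟨ sym (ℤ.*-assoc a₁ k (N q₁)) ⟩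
    a₁ * k * N q₁       ≡⟨ cong (_* N q₁) (sym Nz≡) ⟩
    N z * N q₁          ≡⟨ sym (N-· z q₁) ⟩
    N (z · q₁)          ≡⟨ cong N (sym div₁) ⟩
    N (a₁ ⋆ 1ℍ)         ≡⟨ N-⋆ a₁ 1ℍ ⟩
    a₁ * a₁ * + 1       ≡⟨ ℤ.*-identityʳ (a₁ * a₁) ⟩
    a₁ * a₁             ∎)
  k-q₂ : k * N q₂ ≡ a₂
  k-q₂ = *-cancelˡ a₁≢0 (begin
    a₁ * (k * N q₂)     ≡⟨ sym (ℤ.*-assoc a₁ k (N q₂)) ⟩
    a₁ * k * N q₂       ≡⟨ cong (_* N q₂) (sym Nz≡) ⟩
    N z * N q₂          ≡⟨ sym (N-· z q₂) ⟩
    N (z · q₂)          ≡⟨ cong N (sym div₂) ⟩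
    N e                 ≡⟨ Ne ⟩
    a₁ * a₂             ∎)
  k-inverse : k * (s * N q₁ + t * N q₂) ≡ + 1
  k-inverse = begin
    k * (s * N q₁ + t * N q₂)             ≡⟨ distrib k s (N q₁) t (N q₂) ⟩
    s * (k * N q₁) + t * (k * N q₂)       ≡⟨ cong₂ (λ x y → s * x + t * y) k-q₁ k-q₂ ⟩
    s * a₁ + t * a₂                       ≡⟨ st ⟩
    + 1                                   ∎
    where
    distrib : ∀ k s m t n → k * (s * m + t * n) ≡ s * (k * m) + t * (k * n)
    distrib = solve-∀
  conclude : Unit k → N z ≡ a₁
  conclude (inj₁ k≡1) = trans Nz≡ (trans (cong (a₁ *_) k≡1) (ℤ.*-identityʳ a₁))
  conclude (inj₂ k≡-1) = ⊥-elim (ℤ.<⇒≱ (ℤ.neg-mono-< a₁>0) (subst (+ 0 ℤ.≤_) (trans Nz≡ (trans (cong (a₁ *_) k≡-1) (negate a₁))) (N-nonNeg z)))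
    where
    negate : ∀ a → a * - (+ 1) ≡ - a
    negate = solve-∀

module Euclid (e : ℍ) (a₁ a₂ κ : ℤ) (Ne : N e ≡ a₁ * a₂) (e² : ∀ z → e · (e · z) ≡ (- (a₁ * a₂)) ⋆ z)
  (a₁>0 : + 0 ℤ.< a₁) (odd : a₁ ≡ + 1 + + 2 * κ) (coprime : Bezout a₁ a₂) where

  a₁-inIdeal : InIdeal e a₁ (a₁ ⋆ 1ℍ)
  a₁-inIdeal = e · 1ℍ , ·-⋆ a₁ e 1ℍ

  e-inIdeal : InIdeal e a₁ e
  e-inIdeal = (- a₂) ⋆ 1ℍ , (begin
    e · e                     ≡⟨ cong (e ·_) (sym (·-identityʳ e)) ⟩
    e · (e · 1ℍ)              ≡⟨ e² 1ℍ ⟩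
    (- (a₁ * a₂)) ⋆ 1ℍ        ≡⟨ cong (_⋆ 1ℍ) (ℤ.neg-distribʳ-* a₁ a₂) ⟩
    (a₁ * - a₂) ⋆ 1ℍ          ≡⟨ sym (⋆-⋆ a₁ (- a₂) 1ℍ) ⟩
    a₁ ⋆ ((- a₂) ⋆ 1ℍ)        ∎)
    where
    ·-identityʳ : ∀ x → x · 1ℍ ≡ x
    ·-identityʳ (quat a b c d) = quat-cong (real a b c d) (imag a b c d) (imag a c d b) (imag a d b c)
      where
      real : ∀ a b c d → a * + 1 - b * + 0 - c * + 0 - d * + 0 ≡ a
      real = solve-∀
      imag : ∀ a b c d → a * + 0 + b * + 1 + c * + 0 - d * + 0 ≡ b
      imag = solve-∀

  Generator : Set
  Generator = ∃[ x ] N x ≡ a₁ × InIdeal e a₁ x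

  -- Descent on the norm. An even norm is halved. An odd norm permits division of both a₁ and e by
  -- z: a nonzero remainder is a smaller element of the ideal, and two zero remainders make z a
  -- common left divisor, which is what `generator-norm` requires.
  search : ∀ z → InIdeal e a₁ z → N z ≢ + 0 → Acc ℕ._<_ ∣ N z ∣ → Generator
  search z z∈ Nz≢0 (acc rec) = byParity (parity (N z))
    where
    halve : ∀ M → N z ≡ + 2 * M → (∃[ h ] ∃[ z′ ] z · h ≡ (+ 2) ⋆ z′ × N z′ ≡ M) → Generator
    halve M even (h , z′ , zh≡ , Nz′≡) = search z′ (InIdeal-half e a₁ z′ κ odd (subst (InIdeal e a₁) zh≡ (InIdeal-· e a₁ z h z∈)))
      (λ p → M≢0 (trans (sym Nz′≡) p))
      (rec (subst₂ ℕ._<_ (cong ∣_∣ (sym Nz′≡)) (cong ∣_∣ (sym even)) (∣-∣-half-< M M≢0)))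
      where
      M≢0 : M ≢ + 0
      M≢0 M≡0 = Nz≢0 (trans even (cong (+ 2 *_) M≡0))
    reduce : ∀ w → InIdeal e a₁ w → N w ≢ + 0 → N w ℤ.< N z → Generator
    reduce w w∈ Nw≢0 lt = search w w∈ Nw≢0 (rec (∣-∣-mono-< (N-nonNeg w) lt))
    divide : (∃[ q ] N (a₁ ⋆ 1ℍ ⊖ z · q) ℤ.< N z) → (∃[ q ] N (e ⊖ z · q) ℤ.< N z) → Generator
    divide (q₁ , lt₁) (q₂ , lt₂) = decide (N (a₁ ⋆ 1ℍ ⊖ z · q₁) ℤ.≟ + 0) (N (e ⊖ z · q₂) ℤ.≟ + 0)
      where
      decide : Dec (N (a₁ ⋆ 1ℍ ⊖ z · q₁) ≡ + 0) → Dec (N (e ⊖ z · q₂) ≡ + 0) → Generator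
      decide (no r≢0) _ = reduce (a₁ ⋆ 1ℍ ⊖ z · q₁) (InIdeal-⊖ e a₁ (a₁ ⋆ 1ℍ) (z · q₁) a₁-inIdeal (InIdeal-· e a₁ z q₁ z∈)) r≢0 lt₁
      decide (yes _) (no r≢0) = reduce (e ⊖ z · q₂) (InIdeal-⊖ e a₁ e (z · q₂) e-inIdeal (InIdeal-· e a₁ z q₂ z∈)) r≢0 lt₂
      decide (yes r₁≡0) (yes r₂≡0) = z ,
        generator-norm e a₁ a₂ z q₁ q₂ Ne a₁>0 coprime z∈ (N≡0⇒≡0 (a₁ ⋆ 1ℍ) (z · q₁) r₁≡0) (N≡0⇒≡0 e (z · q₂) r₂≡0) , z∈
    byParity : ∃[ k ] (N z ≡ + 2 * k ⊎ N z ≡ + 1 + + 2 * k) → Generator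
    byParity (M , inj₁ even) = halve M even (halving z M even)
    byParity (K , inj₂ p) = fromOdd (odd-nonNeg (N z) K (N-nonNeg z) p)
      where
      fromOdd : ∃[ h ] N z ≡ + suc (2 ℕ.* h) → Generator
      fromOdd (h , Nz≡) = divide (division h (a₁ ⋆ 1ℍ) z Nz≡) (division h e z Nz≡)

  generator : Generator
  generator = search (a₁ ⋆ 1ℍ) a₁-inIdeal Na₁≢0 (<-wellFounded ∣ N (a₁ ⋆ 1ℍ) ∣)
    where
    a₁≢0 : a₁ ≢ + 0
    a₁≢0 q = ℤ.<⇒≢ a₁>0 (sym q)
    Na₁≢0 : N (a₁ ⋆ 1ℍ) ≢ + 0
    Na₁≢0 p = *-≢0 a₁≢0 a₁≢0 (trans (sym (ℤ.*-identityʳ (a₁ * a₁))) (trans (sym (N-⋆ a₁ 1ℍ)) p))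

-- Orthogonal planes in ℤ⁴

dot-self-zero : ∀ {k} (w : Vecℤ k) → dot w w ≡ + 0 → ∀ i → w i ≡ + 0
dot-self-zero {suc k} w p zero = square≡0⇒≡0 (sum≡0⇒≡0 (square-nonNeg (w 0F)) (dot-self-nonNeg (λ i → w (suc i))) p)
dot-self-zero {suc k} w p (suc i) = dot-self-zero (λ i → w (suc i))
  (sum≡0⇒≡0 (dot-self-nonNeg (λ i → w (suc i))) (square-nonNeg (w 0F)) (trans (ℤ.+-comm (dot (λ i → w (suc i)) (λ i → w (suc i))) (w 0F * w 0F)) p)) i

-- Otherwise Φ(y₀, –) would carry x₀, x₁, w and y₁ to vectors of ℤ³ spanning a space of dimension four.
complement-trivial : ∀ (x y : Fin 2 → Vecℤ 4) → (∀ i j → dot (x i) (y j) ≡ + 0) →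
  gramDet (x 0F) (x 1F) ≢ + 0 → gramDet (y 0F) (y 1F) ≢ + 0 → dot (x 0F) (x 0F) ≢ + 0 → dot (y 0F) (y 0F) ≢ + 0 →
  ∀ w → (∀ i → dot w (x i) ≡ + 0) → (∀ i → dot w (y i) ≡ + 0) → ∀ i → w i ≡ + 0
complement-trivial x y x⊥y Δx≢0 Δy≢0 a≢0 Y≢0 w w⊥x w⊥y = dot-self-zero w
  -- On the complement of y₀ the map Φ(y₀, -) multiplies dot products by Y, and v₃ is orthogonal to
  -- v₁ and v₂. The coplanarity relation for v₁, v₂, v₃ then reads 16 Y⁴ a (ac - b²) ⟨w, w⟩ = 0.
  (*≡0⇒≡0 (*-≢0 (*-≢0 (*-≢0 {+ 16} (λ ()) Y⁴≢0) a≢0) Δx≢0) (begin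
    + 16 * (Y * Y * (Y * Y)) * a * (a * c - b * b) * dot w w       ≡⟨ expand Y a b c (dot w w) ⟩
    (+ 2 * (Y * b) * (+ 2 * (Y * b)) - + 2 * (Y * a) * (+ 2 * (Y * c))) * (+ 2 * + 0 * (+ 2 * + 0) - + 2 * (Y * a) * (+ 2 * (Y * dot w w)))
      ≡⟨ sym (cong₅ (λ p q r s t → (+ 2 * p * (+ 2 * p) - + 2 * q * (+ 2 * r)) * (+ 2 * s * (+ 2 * s) - + 2 * q * (+ 2 * t))) d₁₂ d₁₁ d₂₂ d₁₃ d₃₃) ⟩
    _ ≡⟨ sym (dot-coplanar v₁ v₂ v₃ W W≢0 (v⊥W (x 0F) (x⊥y 0F 0F) (x⊥y 0F 1F)) (v⊥W (x 1F) (x⊥y 1F 0F) (x⊥y 1F 1F)) (v⊥W w (w⊥y 0F) (w⊥y 1F))) ⟩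
    _ ≡⟨ cong₂ (λ p q → (+ 2 * dot v₁ v₂ * (+ 2 * p) - + 2 * dot v₁ v₁ * (+ 2 * q)) * (+ 2 * dot v₁ v₂ * (+ 2 * p) - + 2 * dot v₁ v₁ * (+ 2 * q))) d₁₃ d₂₃ ⟩
    (+ 2 * dot v₁ v₂ * (+ 2 * + 0) - + 2 * dot v₁ v₁ * (+ 2 * + 0)) * (+ 2 * dot v₁ v₂ * (+ 2 * + 0) - + 2 * dot v₁ v₁ * (+ 2 * + 0))
      ≡⟨ zeros (dot v₁ v₂) (dot v₁ v₁) ⟩
    + 0 ∎))
  where
  a = dot (x 0F) (x 0F) ; b = dot (x 0F) (x 1F) ; c = dot (x 1F) (x 1F) ; Y = dot (y 0F) (y 0F)
  Y⁴≢0 = *-≢0 (*-≢0 Y≢0 Y≢0) (*-≢0 Y≢0 Y≢0)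
  v₁ = Φ (y 0F) (x 0F) ; v₂ = Φ (y 0F) (x 1F) ; v₃ = Φ (y 0F) w ; W = Φ (y 0F) (y 1F)
  W≢0 : dot W W ≢ + 0
  W≢0 p = Δy≢0 (trans (sym (Φ-dot (y 0F) (y 1F) (y 1F))) p)
  Φ-dot-⊥ : ∀ u v → dot u (y 0F) ≡ + 0 → dot (Φ (y 0F) u) (Φ (y 0F) v) ≡ Y * dot u v
  Φ-dot-⊥ u v p = trans (Φ-dot (y 0F) u v) (trans (cong (λ t → Y * dot u v - t * dot (y 0F) v) (trans (dot-comm (y 0F) u) p)) (drop (Y * dot u v) (dot (y 0F) v)))
    where
    drop : ∀ x y → x - + 0 * y ≡ x
    drop = solve-∀
  zero-product : ∀ {u v} → dot u (y 0F) ≡ + 0 → dot u v ≡ + 0 → dot (Φ (y 0F) u) (Φ (y 0F) v) ≡ + 0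
  zero-product {u} {v} p q = trans (Φ-dot-⊥ u v p) (trans (cong (Y *_) q) (ℤ.*-zeroʳ Y))
  v⊥W : ∀ u → dot u (y 0F) ≡ + 0 → dot u (y 1F) ≡ + 0 → dot (Φ (y 0F) u) W ≡ + 0
  v⊥W u = zero-product {u} {y 1F}
  d₁₁ : dot v₁ v₁ ≡ Y * a
  d₁₁ = Φ-dot-⊥ (x 0F) (x 0F) (x⊥y 0F 0F)
  d₁₂ : dot v₁ v₂ ≡ Y * b
  d₁₂ = Φ-dot-⊥ (x 0F) (x 1F) (x⊥y 0F 0F)
  d₂₂ : dot v₂ v₂ ≡ Y * c
  d₂₂ = Φ-dot-⊥ (x 1F) (x 1F) (x⊥y 1F 0F)
  d₃₃ : dot v₃ v₃ ≡ Y * dot w w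
  d₃₃ = Φ-dot-⊥ w w (w⊥y 0F)
  d₁₃ : dot v₁ v₃ ≡ + 0
  d₁₃ = zero-product {x 0F} {w} (x⊥y 0F 0F) (trans (dot-comm (x 0F) w) (w⊥x 0F))
  d₂₃ : dot v₂ v₃ ≡ + 0
  d₂₃ = zero-product {x 1F} {w} (x⊥y 1F 0F) (trans (dot-comm (x 1F) w) (w⊥x 1F))
  expand : ∀ Y a b c w → + 16 * (Y * Y * (Y * Y)) * a * (a * c - b * b) * w ≡
    (+ 2 * (Y * b) * (+ 2 * (Y * b)) - + 2 * (Y * a) * (+ 2 * (Y * c))) * (+ 2 * + 0 * (+ 2 * + 0) - + 2 * (Y * a) * (+ 2 * (Y * w)))
  expand = solve-∀
  zeros : ∀ p q → (+ 2 * p * (+ 2 * + 0) - + 2 * q * (+ 2 * + 0)) * (+ 2 * p * (+ 2 * + 0) - + 2 * q * (+ 2 * + 0)) ≡ + 0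
  zeros = solve-∀

-- For w orthogonal to the x-plane, n w minus its Cramer combination of the y's is orthogonal to
-- both planes, hence zero by `complement-trivial`. Squarefreeness then removes the factor n from
-- the coordinates.
perp-basis : ∀ {n} → SquareFree n → ∀ (x y : Fin 2 → Vecℤ 4) → (∀ i j → dot (x i) (y j) ≡ + 0) →
  gramDet (x 0F) (x 1F) ≡ + n → gramDet (y 0F) (y 1F) ≡ + n → IsBasis (Perp (x 0F) (x 1F)) (y 0F) (y 1F)
perp-basis {n} sf x y x⊥y Δx Δy =
  (y⊥x 0F 0F , y⊥x 0F 1F) , (y⊥x 1F 0F , y⊥x 1F 1F) , gramDet-independent (y 0F) (y 1F) (λ p → n≢0 (trans (sym Δy) p)) ,
  λ w (w⊥x₀ , w⊥x₁) → squareFree-span sf (y 0F) (y 1F) w Δy (coordinates w w⊥x₀ w⊥x₁)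
  where
  n≢0 = squareFree⇒≢0 sf
  y⊥x : ∀ i j → dot (y i) (x j) ≡ + 0
  y⊥x i j = trans (dot-comm (y i) (x j)) (x⊥y j i)
  nonZero : ∀ (u v : Vecℤ 4) → gramDet u v ≡ + n → dot u u ≢ + 0
  nonZero u v Δ = det⇒≢0 sf (dot u v) (det⇒product (dot u u) (dot u v) (dot v v) Δ)
  coordinates : ∀ w → dot w (x 0F) ≡ + 0 → dot w (x 1F) ≡ + 0 →
    ∀ i → + n * w i ≡ cramer₁ (y 0F) (y 1F) w * y 0F i + cramer₂ (y 0F) (y 1F) w * y 1F i
  coordinates w w⊥x₀ w⊥x₁ i = ℤ.i-j≡0⇒i≡j (+ n * w i) (p i) (trans (difference (+ n * w i) (p i))
    (complement-trivial x y x⊥y (λ q → n≢0 (trans (sym Δx) q)) (λ q → n≢0 (trans (sym Δy) q))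
      (nonZero (x 0F) (x 1F) Δx) (nonZero (y 0F) (y 1F) Δy) r r⊥x r⊥y i))
    where
    a = dot (y 0F) (y 0F) ; b = dot (y 0F) (y 1F) ; c = dot (y 1F) (y 1F) ; s = dot w (y 0F) ; t = dot w (y 1F)
    α = cramer₁ (y 0F) (y 1F) w
    β = cramer₂ (y 0F) (y 1F) w
    nw p r : Vecℤ 4
    nw i = + n * w i
    p = comb α (y 0F) β (y 1F)
    r = comb (+ 1) nw (- (+ 1)) p
    difference : ∀ x y → x - y ≡ + 1 * x + - (+ 1) * y
    difference = solve-∀
    r-dot : ∀ z → dot r z ≡ + 1 * (+ n * dot w z) + - (+ 1) * (α * dot (y 0F) z + β * dot (y 1F) z)
    r-dot z = trans (dot-linearˡ (+ 1) (- (+ 1)) nw p z) (cong₂ (λ u v → + 1 * u + - (+ 1) * v) (dot-scaleˡ (+ n) w z) (dot-linearˡ α β (y 0F) (y 1F) z))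
    r⊥x′ : ∀ j → dot w (x j) ≡ + 0 → dot r (x j) ≡ + 0
    r⊥x′ j w⊥ = trans (r-dot (x j)) (trans (cong₃ (λ u v z → + 1 * (+ n * u) + - (+ 1) * (α * v + β * z)) w⊥ (y⊥x 0F j) (y⊥x 1F j)) (zeros (+ n) α β))
      where
      zeros : ∀ n α β → + 1 * (n * + 0) + - (+ 1) * (α * + 0 + β * + 0) ≡ + 0
      zeros = solve-∀
    r⊥x : ∀ j → dot r (x j) ≡ + 0
    r⊥x 0F = r⊥x′ 0F w⊥x₀
    r⊥x 1F = r⊥x′ 1F w⊥x₁
    cramer-0F : ∀ a b c s t → + 1 * ((a * c - b * b) * s) + - (+ 1) * ((s * c - t * b) * a + (t * a - s * b) * b) ≡ + 0
    cramer-0F = solve-∀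
    cramer-1F : ∀ a b c s t → + 1 * ((a * c - b * b) * t) + - (+ 1) * ((s * c - t * b) * b + (t * a - s * b) * c) ≡ + 0
    cramer-1F = solve-∀
    r⊥y : ∀ j → dot r (y j) ≡ + 0
    r⊥y 0F = trans (r-dot (y 0F)) (trans (cong₂ (λ m u → + 1 * (m * s) + - (+ 1) * (α * a + β * u)) (sym Δy) (dot-comm (y 1F) (y 0F))) (cramer-0F a b c s t))
    r⊥y 1F = trans (r-dot (y 1F)) (trans (cong (λ m → + 1 * (m * t) + - (+ 1) * (α * b + β * c)) (sym Δy)) (cramer-1F a b c s t))

-- Orthogonal planes from two pure quaternions

pure : Vecℤ 3 → ℍ
pure u = quat (+ 0) (u 0F) (u 1F) (u 2F)

coords : ℍ → Vecℤ 4
coords x 0F = ℍ.re x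
coords x 1F = ℍ.im₁ x
coords x 2F = ℍ.im₂ x
coords x 3F = ℍ.im₃ x

⟪⟫-sym : ∀ x y → ⟪ x , y ⟫ ≡ ⟪ y , x ⟫
⟪⟫-sym x y = dot-comm (coords x) (coords y)

⟪⟫-⋆ˡ : ∀ k x y → ⟪ k ⋆ x , y ⟫ ≡ k * ⟪ x , y ⟫
⟪⟫-⋆ˡ k (quat a b c d) (quat p q r s) = identity k a b c d p q r s
  where
  identity : ∀ k a b c d p q r s → k * a * p + (k * b * q + (k * c * r + (k * d * s + + 0))) ≡
    k * (a * p + (b * q + (c * r + (d * s + + 0))))
  identity = solve-∀

⟪⟫-⋆ʳ : ∀ k x y → ⟪ x , k ⋆ y ⟫ ≡ k * ⟪ x , y ⟫
⟪⟫-⋆ʳ k x y = trans (⟪⟫-sym x (k ⋆ y)) (trans (⟪⟫-⋆ˡ k y x) (cong (k *_) (⟪⟫-sym y x)))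

N-pure : ∀ u → N (pure u) ≡ dot u u
N-pure u = identity (u 0F) (u 1F) (u 2F)
  where
  identity : ∀ b c d → + 0 * + 0 + (b * b + (c * c + (d * d + + 0))) ≡ b * b + (c * c + (d * d + + 0))
  identity = solve-∀

pure-square : ∀ u z → pure u · (pure u · z) ≡ (- dot u u) ⋆ z
pure-square u (quat p q r s) = quat-cong (real (u 0F) (u 1F) (u 2F) p q r s) (imag₁ (u 0F) (u 1F) (u 2F) p q r s)
  (imag₂ (u 0F) (u 1F) (u 2F) p q r s) (imag₃ (u 0F) (u 1F) (u 2F) p q r s)
  where
  real : ∀ b c d p q r s →
    let R = λ b c d p q r s → + 0 * p - b * q - c * r - d * s ; I = λ b c d p q r s → + 0 * q + b * p + c * s - d * r
        J = λ b c d p q r s → + 0 * r + c * p + d * q - b * s ; K = λ b c d p q r s → + 0 * s + d * p + b * r - c * q in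
    R b c d (R b c d p q r s) (I b c d p q r s) (J b c d p q r s) (K b c d p q r s) ≡ - (b * b + (c * c + (d * d + + 0))) * p
  real = solve-∀
  imag₁ : ∀ b c d p q r s →
    let R = λ b c d p q r s → + 0 * p - b * q - c * r - d * s ; I = λ b c d p q r s → + 0 * q + b * p + c * s - d * r
        J = λ b c d p q r s → + 0 * r + c * p + d * q - b * s ; K = λ b c d p q r s → + 0 * s + d * p + b * r - c * q in
    I b c d (R b c d p q r s) (I b c d p q r s) (J b c d p q r s) (K b c d p q r s) ≡ - (b * b + (c * c + (d * d + + 0))) * q
  imag₁ = solve-∀
  imag₂ : ∀ b c d p q r s →
    let R = λ b c d p q r s → + 0 * p - b * q - c * r - d * s ; I = λ b c d p q r s → + 0 * q + b * p + c * s - d * r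
        J = λ b c d p q r s → + 0 * r + c * p + d * q - b * s ; K = λ b c d p q r s → + 0 * s + d * p + b * r - c * q in
    J b c d (R b c d p q r s) (I b c d p q r s) (J b c d p q r s) (K b c d p q r s) ≡ - (b * b + (c * c + (d * d + + 0))) * r
  imag₂ = solve-∀
  imag₃ : ∀ b c d p q r s →
    let R = λ b c d p q r s → + 0 * p - b * q - c * r - d * s ; I = λ b c d p q r s → + 0 * q + b * p + c * s - d * r
        J = λ b c d p q r s → + 0 * r + c * p + d * q - b * s ; K = λ b c d p q r s → + 0 * s + d * p + b * r - c * q in
    K b c d (R b c d p q r s) (I b c d p q r s) (J b c d p q r s) (K b c d p q r s) ≡ - (b * b + (c * c + (d * d + + 0))) * s
  imag₃ = solve-∀

-- Left multiplication by a pure quaternion is skew-symmetric.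
pure-⊥ : ∀ u y → ⟪ pure u · y , y ⟫ ≡ + 0
pure-⊥ u (quat p q r s) = identity (u 0F) (u 1F) (u 2F) p q r s
  where
  identity : ∀ b c d p q r s →
    let R = λ b c d p q r s → + 0 * p - b * q - c * r - d * s ; I = λ b c d p q r s → + 0 * q + b * p + c * s - d * r
        J = λ b c d p q r s → + 0 * r + c * p + d * q - b * s ; K = λ b c d p q r s → + 0 * s + d * p + b * r - c * q in
    R b c d p q r s * p + (I b c d p q r s * q + (J b c d p q r s * r + (K b c d p q r s * s + + 0))) ≡ + 0
  identity = solve-∀

⟪⟫-·ˡ : ∀ u x y → ⟪ pure u · x , pure u · y ⟫ ≡ dot u u * ⟪ x , y ⟫
⟪⟫-·ˡ u (quat p q r s) (quat t v w z) = identity (u 0F) (u 1F) (u 2F) p q r s t v w z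
  where
  identity : ∀ b c d p q r s t v w z →
    let R = λ b c d p q r s → + 0 * p - b * q - c * r - d * s ; I = λ b c d p q r s → + 0 * q + b * p + c * s - d * r
        J = λ b c d p q r s → + 0 * r + c * p + d * q - b * s ; K = λ b c d p q r s → + 0 * s + d * p + b * r - c * q in
    R b c d p q r s * R b c d t v w z + (I b c d p q r s * I b c d t v w z + (J b c d p q r s * J b c d t v w z + (K b c d p q r s * K b c d t v w z + + 0))) ≡
    (b * b + (c * c + (d * d + + 0))) * (p * t + (q * v + (r * w + (s * z + + 0))))
  identity = solve-∀

⟪⟫-·ʳ : ∀ u v y → ⟪ pure u · y , pure v · y ⟫ ≡ dot u v * N y
⟪⟫-·ʳ u v (quat p q r s) = identity (u 0F) (u 1F) (u 2F) (v 0F) (v 1F) (v 2F) p q r s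
  where
  identity : ∀ b c d b′ c′ d′ p q r s →
    let R = λ b c d p q r s → + 0 * p - b * q - c * r - d * s ; I = λ b c d p q r s → + 0 * q + b * p + c * s - d * r
        J = λ b c d p q r s → + 0 * r + c * p + d * q - b * s ; K = λ b c d p q r s → + 0 * s + d * p + b * r - c * q in
    R b c d p q r s * R b′ c′ d′ p q r s + (I b c d p q r s * I b′ c′ d′ p q r s + (J b c d p q r s * J b′ c′ d′ p q r s + (K b c d p q r s * K b′ c′ d′ p q r s + + 0))) ≡
    (b * b′ + (c * c′ + (d * d′ + + 0))) * (p * p + (q * q + (r * r + (s * s + + 0))))
  identity = solve-∀

record OrthogonalPlanes (q₁ q₂ : BQF) : Set where
  field
    x y : Fin 2 → Vecℤ 4
    orthogonal : ∀ i j → dot (x i) (y j) ≡ + 0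
    form-x : FormOf (x 0F) (x 1F) ≡ q₁
    form-y : FormOf (y 0F) (y 1F) ≡ q₂

-- With x the generator of the ideal {z : e z ≡ 0 mod a₁} and e x = a₁ y (so e y = −a₂ x), the planes are ⟨x, −f y⟩ and ⟨y, f x⟩.
orthogonalPlanes : ∀ e f a₁ a₂ B C κ → dot e e ≡ a₁ * a₂ → dot e f ≡ B → dot f f ≡ C →
  + 0 ℤ.< a₁ → a₁ ≡ + 1 + + 2 * κ → a₂ ≢ + 0 → Bezout a₁ a₂ →
  OrthogonalPlanes (bqf a₁ (+ 2 * B) (a₂ * C)) (bqf a₂ (+ 2 * B) (a₁ * C))
orthogonalPlanes e f a₁ a₂ B C κ ee ef ff a₁>0 odd a₂≢0 coprime = fromGenerator
  (Euclid.generator (pure e) a₁ a₂ κ (trans (N-pure e) ee) (λ z → trans (pure-square e z) (cong (λ t → (- t) ⋆ z) ee)) a₁>0 odd coprime)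
  where
  a₁≢0 : a₁ ≢ + 0
  a₁≢0 q = ℤ.<⇒≢ a₁>0 (sym q)
  fromGenerator : (∃[ x ] N x ≡ a₁ × InIdeal (pure e) a₁ x) → OrthogonalPlanes (bqf a₁ (+ 2 * B) (a₂ * C)) (bqf a₂ (+ 2 * B) (a₁ * C))
  fromGenerator (x , Nx , y , ex) = record
    { x = X ; y = Y ; orthogonal = ⊥
    ; form-x = bqf-cong Nx (cong (+ 2 *_) ⟪x,-fy⟫) (trans (⟪⟫-⋆ˡ (- (+ 1)) (f′ · y) (-1⋆ (f′ · y))) (trans (cong (- (+ 1) *_) (⟪⟫-⋆ʳ (- (+ 1)) (f′ · y) (f′ · y)))
        (trans (cong (λ t → - (+ 1) * (- (+ 1) * t)) (trans (⟪⟫-·ˡ f y y) (cong₂ _*_ ff Ny))) (signs C a₂))))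
    ; form-y = bqf-cong Ny (cong (+ 2 *_) ⟪y,fx⟫) (trans (⟪⟫-·ˡ f x x) (trans (cong₂ _*_ ff Nx) (ℤ.*-comm C a₁))) }
    where
    e′ = pure e
    f′ = pure f
    -1⋆ : ℍ → ℍ
    -1⋆ z = (- (+ 1)) ⋆ z
    X Y : Fin 2 → Vecℤ 4
    X 0F = coords x
    -- The sign compensates that of e y = -a₂ x, so that both planes receive the same middle
    -- coefficient 2B.
    X 1F = coords (-1⋆ (f′ · y))
    Y 0F = coords y
    Y 1F = coords (f′ · x)
    signs : ∀ C a → - (+ 1) * (- (+ 1) * (C * a)) ≡ a * C
    signs = solve-∀
    Ny : N y ≡ a₂
    Ny = *-cancelˡ (*-≢0 a₁≢0 a₁≢0) (begin
      a₁ * a₁ * N y       ≡⟨ sym (N-⋆ a₁ y) ⟩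
      N (a₁ ⋆ y)          ≡⟨ cong N (sym ex) ⟩
      N (e′ · x)          ≡⟨ ⟪⟫-·ˡ e x x ⟩
      dot e e * N x       ≡⟨ cong₂ _*_ ee Nx ⟩
      a₁ * a₂ * a₁        ≡⟨ rearr a₁ a₂ ⟩
      a₁ * a₁ * a₂        ∎)
      where
      rearr : ∀ a b → a * b * a ≡ a * a * b
      rearr = solve-∀
    ey : e′ · y ≡ (- a₂) ⋆ x
    ey = ⋆-cancelˡ a₁≢0 (begin
      a₁ ⋆ (e′ · y)         ≡⟨ sym (·-⋆ a₁ e′ y) ⟩
      e′ · (a₁ ⋆ y)         ≡⟨ cong (e′ ·_) (sym ex) ⟩
      e′ · (e′ · x)         ≡⟨ pure-square e x ⟩
      (- dot e e) ⋆ x       ≡⟨ cong (λ t → (- t) ⋆ x) ee ⟩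
      (- (a₁ * a₂)) ⋆ x     ≡⟨ cong (_⋆ x) (ℤ.neg-distribʳ-* a₁ a₂) ⟩
      (a₁ * - a₂) ⋆ x       ≡⟨ sym (⋆-⋆ a₁ (- a₂) x) ⟩
      a₁ ⋆ ((- a₂) ⋆ x)     ∎)
    x⊥y : ⟪ x , y ⟫ ≡ + 0
    x⊥y = *≡0⇒≡0 a₁≢0 (begin
      a₁ * ⟪ x , y ⟫        ≡⟨ sym (⟪⟫-⋆ʳ a₁ x y) ⟩
      ⟪ x , a₁ ⋆ y ⟫        ≡⟨ cong (λ t → ⟪ x , t ⟫) (sym ex) ⟩
      ⟪ x , e′ · x ⟫        ≡⟨ ⟪⟫-sym x (e′ · x) ⟩
      ⟪ e′ · x , x ⟫        ≡⟨ pure-⊥ e x ⟩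
      + 0                   ∎)
    ⟪y,fx⟫ : ⟪ y , f′ · x ⟫ ≡ B
    ⟪y,fx⟫ = *-cancelˡ a₁≢0 (begin
      a₁ * ⟪ y , f′ · x ⟫      ≡⟨ sym (⟪⟫-⋆ˡ a₁ y (f′ · x)) ⟩
      ⟪ a₁ ⋆ y , f′ · x ⟫      ≡⟨ cong (λ t → ⟪ t , f′ · x ⟫) (sym ex) ⟩
      ⟪ e′ · x , f′ · x ⟫      ≡⟨ ⟪⟫-·ʳ e f x ⟩
      dot e f * N x            ≡⟨ cong₂ _*_ ef Nx ⟩
      B * a₁                   ≡⟨ ℤ.*-comm B a₁ ⟩
      a₁ * B                   ∎)
    ⟪x,-fy⟫ : ⟪ x , -1⋆ (f′ · y) ⟫ ≡ B
    ⟪x,-fy⟫ = *-cancelˡ a₂≢0 (begin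
      a₂ * ⟪ x , -1⋆ (f′ · y) ⟫          ≡⟨ cong (a₂ *_) (⟪⟫-⋆ʳ (- (+ 1)) x (f′ · y)) ⟩
      a₂ * (- (+ 1) * ⟪ x , f′ · y ⟫)    ≡⟨ rearr a₂ ⟪ x , f′ · y ⟫ ⟩
      - a₂ * ⟪ x , f′ · y ⟫              ≡⟨ sym (⟪⟫-⋆ˡ (- a₂) x (f′ · y)) ⟩
      ⟪ (- a₂) ⋆ x , f′ · y ⟫            ≡⟨ cong (λ t → ⟪ t , f′ · y ⟫) (sym ey) ⟩
      ⟪ e′ · y , f′ · y ⟫                ≡⟨ ⟪⟫-·ʳ e f y ⟩
      dot e f * N y                      ≡⟨ cong₂ _*_ ef Ny ⟩
      B * a₂                             ≡⟨ ℤ.*-comm B a₂ ⟩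
      a₂ * B                             ∎)
      where
      rearr : ∀ a t → a * (- (+ 1) * t) ≡ - a * t
      rearr = solve-∀
    vanish : ∀ z w → ⟪ z , w ⟫ ≡ + 0 → ⟪ -1⋆ z , w ⟫ ≡ + 0
    vanish z w p = trans (⟪⟫-⋆ˡ (- (+ 1)) z w) (cong (- (+ 1) *_) p)
    ⊥ : ∀ i j → dot (X i) (Y j) ≡ + 0
    ⊥ 0F 0F = x⊥y
    ⊥ 0F 1F = trans (⟪⟫-sym x (f′ · x)) (pure-⊥ f x)
    ⊥ 1F 0F = vanish (f′ · y) y (pure-⊥ f y)
    ⊥ 1F 1F = vanish (f′ · y) (f′ · x) (trans (⟪⟫-·ˡ f y x) (trans (cong (dot f f *_) (trans (⟪⟫-sym y x) x⊥y)) (ℤ.*-zeroʳ (dot f f))))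

-- Concordant forms

prime-bezout : ∀ {p} → Prime p → ∀ a → Bezout a (+ p) ⊎ (∃[ k ] a ≡ + p * k)
prime-bezout {p} pr a = decide (prime⇒irreducible pr (ℕ.divides ∣ b′ ∣ (trans (cong ∣_∣ b-eq) (trans (ℤ.abs-* g b′) (ℕ.*-comm ∣ g ∣ ∣ b′ ∣)))))
  where
  open CommonFactor (commonFactor a (+ p))
  s = proj₁ coprime
  t = proj₁ (proj₂ coprime)
  st = proj₂ (proj₂ coprime)
  decide : ∣ g ∣ ≡ 1 ⊎ ∣ g ∣ ≡ p → Bezout a (+ p) ⊎ (∃[ k ] a ≡ + p * k)
  decide (inj₁ ∣g∣≡1) = inj₁ (s * g , t * g , (begin
    s * g * a + t * g * + p                   ≡⟨ cong₂ (λ x y → s * g * x + t * g * y) a-eq b-eq ⟩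
    s * g * (g * a′) + t * g * (g * b′)       ≡⟨ rearr s t g a′ b′ ⟩
    g * g * (s * a′ + t * b′)                 ≡⟨ cong₂ _*_ (trans (square-∣∣ g) (cong (λ x → + (x ℕ.* x)) ∣g∣≡1)) st ⟩
    + 1                                       ∎))
    where
    rearr : ∀ s t g a b → s * g * (g * a) + t * g * (g * b) ≡ g * g * (s * a + t * b)
    rearr = solve-∀
  decide (inj₂ ∣g∣≡p) = inj₂ (signed (ℤ.+∣i∣≡i⊎+∣i∣≡-i g))
    where
    signed : + ∣ g ∣ ≡ g ⊎ + ∣ g ∣ ≡ - g → ∃[ k ] a ≡ + p * k
    signed (inj₁ q) = a′ , trans a-eq (cong (_* a′) (trans (sym q) (cong +_ ∣g∣≡p)))
    signed (inj₂ q) = - a′ , trans a-eq (trans (negate g a′) (cong (_* - a′) (trans (sym q) (cong +_ ∣g∣≡p))))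
      where
      negate : ∀ g a → g * a ≡ - g * - a
      negate = solve-∀

CoprimeValue : BQF → ℤ → Set
CoprimeValue q m = ∃[ x ] ∃[ y ] Bezout (evalF q x y) m

-- Modulo m the value depends only on the arguments modulo m; `k` is the difference of the two
-- values divided by m.
coprimeValue-shift : ∀ q m x y α β → Bezout (evalF q x y) m → Bezout (evalF q (x + m * α) (y + m * β)) m
coprimeValue-shift (bqf a b c) m x y α β (s , t , p) = s , t - s * k , trans (identity a b c m x y α β s t) p
  where
  k = a * (+ 2 * x * α + m * α * α) + b * (x * β + y * α + m * α * β) + c * (+ 2 * y * β + m * β * β)
  identity : ∀ a b c m x y α β s t →
    s * (a * ((x + m * α) * (x + m * α)) + b * ((x + m * α) * (y + m * β)) + c * ((y + m * β) * (y + m * β))) +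
    (t - s * (a * (+ 2 * x * α + m * α * α) + b * (x * β + y * α + m * α * β) + c * (+ 2 * y * β + m * β * β))) * m ≡
    s * (a * (x * x) + b * (x * y) + c * (y * y)) + t * m
  identity = solve-∀

-- If p divided all of a, c and a + 2b + c, then `content-unit` would give p² = 1.
coprimeValue-prime : ∀ {n} → SquareFree n → n % 4 ≡ 1 → ∀ a b c → a * c - b * b ≡ + n →
  ∀ {p} → Prime p → CoprimeValue (bqf a (+ 2 * b) c) (+ p)
coprimeValue-prime {n} sf n≡1 a b c Δ {p} pr = decide (prime-bezout pr a) (prime-bezout pr c) (prime-bezout pr (a + + 2 * b + c))
  where
  Divisible : ℤ → Set
  Divisible v = Bezout v (+ p) ⊎ (∃[ k ] v ≡ + p * k)
  value₁ : ∀ a b c → a ≡ a * (+ 1 * + 1) + + 2 * b * (+ 1 * + 0) + c * (+ 0 * + 0)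
  value₁ = solve-∀
  value₂ : ∀ a b c → c ≡ a * (+ 0 * + 0) + + 2 * b * (+ 0 * + 1) + c * (+ 1 * + 1)
  value₂ = solve-∀
  value₃ : ∀ a b c → a + + 2 * b + c ≡ a * (+ 1 * + 1) + + 2 * b * (+ 1 * + 1) + c * (+ 1 * + 1)
  value₃ = solve-∀
  p≢1 : p ≢ 1
  p≢1 p≡1 = ¬prime[1] (subst Prime p≡1 pr)
  decide : Divisible a → Divisible c → Divisible (a + + 2 * b + c) → CoprimeValue (bqf a (+ 2 * b) c) (+ p)
  decide (inj₁ B) _ _ = + 1 , + 0 , subst (λ v → Bezout v (+ p)) (value₁ a b c) B
  decide (inj₂ _) (inj₁ B) _ = + 0 , + 1 , subst (λ v → Bezout v (+ p)) (value₂ a b c) B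
  decide (inj₂ _) (inj₂ _) (inj₁ B) = + 1 , + 1 , subst (λ v → Bezout v (+ p)) (value₃ a b c) B
  decide (inj₂ (α , a≡)) (inj₂ (γ , c≡)) (inj₂ (ε , e≡)) = ⊥-elim (p≢1 (ℕ.m*n≡1⇒m≡1 p p (ℤ.+-injective (trans (ℤ.pos-* p p)
    (content-unit sf n≡1 (+ p) α γ ε b (trans (cong₂ (λ x y → x * y - b * b) (sym a≡) (sym c≡)) Δ)
      (trans (cong₂ (λ x y → x + + 2 * b + y) (sym a≡) (sym c≡)) e≡))))))

-- If p divides m a value coprime to m will do; otherwise combine by the Chinese remainder theorem.
coprimeValue-* : ∀ q {p} m → Prime p → CoprimeValue q (+ p) → CoprimeValue q m → CoprimeValue q (+ p * m)
coprimeValue-* q {p} m pr (x′ , y′ , B′) (x , y , B) = decide (prime-bezout pr m)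
  where
  combine : ∀ {v} → Bezout v (+ p) → Bezout v m → Bezout v (+ p * m)
  combine {v} B₁ B₂ = bezout-sym {+ p * m} {v} (bezout-* {+ p} {m} {v} (bezout-sym {v} {+ p} B₁) (bezout-sym {v} {m} B₂))
  decide : Bezout m (+ p) ⊎ (∃[ k ] m ≡ + p * k) → CoprimeValue q (+ p * m)
  decide (inj₂ (k , m≡)) = x , y , combine (restrict B) B
    where
    restrict : Bezout (evalF q x y) m → Bezout (evalF q x y) (+ p)
    restrict (s , t , e) = s , t * k , trans (cong (λ r → s * evalF q x y + r) (trans (rearr t k (+ p)) (cong (t *_) (sym m≡)))) e
      where
      rearr : ∀ t k p → t * k * p ≡ t * (p * k)
      rearr = solve-∀
  decide (inj₁ (s , t , e)) = X , Y , combine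
    (subst₂ (λ u v → Bezout (evalF q u v) (+ p)) (sym (toPrime x x′)) (sym (toPrime y y′)) (coprimeValue-shift q (+ p) x′ y′ (t * (x - x′)) (t * (y - y′)) B′))
    (coprimeValue-shift q m x y (s * (x′ - x)) (s * (y′ - y)) B)
    where
    X = x + m * (s * (x′ - x))
    Y = y + m * (s * (y′ - y))
    toPrime : ∀ x x′ → x + m * (s * (x′ - x)) ≡ x′ + + p * (t * (x - x′))
    toPrime x x′ = trans (expand x x′ s m t (+ p)) (trans (cong (λ r → x′ + + p * (t * (x - x′)) + (+ 1 - r) * (x - x′)) e) (drop x′ (+ p * (t * (x - x′))) (x - x′)))
      where
      expand : ∀ x x′ s m t p → x + m * (s * (x′ - x)) ≡ x′ + p * (t * (x - x′)) + (+ 1 - (s * m + t * p)) * (x - x′)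
      expand = solve-∀
      drop : ∀ a b c → a + b + (+ 1 - + 1) * c ≡ a + b
      drop = solve-∀

coprimeValue : ∀ {n} → SquareFree n → n % 4 ≡ 1 → ∀ a b c → a * c - b * b ≡ + n →
  ∀ m → .{{ℕ.NonZero m}} → CoprimeValue (bqf a (+ 2 * b) c) (+ m)
coprimeValue sf n≡1 a b c Δ m =
  subst (λ k → CoprimeValue q (+ k)) (sym isFactorisation) (forProduct (PrimeFactorisation.factors (factorise m)) factorsPrime)
  where
  open PrimeFactorisation (factorise m) using (isFactorisation; factorsPrime)
  q = bqf a (+ 2 * b) c
  forProduct : ∀ ps → All Prime ps → CoprimeValue q (+ product ps)
  -- Modulo 1 even the value 0 at (0,0) is coprime. `primitiveValue` later replaces this argument by
  -- the coprime cofactors (1,0).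
  forProduct [] [] = + 0 , + 0 , + 0 , + 1 , refl
  forProduct (p ∷ ps) (pr ∷ prs) = subst (CoprimeValue q) (sym (ℤ.pos-* p (product ps)))
    (coprimeValue-* q (+ product ps) pr (coprimeValue-prime sf n≡1 a b c Δ pr) (forProduct ps prs))

-- The discriminant is divisible by 4, hence so is the square of the middle coefficient.
disc-even : ∀ q n → disc q ≡ - (+ 4 * n) → ∃[ b ] q ≡ bqf (BQF.a q) (+ 2 * b) (BQF.c q)
disc-even (bqf a b c) n D = decide (parity b)
  where
  decide : ∃[ k ] (b ≡ + 2 * k ⊎ b ≡ + 1 + + 2 * k) → ∃[ b′ ] bqf a b c ≡ bqf a (+ 2 * b′) c
  decide (k , inj₁ p) = k , cong (λ t → bqf a t c) p
  decide (k , inj₂ p) = ⊥-elim (absurd (4*⇒%4≡0 (a * c - n - k - k * k) 1 (trans (rearr a c n k)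
    (trans (cong (λ t → t + + 1 + + 4 * (a * c) - (+ 1 + + 2 * k) * (+ 1 + + 2 * k)) (sym D)) (trans (cong (λ t → t * t - + 4 * (a * c) + + 1 + + 4 * (a * c) - (+ 1 + + 2 * k) * (+ 1 + + 2 * k)) p) (cancel (a * c) k))))))
    where
    absurd : ¬ (1 ≡ 0)
    absurd ()
    rearr : ∀ a c n k → + 4 * (a * c - n - k - k * k) ≡ - (+ 4 * n) + + 1 + + 4 * (a * c) - (+ 1 + + 2 * k) * (+ 1 + + 2 * k)
    rearr = solve-∀
    cancel : ∀ x k → (+ 1 + + 2 * k) * (+ 1 + + 2 * k) - + 4 * x + + 1 + + 4 * x - (+ 1 + + 2 * k) * (+ 1 + + 2 * k) ≡ + 1
    cancel = solve-∀

record Represents (q : BQF) (n v : ℤ) : Set where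
  field
    b c : ℤ
    det : v * c - b * b ≡ n
    equiv : Equiv (bqf v (+ 2 * b) c) q

-- The Bezout coefficients complete the column (x, y) by (-t, s) to a matrix of determinant 1; the
-- transformed form has q(x, y) as its leading coefficient.
represents-primitive : ∀ q n x y → disc q ≡ - (+ 4 * n) → Bezout x y → Represents q n (evalF q x y)
represents-primitive q n x y D (s , t , st) = fromEven (disc-even f n Df)
  where
  f = act q x (- t) y s
  unit : x * s - - t * y ≡ + 1
  unit = trans (rearr x s t y) st
    where
    rearr : ∀ x s t y → x * s - - t * y ≡ s * x + t * y
    rearr = solve-∀
  Df : disc f ≡ - (+ 4 * n)
  Df = trans (disc-act q x (- t) y s) (trans (cong₂ (λ d u → d * (u * u)) D unit) (ℤ.*-identityʳ (- (+ 4 * n))))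
  fromEven : (∃[ b ] f ≡ bqf (BQF.a f) (+ 2 * b) (BQF.c f)) → Represents q n (evalF q x y)
  fromEven (b , f≡) = record
    { b = b ; c = BQF.c f
    ; det = disc⇒det (BQF.a f) b (BQF.c f) n (trans (cong disc (sym f≡)) Df)
    ; equiv = subst (λ g → Equiv g q) f≡ (equiv-sym q f (act-equiv q x (- t) y s (inj₁ unit))) }

-- Translating the first variable by a multiple of the second keeps the leading coefficient v, so b
-- is adjustable modulo v.
represents-shift : ∀ q n v (R : Represents q n v) k → Σ (Represents q n v) λ R′ → Represents.b R′ ≡ Represents.b R + v * k
represents-shift q n v R k = record
  { b = b + v * k ; c = c + + 2 * b * k + v * k * k
  ; det = trans (shifted v b c k) det
  ; equiv = equiv-trans g f q (subst (Equiv g) act≡f (act-equiv g (+ 1) (- k) (+ 0) (+ 1) (inj₁ (unit k)))) equiv } , refl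
  where
  open Represents R
  f = bqf v (+ 2 * b) c
  g = bqf v (+ 2 * (b + v * k)) (c + + 2 * b * k + v * k * k)
  shifted : ∀ v b c k → v * (c + + 2 * b * k + v * k * k) - (b + v * k) * (b + v * k) ≡ v * c - b * b
  shifted = solve-∀
  unit : ∀ k → + 1 * + 1 - - k * + 0 ≡ + 1
  unit = solve-∀
  act≡f : act g (+ 1) (- k) (+ 0) (+ 1) ≡ f
  act≡f = bqf-cong (e₁ v b c k) (e₂ v b c k) (e₃ v b c k)
    where
    e₁ : ∀ v b c k → v * (+ 1 * + 1) + + 2 * (b + v * k) * (+ 1 * + 0) + (c + + 2 * b * k + v * k * k) * (+ 0 * + 0) ≡ v
    e₁ = solve-∀
    e₂ : ∀ v b c k → + 2 * v * + 1 * - k + + 2 * (b + v * k) * (+ 1 * + 1 + - k * + 0) + + 2 * (c + + 2 * b * k + v * k * k) * + 0 * + 1 ≡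
      + 2 * b
    e₂ = solve-∀
    e₃ : ∀ v b c k → v * (- k * - k) + + 2 * (b + v * k) * (- k * + 1) + (c + + 2 * b * k + v * k * k) * (+ 1 * + 1) ≡ c
    e₃ = solve-∀

-- Dividing the argument by its gcd g divides the value by g², which preserves coprimality to m.
primitiveValue : ∀ q m → CoprimeValue q m → ∃[ x ] ∃[ y ] Bezout x y × Bezout (evalF q x y) m
primitiveValue q@(bqf a b c) m (x , y , s , t , st) = a′ , b′ , coprime , s * (g * g) , t ,
  trans (cong (_+ t * m) (trans (homogeneous s a b c g a′ b′) (cong₂ (λ u v → s * evalF q u v) (sym a-eq) (sym b-eq)))) st
  where
  open CommonFactor (commonFactor x y)
  homogeneous : ∀ s a b c g x y → s * (g * g) * (a * (x * x) + b * (x * y) + c * (y * y)) ≡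
    s * (a * (g * x * (g * x)) + b * (g * x * (g * y)) + c * (g * y * (g * y)))
  homogeneous = solve-∀

record OddValue (q : BQF) : Set where
  field
    x y κ : ℤ
    bezout : Bezout x y
    positive : + 0 ℤ.< evalF q x y
    odd : evalF q x y ≡ + 1 + + 2 * κ

-- a and c are values at primitive vectors and are not both even.
oddValue : ∀ n → n % 4 ≡ 1 → ∀ a b c → a * c - b * b ≡ + n → Positive (bqf a (+ 2 * b) c) → OddValue (bqf a (+ 2 * b) c)
oddValue n n≡1 a b c Δ pos = decide (parity a) (parity c)
  where
  value₁ : ∀ a b c → a * (+ 1 * + 1) + + 2 * b * (+ 1 * + 0) + c * (+ 0 * + 0) ≡ a
  value₁ = solve-∀
  value₂ : ∀ a b c → a * (+ 0 * + 0) + + 2 * b * (+ 0 * + 1) + c * (+ 1 * + 1) ≡ c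
  value₂ = solve-∀
  Parity : ℤ → Set
  Parity z = ∃[ k ] (z ≡ + 2 * k ⊎ z ≡ + 1 + + 2 * k)
  decide : Parity a → Parity c → OddValue (bqf a (+ 2 * b) c)
  decide (κ , inj₂ p) _ = record
    { x = + 1 ; y = + 0 ; κ = κ ; bezout = + 1 , + 0 , refl
    ; positive = pos (+ 1) (+ 0) (λ { (() , _) }) ; odd = trans (value₁ a b c) p }
  decide (_ , inj₁ _) (κ , inj₂ p) = record
    { x = + 0 ; y = + 1 ; κ = κ ; bezout = + 0 , + 1 , refl
    ; positive = pos (+ 0) (+ 1) (λ { (_ , ()) }) ; odd = trans (value₂ a b c) p }
  decide (k , inj₁ p) (l , inj₁ r) = ⊥-elim (det≡1mod4⇒notBothEven n n≡1 a b c Δ k l (p , r))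

record Concordant (q₁ q₂ : BQF) (n : ℤ) : Set where
  field
    a₁ a₂ B C κ : ℤ
    det : a₁ * (a₂ * C) - B * B ≡ n
    coprime : Bezout a₁ a₂
    positive : + 0 ℤ.< a₁
    odd : a₁ ≡ + 1 + + 2 * κ
    equiv₁ : Equiv (bqf a₁ (+ 2 * B) (a₂ * C)) q₁
    equiv₂ : Equiv (bqf a₂ (+ 2 * B) (a₁ * C)) q₂

-- With a common middle coefficient, a₁c₁ = b² + n = a₂c₂. Coprimality of a₁ and a₂ forces c₁ = a₂C
-- and c₂ = a₁C.
concordant-represents : ∀ {n} → SquareFree n → ∀ q₁ q₂ a₁ a₂ κ → Bezout a₁ a₂ → + 0 ℤ.< a₁ → a₁ ≡ + 1 + + 2 * κ →
  (R₁ : Represents q₁ (+ n) a₁) (R₂ : Represents q₂ (+ n) a₂) → Represents.b R₁ ≡ Represents.b R₂ → Concordant q₁ q₂ (+ n)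
concordant-represents {n} sf q₁ q₂ a₁ a₂ κ coprime@(s , t , st) pos odd R₁ R₂ b≡ = record
  { a₁ = a₁ ; a₂ = a₂ ; B = b ; C = C ; κ = κ
  ; det = subst (λ c → a₁ * c - b * b ≡ + n) c₁≡ (Represents.det R₁)
  ; coprime = coprime ; positive = pos ; odd = odd
  ; equiv₁ = subst (λ c → Equiv (bqf a₁ (+ 2 * b) c) q₁) c₁≡ (Represents.equiv R₁)
  ; equiv₂ = subst₂ (λ b c → Equiv (bqf a₂ (+ 2 * b) c) q₂) (sym b≡) c₂≡ (Represents.equiv R₂) }
  where
  b = Represents.b R₁
  c₁ = Represents.c R₁
  c₂ = Represents.c R₂
  -- The quotient c₁ / a₂, read off from c₁ = (s a₁ + t a₂) c₁ with a₁c₁ replaced by a₂c₂.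
  C = s * c₂ + t * c₁
  det₂ : a₂ * c₂ - b * b ≡ + n
  det₂ = subst (λ b → a₂ * c₂ - b * b ≡ + n) (sym b≡) (Represents.det R₂)
  product≡ : a₁ * c₁ ≡ a₂ * c₂
  product≡ = trans (det⇒product a₁ b c₁ (Represents.det R₁)) (sym (det⇒product a₂ b c₂ det₂))
  a₂≢0 : a₂ ≢ + 0
  a₂≢0 = det⇒≢0 sf b (det⇒product a₂ b c₂ det₂)
  c₁≡ : c₁ ≡ a₂ * C
  c₁≡ = begin
    c₁                                    ≡⟨ sym (ℤ.*-identityˡ c₁) ⟩
    + 1 * c₁                              ≡⟨ cong (_* c₁) (sym st) ⟩
    (s * a₁ + t * a₂) * c₁                ≡⟨ split s a₁ t a₂ c₁ ⟩
    s * (a₁ * c₁) + t * a₂ * c₁           ≡⟨ cong (λ x → s * x + t * a₂ * c₁) product≡ ⟩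
    s * (a₂ * c₂) + t * a₂ * c₁           ≡⟨ collect s a₂ c₂ t c₁ ⟩
    a₂ * (s * c₂ + t * c₁)                ∎
    where
    split : ∀ s a t b c → (s * a + t * b) * c ≡ s * (a * c) + t * b * c
    split = solve-∀
    collect : ∀ s a d t c → s * (a * d) + t * a * c ≡ a * (s * d + t * c)
    collect = solve-∀
  c₂≡ : c₂ ≡ a₁ * C
  c₂≡ = *-cancelˡ a₂≢0 (trans (sym product≡) (trans (cong (a₁ *_) c₁≡) (rearr a₁ a₂ C)))
    where
    rearr : ∀ a b c → a * (b * c) ≡ b * (a * c)
    rearr = solve-∀

-- Each bᵢ may be moved by multiples of aᵢ, and the aᵢ are coprime, so the Chinese remainder theorem
-- makes the two middle coefficients equal.
concordant-values : ∀ {n} → SquareFree n → ∀ q₁ q₂ a₁ a₂ κ → Bezout a₁ a₂ → + 0 ℤ.< a₁ → a₁ ≡ + 1 + + 2 * κ →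
  Represents q₁ (+ n) a₁ → Represents q₂ (+ n) a₂ → Concordant q₁ q₂ (+ n)
concordant-values {n} sf q₁ q₂ a₁ a₂ κ (s , t , st) pos odd R₁ R₂ =
  concordant-represents sf q₁ q₂ a₁ a₂ κ (s , t , st) pos odd (proj₁ S₁) (proj₁ S₂) (trans (proj₂ S₁) (trans meet (sym (proj₂ S₂))))
  where
  b₁ = Represents.b R₁
  b₂ = Represents.b R₂
  S₁ = represents-shift q₁ (+ n) a₁ R₁ (s * (b₂ - b₁))
  S₂ = represents-shift q₂ (+ n) a₂ R₂ (t * (b₁ - b₂))
  meet : b₁ + a₁ * (s * (b₂ - b₁)) ≡ b₂ + a₂ * (t * (b₁ - b₂))
  meet = trans (expand b₁ b₂ s a₁ t a₂) (trans (cong (λ r → b₂ + a₂ * (t * (b₁ - b₂)) + (+ 1 - r) * (b₁ - b₂)) st) (drop b₂ (a₂ * (t * (b₁ - b₂))) (b₁ - b₂)))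
    where
    expand : ∀ x y s a t b → x + a * (s * (y - x)) ≡ y + b * (t * (x - y)) + (+ 1 - (s * a + t * b)) * (x - y)
    expand = solve-∀
    drop : ∀ x y z → x + y + (+ 1 - + 1) * z ≡ x + y
    drop = solve-∀

-- The order of choice matters: the odd value a₁ of q₁ is fixed before a value of q₂ prime to it is
-- sought.
concordant : ∀ {n} → SquareFree n → n % 4 ≡ 1 → ∀ q₁ q₂ → Positive q₁ → disc q₁ ≡ - (+ 4 * + n) → disc q₂ ≡ - (+ 4 * + n) → Concordant q₁ q₂ (+ n)
concordant {n} sf n≡1 q₁ q₂ pos₁ D₁ D₂ = fromEven (disc-even q₁ (+ n) D₁) (disc-even q₂ (+ n) D₂)
  where
  fromEven : (∃[ b ] q₁ ≡ bqf (BQF.a q₁) (+ 2 * b) (BQF.c q₁)) → (∃[ b ] q₂ ≡ bqf (BQF.a q₂) (+ 2 * b) (BQF.c q₂)) → Concordant q₁ q₂ (+ n)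
  fromEven (b₁ , q₁≡) (b₂ , q₂≡) = fromOdd (subst OddValue (sym q₁≡)
    (oddValue n n≡1 (BQF.a q₁) b₁ (BQF.c q₁) (disc⇒det (BQF.a q₁) b₁ (BQF.c q₁) (+ n) (trans (cong disc (sym q₁≡)) D₁)) (subst Positive q₁≡ pos₁)))
    where
    fromOdd : OddValue q₁ → Concordant q₁ q₂ (+ n)
    fromOdd V = fromCoprime (primitiveValue q₂ a₁ (subst₂ CoprimeValue (sym q₂≡) (ℤ.0≤i⇒+∣i∣≡i (ℤ.<⇒≤ positive))
      (coprimeValue sf n≡1 (BQF.a q₂) b₂ (BQF.c q₂) (disc⇒det (BQF.a q₂) b₂ (BQF.c q₂) (+ n) (trans (cong disc (sym q₂≡)) D₂)) ∣ a₁ ∣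
        {{ℤ.≢-nonZero (λ p → ℤ.<⇒≢ positive (sym p))}})))
      where
      open OddValue V
      a₁ = evalF q₁ x y
      fromCoprime : (∃[ x′ ] ∃[ y′ ] Bezout x′ y′ × Bezout (evalF q₂ x′ y′) a₁) → Concordant q₁ q₂ (+ n)
      fromCoprime (x′ , y′ , prim , cop) = concordant-values sf q₁ q₂ a₁ (evalF q₂ x′ y′) κ (bezout-sym {evalF q₂ x′ y′} {a₁} cop) positive odd
        (represents-primitive q₁ (+ n) x y D₁ bezout) (represents-primitive q₂ (+ n) x′ y′ D₂ prim)

-- Dirichlet's composition. If θ² = 2Bθ - a₁a₂C, then (a₁x + θy)(a₂z + θw) = a₁a₂X + θY with X = xz
-- - Cyw and Y = a₁xw + a₂yz + 2Byw; these are the coordinates of μ.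
concordant-composition : ∀ a₁ a₂ B C → Bezout a₁ a₂ →
  IsLegendreComposition (bqf a₁ (+ 2 * B) (a₂ * C)) (bqf a₂ (+ 2 * B) (a₁ * C)) (bqf (a₁ * a₂) (+ 2 * B) C)
concordant-composition a₁ a₂ B C (s , t , st) = μ , (λ w → T w , λ { 0F → X w ; 1F → Y w }) ,
  λ u v → identity a₁ a₂ B C (u 0F) (u 1F) (v 0F) (v 1F)
  where
  μ : Fin 2 → Fin 2 → Vecℤ 2
  μ 0F 0F 0F = + 1
  μ 0F 0F 1F = + 0
  μ 0F 1F 0F = + 0
  μ 0F 1F 1F = a₁
  μ 1F 0F 0F = + 0
  μ 1F 0F 1F = a₂
  μ 1F 1F 0F = - C
  μ 1F 1F 1F = + 2 * B
  -- The image contains (1, 0), (0, a₁) and (0, a₂); Bezout combines the last two to (0, 1).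
  T : Vecℤ 2 → Fin 2 → Fin 2 → ℤ
  T w 0F 0F = w 0F
  T w 0F 1F = w 1F * s
  T w 1F 0F = w 1F * t
  T w 1F 1F = + 0
  X : ∀ w → tensorApply μ (T w) 0F ≡ w 0F
  X w = first (w 0F) (w 1F) s t C
    where
    first : ∀ x y s t C → x * + 1 + y * s * + 0 + y * t * + 0 + + 0 * - C ≡ x
    first = solve-∀
  Y : ∀ w → tensorApply μ (T w) 1F ≡ w 1F
  Y w = trans (second (w 0F) (w 1F) s t a₁ a₂ B) (trans (cong (w 1F *_) st) (ℤ.*-identityʳ (w 1F)))
    where
    second : ∀ x y s t a b B → x * + 0 + y * s * a + y * t * b + + 0 * (+ 2 * B) ≡ y * (s * a + t * b)
    second = solve-∀
  identity : ∀ a b B C x y z w →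
    (a * (x * x) + + 2 * B * (x * y) + b * C * (y * y)) * (b * (z * z) + + 2 * B * (z * w) + a * C * (w * w)) ≡
    (let X = x * z * + 1 + x * w * + 0 + y * z * + 0 + y * w * - C
         Y = x * z * + 0 + x * w * a + y * z * b + y * w * (+ 2 * B) in
     a * b * (X * X) + + 2 * B * (X * Y) + C * (Y * Y))
  identity = solve-∀

-- Membership in the genus gives the form only up to equivalence. Changing the basis of the plane by
-- the equivalence makes the Gram numbers exact.
genus-vectors : ∀ {n} A B C → InGenusG n (bqf A (+ 2 * B) C) →
  ∃[ e ] ∃[ f ] dot {3} e e ≡ A × dot {3} e f ≡ B × dot {3} f f ≡ C
genus-vectors A B C (_ , _ , e , f , _ , E@(p , q , r , s , _)) = e′ , f′ , cong BQF.a form≡ , *-cancelˡ {+ 2} (λ ()) (cong BQF.b form≡) , cong BQF.c form≡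
  where
  e′ f′ : Vecℤ 3
  e′ = comb p e r f
  f′ = comb q e s f
  form≡ : FormOf e′ f′ ≡ bqf A (+ 2 * B) C
  form≡ = trans (FormOf-comb e f p q r s) (equiv-act (FormOf e f) (bqf A (+ 2 * B) C) E)

-- The two directions of the equivalence

PlanePair : ℕ → BQF → BQF → Set
PlanePair n q₁ q₂ = Σ (Vecℤ 4) λ u → Σ (Vecℤ 4) λ v →
  Independent u v × Primitive u v × (disc (FormOf u v) ≡ - (+ (4 ℕ.* n))) × Equiv (FormOf u v) q₁ ×
  (Σ (Vecℤ 4) λ u′ → Σ (Vecℤ 4) λ v′ → IsBasis (Perp u v) u′ v′ × Equiv (FormOf u′ v′) q₂)

pair : Vecℤ 4 → Vecℤ 4 → Fin 2 → Vecℤ 4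
pair u v 0F = u
pair u v 1F = v

theorem7p9 : (n : ℕ) → InD n → SquareFree n → n % 4 ≡ 1 →
    (q₁ q₂ : BQF) → Positive q₁ → Positive q₂ →
    disc q₁ ≡ - (+ (4 Data.Nat.* n)) → disc q₂ ≡ - (+ (4 Data.Nat.* n)) →
    (Σ (Vecℤ 4) λ u → Σ (Vecℤ 4) λ v →
    Independent u v × Primitive u v ×
    (disc (FormOf u v) ≡ - (+ (4 Data.Nat.* n))) ×
    Equiv (FormOf u v) q₁ ×
    (Σ (Vecℤ 4) λ u′ → Σ (Vecℤ 4) λ v′ →
    IsBasis (Perp u v) u′ v′ × Equiv (FormOf u′ v′) q₂))
    ⇔ (∀ (q : BQF) → IsLegendreComposition q₁ q₂ q → InGenusG n q)
theorem7p9 n _ sf n≡1 q₁ q₂ pos₁ _ D₁′ D₂′ = mk⇔ planes⇒genus genus⇒planes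
  where
  4n≡ : - (+ (4 ℕ.* n)) ≡ - (+ 4 * + n)
  4n≡ = cong -_ (ℤ.pos-* 4 n)
  D₁ : disc q₁ ≡ - (+ 4 * + n)
  D₁ = trans D₁′ 4n≡
  D₂ : disc q₂ ≡ - (+ 4 * + n)
  D₂ = trans D₂′ 4n≡
  gram : ∀ {k} (u v : Vecℤ k) → disc (FormOf u v) ≡ - (+ 4 * + n) → gramDet u v ≡ + n
  gram u v = disc⇒det (dot u u) (dot u v) (dot v v) (+ n)

  planes⇒genus : PlanePair n q₁ q₂ → ∀ q → IsLegendreComposition q₁ q₂ q → InGenusG n q
  planes⇒genus (u , v , _ , _ , Duv , E₁ , u′ , v′ , ((u′⊥u , u′⊥v) , (v′⊥u , v′⊥v) , _) , E₂) q comp =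
    orthogonal⇒genus sf n≡1 (pair u v) (pair u′ v′) ⊥ (gram u v (trans Duv 4n≡))
      (gram u′ v′ (trans (equiv-disc (FormOf u′ v′) q₂ E₂) D₂)) q
      (composition-equiv q₁ q₂ (FormOf u v) (FormOf u′ v′) q (equiv-sym (FormOf u v) q₁ E₁) (equiv-sym (FormOf u′ v′) q₂ E₂) comp)
    where
    ⊥ : ∀ i j → dot (pair u v i) (pair u′ v′ j) ≡ + 0
    ⊥ 0F 0F = trans (dot-comm u u′) u′⊥u
    ⊥ 0F 1F = trans (dot-comm u v′) v′⊥u
    ⊥ 1F 0F = trans (dot-comm v u′) u′⊥v
    ⊥ 1F 1F = trans (dot-comm v v′) v′⊥v

  genus⇒planes : (∀ q → IsLegendreComposition q₁ q₂ q → InGenusG n q) → PlanePair n q₁ q₂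
  genus⇒planes genus = fromConcordant (concordant sf n≡1 q₁ q₂ pos₁ D₁ D₂)
    where
    fromPlanes : ∀ {f₁ f₂} → Equiv f₁ q₁ → Equiv f₂ q₂ → OrthogonalPlanes f₁ f₂ → PlanePair n q₁ q₂
    fromPlanes E₁ E₂ planes = x 0F , x 1F ,
      gramDet-independent (x 0F) (x 1F) (λ p → squareFree⇒≢0 sf (trans (sym Δx) p)) , squareFree-primitive sf (x 0F) (x 1F) Δx ,
      trans Dx (sym 4n≡) , Ex , y 0F , y 1F , perp-basis sf x y orthogonal Δx Δy , Ey
      where
      open OrthogonalPlanes planes
      Ex : Equiv (FormOf (x 0F) (x 1F)) q₁
      Ex = subst (λ g → Equiv g q₁) (sym form-x) E₁
      Ey : Equiv (FormOf (y 0F) (y 1F)) q₂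
      Ey = subst (λ g → Equiv g q₂) (sym form-y) E₂
      Dx : disc (FormOf (x 0F) (x 1F)) ≡ - (+ 4 * + n)
      Dx = trans (equiv-disc (FormOf (x 0F) (x 1F)) q₁ Ex) D₁
      Dy : disc (FormOf (y 0F) (y 1F)) ≡ - (+ 4 * + n)
      Dy = trans (equiv-disc (FormOf (y 0F) (y 1F)) q₂ Ey) D₂
      Δx : gramDet (x 0F) (x 1F) ≡ + n
      Δx = gram (x 0F) (x 1F) Dx
      Δy : gramDet (y 0F) (y 1F) ≡ + n
      Δy = gram (y 0F) (y 1F) Dy
    fromConcordant : Concordant q₁ q₂ (+ n) → PlanePair n q₁ q₂
    -- The hypothesis is applied to the Dirichlet composite alone, transported from the concordant
    -- representatives to q₁ and q₂.
    fromConcordant c = fromVectors (genus-vectors (a₁ * a₂) B C (genus (bqf (a₁ * a₂) (+ 2 * B) C)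
      (composition-equiv (bqf a₁ (+ 2 * B) (a₂ * C)) (bqf a₂ (+ 2 * B) (a₁ * C)) q₁ q₂ (bqf (a₁ * a₂) (+ 2 * B) C) equiv₁ equiv₂
        (concordant-composition a₁ a₂ B C coprime))))
      where
      open Concordant c
      a₂≢0 : a₂ ≢ + 0
      a₂≢0 = det⇒≢0 sf {j = a₁ * C} B (trans (rearr a₂ a₁ C) (det⇒product a₁ B (a₂ * C) det))
        where
        rearr : ∀ a b c → a * (b * c) ≡ b * (a * c)
        rearr = solve-∀
      fromVectors : (∃[ e ] ∃[ f ] dot {3} e e ≡ a₁ * a₂ × dot {3} e f ≡ B × dot {3} f f ≡ C) → PlanePair n q₁ q₂
      fromVectors (e , f , ee , ef , ff) = fromPlanes {bqf a₁ (+ 2 * B) (a₂ * C)} {bqf a₂ (+ 2 * B) (a₁ * C)} equiv₁ equiv₂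
        (orthogonalPlanes e f a₁ a₂ B C κ ee ef ff positive odd a₂≢0 coprime)
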